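{- There is an absolute constant $\varepsilon>0$ such that every $n$-vertex graph ($n\geq 3$) with average degree $d\geq 2\log\log n$ has a $64$-almost-regular subgraph with average degree at least $\varepsilon\,\frac{(d/\log\log n)^{1/4}}{(\log(d/\log\log n))^{1/2}}$. Furthermore, for every positive integer $t$ there is $\varepsilon_t>0$ such that every $n$-vertex graph ($n\geq 3$) not containing $K_{t,t}$ as a subgraph, with average degree $d\geq 2\log\log n$, has a $64$-almost-regular subgraph with average degree at least $\varepsilon_t\,\frac{(d/\log\log n)^{1/2}}{\log(d/\log\log n)}$.
   Context: Logarithms are to base $2$. A graph is $K$-almost-regular if its maximum degree is at most $K$ times its minimum degree; subgraphs are non-empty; average degree is $2e/|V|$. -}

module Defs where

import Algebra.Definitions.RawSemiring
open import Data.Fin.Base using (Fin; splitAt)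
open import Data.Integer.Base using (ℤ; +_; -[1+_])
open import Data.List.Base using (allFin; cartesianProduct; filter; length; map)
open import Data.List.Extrema.Nat using (max; min)
open import Data.Nat.Base as ℕ using (ℕ; suc; NonZero)
open import Data.Product.Base using (∃; ∃₂; Σ; _×_; _,_)
open import Data.Rational.Base as ℚ using (ℚ; 0ℚ; ½; ↥_; ↧ₙ_; _/_)
open import Data.Sum.Base using (_⊎_; [_,_]′)
open import Data.Bool.Base using (Bool; true; false)
import Data.Bool.Properties as Bool
import Data.Fin.Properties as Fin
open import Function.Base using (_∘_; const)
open import Function.Definitions using (Injective)
open import Level using (0ℓ)
open import Relation.Binary.Core using (Rel)
open import Relation.Binary.Definitions using (Decidable; Irreflexive; Symmetric)
open import Relation.Binary.PropositionalEquality using (_≡_; _≢_; ≢-sym; refl)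
open import Relation.Nullary.Decidable using (¬?; _×-dec_)

open Algebra.Definitions.RawSemiring ℚ.+-*-rawSemiring public
  using () renaming (_^_ to _^ℚ_)

------------------------------------------------------------------------
-- Real numbers

-- A real x is given by its Dedekind cut: `q <ᴸ x` is the set of rationals
-- q < x and `x <ᵁ q` the set of rationals q > x. Only the two sets are
-- recorded. As usual for total versions of partial functions, each operation
-- below yields the cut of the intended real on the domain stated with it and
-- carries no meaning elsewhere.

infix 4 _<ᴸ_ _<ᵁ_ _≤ᴿ_
infixl 7 _÷_
infixr 8 _·_

record ℝ : Set₁ where
  field
    below : ℚ → Set
    above : ℚ → Set

_<ᴸ_ : ℚ → ℝ → Set
q <ᴸ x = ℝ.below x q

_<ᵁ_ : ℝ → ℚ → Set
x <ᵁ q = ℝ.above x q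

_≤ᴿ_ : ℝ → ℝ → Set
x ≤ᴿ y = ∀ {q} → q <ᴸ x → q <ᴸ y

fromℚ : ℚ → ℝ
fromℚ p = record { below = ℚ._< p ; above = p ℚ.<_ }

fromℕ : ℕ → ℝ
fromℕ k = fromℚ (+ k / 1)

-- Domain: c > 0.
_·_ : ℚ → ℝ → ℝ
c · x = record
  { below = λ q → ∃ λ r → r <ᴸ x × q ℚ.< c ℚ.* r
  ; above = λ q → ∃ λ r → x <ᵁ r × c ℚ.* r ℚ.< q
  }

-- Domain: x ≥ 0 and y > 0.
_÷_ : ℝ → ℝ → ℝ
x ÷ y = record
  { below = λ q → ∃₂ λ r s → r <ᴸ x × y <ᵁ s × q ℚ.* s ℚ.< r
  ; above = λ q → ∃₂ λ r s → x <ᵁ r × s <ᴸ y × 0ℚ ℚ.< s × r ℚ.< q ℚ.* s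
  }

-- x ^ (1 / k). Domain: k ≥ 1 and x ≥ 0.
root : ℕ → ℝ → ℝ
root k x = record
  { below = λ q → q ℚ.< 0ℚ ⊎ (q ^ℚ k) <ᴸ x
  ; above = λ q → 0ℚ ℚ.< q × x <ᵁ (q ^ℚ k)
  }

2ℚ : ℚ
2ℚ = + 2 / 1

2^_ : ℤ → ℚ
2^ (+ k)     = 2ℚ ^ℚ k
2^ (-[1+ k ]) = ½ ^ℚ suc k

-- The logarithm to base 2. For q = a / b with b ≥ 1 and r > 0, the relation
-- q < log₂ r means 2 ^ a < r ^ b. Domain: x > 0.
log₂ : ℝ → ℝ
log₂ x = record
  { below = λ q → ∃ λ r → r <ᴸ x × 0ℚ ℚ.< r × 2^ (↥ q) ℚ.< r ^ℚ (↧ₙ q)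
  ; above = λ q → ∃ λ r → x <ᵁ r × r ^ℚ (↧ₙ q) ℚ.< 2^ (↥ q)
  }

------------------------------------------------------------------------
-- Finite simple graphs

record Graph (n : ℕ) : Set₁ where
  field
    _~_    : Rel (Fin n) 0ℓ
    _~?_   : Decidable _~_
    sym    : Symmetric _~_
    irrefl : Irreflexive _≡_ _~_

module _ {n : ℕ} (G : Graph n) where
  open Graph G

  degree : Fin n → ℕ
  degree v = length (filter (v ~?_) (allFin n))

  maxDegree : ℕ
  maxDegree = max 0 (map degree (allFin n))

  -- Degrees are less than n, so the default value n is never attained for n ≥ 1.
  minDegree : ℕ
  minDegree = min n (map degree (allFin n))

  -- Each edge is counted once, as the pair (u , v) of its ends with u < v.
  edgeCount : ℕ
  edgeCount = length (filter (λ (u , v) → (u Fin.<? v) ×-dec (u ~? v))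
                             (cartesianProduct (allFin n) (allFin n)))

  averageDegree : .{{_ : NonZero n}} → ℚ
  averageDegree = + (2 ℕ.* edgeCount) / n

  AlmostRegular : ℕ → Set
  AlmostRegular K = maxDegree ℕ.≤ K ℕ.* minDegree

-- H ⊑ G: G contains H as a (not necessarily induced) subgraph, up to the
-- naming of the vertices.
infix 4 _⊑_
_⊑_ : ∀ {m n} → Graph m → Graph n → Set
_⊑_ {m} {n} H G =
  Σ (Fin m → Fin n) λ f →
    Injective _≡_ _≡_ f × (∀ {u v} → Graph._~_ H u v → Graph._~_ G (f u) (f v))

completeBipartite : ∀ s t → Graph (s ℕ.+ t)
completeBipartite s t = record
  { _~_    = λ u v → side u ≢ side v
  ; _~?_   = λ u v → ¬? (side u Bool.≟ side v)
  ; sym    = ≢-sym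
  ; irrefl = λ { refl u≢u → u≢u refl }
  }
  where
  side : Fin (s ℕ.+ t) → Bool
  side = [ const true , const false ]′ ∘ splitAt s

record Subgraph {n : ℕ} (G : Graph n) : Set₁ where
  field
    order        : ℕ
    {{nonEmpty}} : NonZero order
    graph        : Graph order
    embedding    : graph ⊑ G

HasAlmostRegularSubgraph : ∀ {n} → ℕ → Graph n → ℝ → Set₁
HasAlmostRegularSubgraph K G x =
  Σ (Subgraph G) λ H → let open Subgraph H in
    AlmostRegular graph K × x ≤ᴿ fromℚ (averageDegree graph)

{-# OPTIONS --safe #-}

-- By summing over ranges of degrees it suffices to treat a bipartite graph between rows A and
-- columns B in which every row has at most d entries and the column degrees lie in a range
-- [2 ^ L , 2 ^ (L + s)] with s small compared to L: there are only O (r t log log n) such ranges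
-- above the degrees that are handled by plain dyadic ranges, which is where log log n comes from.
--
-- In such a range, let each row keep r t entries. If many rows have an entry b with t further
-- entries whose codegree with b is large, then counting as for the Kővári–Sós–Turán theorem
-- gives a K t t. Otherwise many rows have r entries of pairwise small codegree. Choose a random
-- set S of columns, each with probability proportional to its degree, and weight the rows inside
-- S so that all rows have the same expected weight. As codegrees are small, the second moments
-- show that some S spans a graph in which all rows have weight-degree r and nearly all columns
-- have comparable weight-degree. A greedy choice of rows turns it into an almost regular graph of
-- degree about r; the leftover of an unsuccessful greedy choice would violate the moment bound.
--
-- The general case is the case t = r, as K r r is itself regular.

module Submission where

open import Defs
import Algebra.Bundles as Bundles
import Algebra.Properties.CommutativeMonoid.Sum as Product
import Algebra.Properties.CommutativeSemiring.Exp as Exp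
import Algebra.Properties.Semiring.Sum as Sum
open import Data.Bool.Base using (Bool; true; false; not; _∧_; _∨_; if_then_else_)
import Data.Bool.Properties as Bool
open import Data.Empty using (⊥)
open import Data.Fin.Base using (Fin; zero; suc; punchIn; splitAt; _↑ˡ_; _↑ʳ_)
import Data.Fin.Properties as Fin
import Data.Integer.Base as ℤ
import Data.Integer.Properties as ℤ
open import Data.List.Base using (List; []; _∷_)
import Data.List.Base as List
open import Data.List.Extrema.Nat using (max≤v⁺; v≤min⁺)
import Data.List.Properties as List
import Data.List.Relation.Unary.All.Properties as All
open import Data.Nat.Base
  using (ℕ; zero; suc; NonZero; >-nonZero; >-nonZero⁻¹; ≢-nonZero; _+_; _*_; _∸_; _^_; _/_; _⊔_; _≤_; _<_; z≤n; s≤s; s≤s⁻¹)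
open import Data.Nat.DivMod using (_%_; m≡m%n+[m/n]*n; m%n<n; m/n*n≤m; m≥n⇒m/n>0)
open import Data.Nat.Properties
open import Data.Nat.Tactic.RingSolver using (solve-∀)
open import Data.Product.Base using (∃; ∃₂; Σ; _×_; _,_; proj₁; proj₂)
open import Data.Rational.Base as ℚ using (ℚ; 0ℚ; 1ℚ; ½; ↥_; ↧ₙ_)
import Data.Rational.Properties as ℚ
import Data.Rational.Unnormalised.Base as ℚᵘ
import Data.Rational.Unnormalised.Properties as ℚᵘ
open import Data.Sum.Base using (_⊎_; inj₁; inj₂; [_,_]′)
import Data.Vec.Functional as Vector
open import Function.Base using (_∘_; id; case_of_)
open import Function.Definitions using (Injective)
open import Relation.Binary.Definitions using (tri<; tri≈; tri>)
open import Relation.Binary.PropositionalEquality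
open import Relation.Nullary using (¬_; Dec; yes; no; does; contradiction)
open import Relation.Nullary.Decidable using (dec-true; dec-false; _×-dec_)

open Sum +-*-semiring
  using (sum-remove; ∑-distrib-+; ∑-comm; *-distribˡ-sum; *-distribʳ-sum) renaming (sum to ∑; sum-cong-≗ to ∑-cong)
open Product *-1-commutativeMonoid
  using () renaming (sum to ∏; sum-cong-≗ to ∏-cong; ∑-distrib-+ to ∏-distrib-*; sum-remove to ∏-remove)

open Exp (Bundles.CommutativeRing.commutativeSemiring ℚ.+-*-commutativeRing)
  using () renaming (^-homo-* to ^ℚ-homo-*; ^-assocʳ to ^ℚ-assocʳ; ^-distrib-* to ^ℚ-distrib-*)

-- Finite sums of natural numbers

-- Plain dyadic ranges could treat every column degree, but each of them may lose `κ * 64` entries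
-- per row, and about log n of them would be needed. A range of ratio 2 ^ s loses `R * 2` entries
-- per row, and s may grow in proportion to L, so the exponents grow geometrically. The price is
-- that column degrees inside a range are far from comparable. Sampling evens them out: a column of
-- not too small degree c survives with probability about c / N, and given survival the expected
-- total weight of its rows is about N, whatever c is. The weights that compensate for the sampling
-- can reach 2 ^ (2 s r), and codegrees must be smaller than column degrees by this factor, so s
-- must be small against L. A subgraph of degree κ costs an initial degree of order κ ^ 2 t ^ 2
-- log(d / log log n) log log n: a constant t leads to the exponent 1/2, and t = κ to 1/4.
-- Expectations remain natural numbers after multiplication by the product of the inverse
-- probabilities.

𝟙 : Bool → ℕ
𝟙 true  = 1
𝟙 false = 0

# : ∀ {n} → (Fin n → Bool) → ℕ
# f = ∑ (λ i → 𝟙 (f i))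

_⊆_ : ∀ {n} → (Fin n → Bool) → (Fin n → Bool) → Set
f ⊆ g = ∀ i → f i ≡ true → g i ≡ true

true≢false : ∀ {b} → b ≡ true → b ≡ false → ⊥
true≢false refl ()

∧-true : ∀ {a b} → a ∧ b ≡ true → a ≡ true × b ≡ true
∧-true {true} {true} _ = refl , refl

∧-intro : ∀ {a b} → a ≡ true → b ≡ true → a ∧ b ≡ true
∧-intro refl refl = refl

𝟙≤1 : ∀ b → 𝟙 b ≤ 1
𝟙≤1 true  = ≤-refl
𝟙≤1 false = z≤n

𝟙-mono : ∀ {a b} → (a ≡ true → b ≡ true) → 𝟙 a ≤ 𝟙 b
𝟙-mono {true}  a⇒b rewrite a⇒b refl = ≤-refl
𝟙-mono {false} _   = z≤n

𝟙-∧ : ∀ a b → 𝟙 (a ∧ b) ≡ 𝟙 a * 𝟙 b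
𝟙-∧ true  b = sym (+-identityʳ (𝟙 b))
𝟙-∧ false b = refl

𝟙-split : ∀ a b → 𝟙 a ≡ 𝟙 (a ∧ b) + 𝟙 (a ∧ not b)
𝟙-split true  true  = refl
𝟙-split true  false = refl
𝟙-split false b     = refl

0<𝟙 : ∀ {b} → 0 < 𝟙 b → b ≡ true
0<𝟙 {true} _ = refl

𝟙-*-≤ : ∀ b {x y} → (b ≡ true → x ≤ y) → 𝟙 b * x ≤ 𝟙 b * y
𝟙-*-≤ true  x≤y = +-monoˡ-≤ 0 (x≤y refl)
𝟙-*-≤ false _   = z≤n

∑-mono : ∀ {n} {f g : Fin n → ℕ} → (∀ i → f i ≤ g i) → ∑ f ≤ ∑ g
∑-mono {zero}  f≤g = z≤n
∑-mono {suc n} f≤g = +-mono-≤ (f≤g zero) (∑-mono (f≤g ∘ suc))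

∑-const : ∀ n c → ∑ {n} (λ _ → c) ≡ n * c
∑-const zero    c = refl
∑-const (suc n) c = cong (c +_) (∑-const n c)

∑-zero : ∀ {n} {f : Fin n → ℕ} → (∀ i → f i ≡ 0) → ∑ f ≡ 0
∑-zero {n} f≡0 = trans (∑-cong f≡0) (trans (∑-const n 0) (*-zeroʳ n))

f≤∑ : ∀ {n} (f : Fin n → ℕ) i → f i ≤ ∑ f
f≤∑ f zero    = m≤m+n _ _
f≤∑ f (suc i) = ≤-trans (f≤∑ (f ∘ suc) i) (m≤n+m _ _)

∑≡0⇒ : ∀ {n} (f : Fin n → ℕ) → ∑ f ≡ 0 → ∀ i → f i ≡ 0
∑≡0⇒ f ∑≡0 i = n≤0⇒n≡0 (≤-trans (f≤∑ f i) (≤-reflexive ∑≡0))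

∑<∑⇒∃ : ∀ {n} (f g : Fin n → ℕ) → ∑ f < ∑ g → ∃ λ i → f i < g i
∑<∑⇒∃ {suc n} f g lt with f zero <? g zero
... | yes f₀<g₀ = zero , f₀<g₀
... | no  f₀≮g₀ with ∑<∑⇒∃ (f ∘ suc) (g ∘ suc)
                     (+-cancelˡ-< (g zero) _ _ (≤-<-trans (+-monoˡ-≤ _ (≮⇒≥ f₀≮g₀)) lt))
...   | i , fᵢ<gᵢ = suc i , fᵢ<gᵢ

0<∑⇒∃ : ∀ {n} (f : Fin n → ℕ) → 0 < ∑ f → ∃ λ i → 0 < f i
0<∑⇒∃ {n} f 0<∑ = ∑<∑⇒∃ (λ _ → 0) f (subst (_< ∑ f) (sym (∑-zero {n} (λ _ → refl))) 0<∑)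

0<#⇒∃ : ∀ {n} (f : Fin n → Bool) → 0 < # f → ∃ λ i → f i ≡ true
0<#⇒∃ f 0<# with 0<∑⇒∃ (𝟙 ∘ f) 0<#
... | i , 0<fᵢ = i , 0<𝟙 0<fᵢ

0<# : ∀ {n} (f : Fin n → Bool) {i} → f i ≡ true → 0 < # f
0<# f {i} fᵢ = ≤-trans (≤-reflexive (cong 𝟙 (sym fᵢ))) (f≤∑ (𝟙 ∘ f) i)

#-mono : ∀ {n} {f g : Fin n → Bool} → f ⊆ g → # f ≤ # g
#-mono f⊆g = ∑-mono (λ i → 𝟙-mono (f⊆g i))

#≤n : ∀ {n} (f : Fin n → Bool) → # f ≤ n
#≤n {n} f = ≤-trans (∑-mono (𝟙≤1 ∘ f)) (≤-reflexive (trans (∑-const n 1) (*-identityʳ n)))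

∑-linear : ∀ {n} c (f g : Fin n → ℕ) → ∑ (λ i → f i + c * g i) ≡ ∑ f + c * ∑ g
∑-linear c f g = trans (∑-distrib-+ f _) (cong (∑ f +_) (sym (*-distribˡ-sum c g)))

∑-*ˡ : ∀ {n} c (f : Fin n → ℕ) → ∑ (λ i → c * f i) ≡ c * ∑ f
∑-*ˡ c f = sym (*-distribˡ-sum c f)

∑-*ʳ : ∀ {n} c (f : Fin n → ℕ) → ∑ (λ i → f i * c) ≡ ∑ f * c
∑-*ʳ c f = sym (*-distribʳ-sum c f)

∑-splitAt : ∀ s {t} (f : Fin (s + t) → ℕ) → ∑ f ≡ ∑ (λ i → f (i ↑ˡ t)) + ∑ (λ j → f (s ↑ʳ j))
∑-splitAt zero    f = refl
∑-splitAt (suc s) f = trans (cong (f zero +_) (∑-splitAt s (f ∘ suc))) (sym (+-assoc (f zero) _ _))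

select : ∀ {n} (f : Fin n → Bool) k → k ≤ # f → ∃ λ g → g ⊆ f × # g ≡ k
select {zero}  f zero    _ = (λ ()) , (λ ()) , refl
select {suc n} f zero    _ = (λ _ → false) , (λ _ ()) , ∑-zero {suc n} (λ _ → refl)
select {suc n} f (suc k) k<# with f zero in f₀
... | false with select (f ∘ suc) (suc k) k<#
...   | g , g⊆f , #g = (false Vector.∷ g) , (λ { zero () ; (suc i) → g⊆f i }) , #g
select {suc n} f (suc k) (s≤s k≤#) | true with select (f ∘ suc) k k≤#
...   | g , g⊆f , #g = (true Vector.∷ g) , (λ { zero _ → f₀ ; (suc i) → g⊆f i }) , cong suc #g

enumerate : ∀ {n} (f : Fin n → Bool) t → t ≤ # f →
            ∃ λ (e : Fin t → Fin n) → Injective _≡_ _≡_ e × (∀ i → f (e i) ≡ true)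
enumerate f zero _ = (λ ()) , (λ { {()} }) , λ ()
enumerate {suc n} f (suc t) t<# with f zero in f₀
... | false with enumerate (f ∘ suc) (suc t) t<#
...   | e , inj , fe = suc ∘ e , (λ eq → inj (Fin.suc-injective eq)) , fe
enumerate {suc n} f (suc t) (s≤s t≤#) | true with enumerate (f ∘ suc) t t≤#
...   | e , inj , fe = (zero Vector.∷ (suc ∘ e)) , injective , λ { zero → f₀ ; (suc i) → fe i }
  where
  injective : Injective _≡_ _≡_ (zero Vector.∷ (suc ∘ e))
  injective {zero}  {zero}  _  = refl
  injective {suc i} {suc j} eq = cong suc (inj (Fin.suc-injective eq))

-- Degrees, edge counts and subgraphs

module _ {n : ℕ} (G : Graph n) where
  open Graph G hiding (sym)

  adjacent : Fin n → Fin n → Bool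
  adjacent u v = does (u ~? v)

  adjacent⇒~ : ∀ {u v} → adjacent u v ≡ true → u ~ v
  adjacent⇒~ {u} {v} eq with u ~? v
  ... | yes u~v = u~v

  adjacent-sym : ∀ u v → adjacent u v ≡ adjacent v u
  adjacent-sym u v with u ~? v
  ... | yes u~v = sym (dec-true (v ~? u) (Graph.sym G u~v))
  ... | no  u≁v = sym (dec-false (v ~? u) (u≁v ∘ Graph.sym G))

  adjacent-irrefl : ∀ v → adjacent v v ≡ false
  adjacent-irrefl v = dec-false (v ~? v) (irrefl refl)

length-filter-tabulate : ∀ {n a p} {A : Set a} {P : A → Set p} (P? : ∀ x → Dec (P x)) (f : Fin n → A) →
                         List.length (List.filter P? (List.tabulate f)) ≡ # (does ∘ P? ∘ f)
length-filter-tabulate {zero}  P? f = refl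
length-filter-tabulate {suc n} P? f with does (P? (f zero))
... | true  = cong suc (length-filter-tabulate P? (f ∘ suc))
... | false = length-filter-tabulate P? (f ∘ suc)

length-filter-map : ∀ {a b p} {A : Set a} {B : Set b} {P : B → Set p} (P? : ∀ x → Dec (P x)) (f : A → B) xs →
                    List.length (List.filter P? (List.map f xs)) ≡ List.length (List.filter (P? ∘ f) xs)
length-filter-map P? f []       = refl
length-filter-map P? f (x ∷ xs) with does (P? (f x))
... | true  = cong suc (length-filter-map P? f xs)
... | false = length-filter-map P? f xs

length-filter-cartesianProduct :
  ∀ {m n a b p} {A : Set a} {B : Set b} {P : A × B → Set p} (P? : ∀ x → Dec (P x))
  (f : Fin m → A) (g : Fin n → B) →
  List.length (List.filter P? (List.cartesianProduct (List.tabulate f) (List.tabulate g)))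
    ≡ ∑ (λ i → # (λ j → does (P? (f i , g j))))
length-filter-cartesianProduct {zero}  P? f g = refl
length-filter-cartesianProduct {suc m} P? f g = begin
  List.length (List.filter P? (row List.++ rest))                                 ≡⟨ cong List.length (List.filter-++ P? row rest) ⟩
  List.length (List.filter P? row List.++ List.filter P? rest)                    ≡⟨ List.length-++ (List.filter P? row) ⟩
  List.length (List.filter P? row) + List.length (List.filter P? rest)            ≡⟨ cong₂ _+_ (trans (length-filter-map P? (f zero ,_) (List.tabulate g)) (length-filter-tabulate (λ y → P? (f zero , y)) g)) (length-filter-cartesianProduct P? (f ∘ suc) g) ⟩
  ∑ (λ i → # (λ j → does (P? (f i , g j))))                                       ∎
  where
  open ≡-Reasoning
  row  = List.map (f zero ,_) (List.tabulate g)
  rest = List.cartesianProduct (List.tabulate (f ∘ suc)) (List.tabulate g)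

module _ {n : ℕ} (G : Graph n) where

  degree≡# : ∀ v → degree G v ≡ # (adjacent G v)
  degree≡# v = length-filter-tabulate (Graph._~?_ G v) id

  maxDegree-≤ : ∀ {D} → (∀ v → degree G v ≤ D) → maxDegree G ≤ D
  maxDegree-≤ {D} deg≤D = max≤v⁺ {D} z≤n (All.map⁺ (All.tabulate⁺ deg≤D))

  minDegree-≥ : ∀ {δ} .{{_ : NonZero n}} → (∀ v → δ ≤ degree G v) → δ ≤ minDegree G
  minDegree-≥ {δ} δ≤deg = v≤min⁺ {δ} (δ≤n n δ≤deg′) (All.map⁺ (All.tabulate⁺ δ≤deg))
    where
    δ≤deg′ : ∀ v → δ ≤ # (adjacent G v)
    δ≤deg′ v = ≤-trans (δ≤deg v) (≤-reflexive (degree≡# v))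
    δ≤n : ∀ m .{{_ : NonZero m}} {f : Fin m → Fin n → Bool} → (∀ v → δ ≤ # (f v)) → δ ≤ n
    δ≤n (suc m) {f} δ≤f = ≤-trans (δ≤f zero) (#≤n (f zero))

  handshake : ∑ (degree G) ≡ 2 * edgeCount G
  handshake = begin
    ∑ (degree G)                                          ≡⟨ ∑-cong degree≡# ⟩
    ∑ (λ u → # (adjacent G u))                            ≡⟨ ∑-cong (λ u → trans (∑-cong (split u)) (∑-distrib-+ (up u) (λ v → up v u))) ⟩
    ∑ (λ u → ∑ (up u) + ∑ (λ v → up v u))                 ≡⟨ ∑-distrib-+ (λ u → ∑ (up u)) (λ u → ∑ (λ v → up v u)) ⟩
    ∑ (λ u → ∑ (up u)) + ∑ (λ u → ∑ (λ v → up v u))       ≡⟨ cong (∑ (λ u → ∑ (up u)) +_) (∑-comm (λ u v → up v u)) ⟩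
    ∑ (λ u → ∑ (up u)) + ∑ (λ u → ∑ (up u))               ≡⟨ cong (λ e → e + e) (sym edges) ⟩
    edgeCount G + edgeCount G                             ≡⟨ cong (edgeCount G +_) (+-identityʳ (edgeCount G)) ⟨
    2 * edgeCount G                                       ∎
    where
    open ≡-Reasoning
    up : Fin n → Fin n → ℕ
    up u v = 𝟙 (does (u Fin.<? v) ∧ adjacent G u v)
    edges : edgeCount G ≡ ∑ (λ u → ∑ (up u))
    edges = length-filter-cartesianProduct (λ (u , v) → (u Fin.<? v) ×-dec Graph._~?_ G u v) id id
    split : ∀ u v → 𝟙 (adjacent G u v) ≡ up u v + up v u
    split u v with Fin.<-cmp u v
    ... | tri< u<v _ v≮u rewrite dec-true (u Fin.<? v) u<v | dec-false (v Fin.<? u) v≮u = sym (+-identityʳ _)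
    ... | tri> u≮v _ v<u rewrite dec-false (u Fin.<? v) u≮v | dec-true (v Fin.<? u) v<u = cong 𝟙 (adjacent-sym G u v)
    ... | tri≈ u≮u refl _ rewrite dec-false (u Fin.<? u) u≮u | adjacent-irrefl G u = refl

⊑-refl : ∀ {n} {G : Graph n} → G ⊑ G
⊑-refl = id , id , id

⊑-trans : ∀ {l m n} {F : Graph l} {G : Graph m} {H : Graph n} → F ⊑ G → G ⊑ H → F ⊑ H
⊑-trans (f , f-inj , f-hom) (g , g-inj , g-hom) = g ∘ f , f-inj ∘ g-inj , g-hom ∘ f-hom

inside : ∀ {m n} {H : Graph m} {G : Graph n} → H ⊑ G → Subgraph H → Subgraph G
inside {H = H} {G} H⊑G K = record { graph = graph ; embedding = ⊑-trans {F = graph} {H} {G} embedding H⊑G }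
  where open Subgraph K

delete : ∀ {n} → Graph (suc n) → Fin (suc n) → Graph n
delete G v = record
  { _~_    = λ x y → punchIn v x ~ punchIn v y
  ; _~?_   = λ x y → punchIn v x ~? punchIn v y
  ; sym    = Graph.sym G
  ; irrefl = λ { refl → irrefl refl }
  } where open Graph G hiding (sym)

module _ {n : ℕ} (G : Graph (suc n)) (v : Fin (suc n)) where

  delete-⊑ : delete G v ⊑ G
  delete-⊑ = punchIn v , Fin.punchIn-injective v _ _ , id

  degree-delete : ∀ x → degree G (punchIn v x) ≡ 𝟙 (adjacent G v (punchIn v x)) + degree (delete G v) x
  degree-delete x = begin
    degree G (punchIn v x)                                                   ≡⟨ degree≡# G (punchIn v x) ⟩
    # (adjacent G (punchIn v x))                                             ≡⟨ sum-remove {n} {v} (𝟙 ∘ adjacent G (punchIn v x)) ⟩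
    𝟙 (adjacent G (punchIn v x) v) + # (adjacent G (punchIn v x) ∘ punchIn v)  ≡⟨ cong₂ _+_ (cong 𝟙 (adjacent-sym G (punchIn v x) v)) (sym (degree≡# (delete G v) x)) ⟩
    𝟙 (adjacent G v (punchIn v x)) + degree (delete G v) x                    ∎
    where open ≡-Reasoning

  ∑-degree-delete : ∑ (degree G) ≡ 2 * degree G v + ∑ (degree (delete G v))
  ∑-degree-delete = begin
    ∑ (degree G)                                          ≡⟨ sum-remove {n} {v} (degree G) ⟩
    d + ∑ (degree G ∘ punchIn v)                          ≡⟨ cong (d +_) (trans (∑-cong degree-delete) (∑-distrib-+ nbr (degree (delete G v)))) ⟩
    d + (∑ nbr + ∑ (degree (delete G v)))                 ≡⟨ cong (λ e → d + (e + ∑ (degree (delete G v)))) nbrs ⟩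
    d + (d + ∑ (degree (delete G v)))                     ≡⟨ regroup d (∑ (degree (delete G v))) ⟩
    2 * d + ∑ (degree (delete G v))                       ∎
    where
    open ≡-Reasoning
    d   = degree G v
    nbr = λ x → 𝟙 (adjacent G v (punchIn v x))
    regroup : ∀ a b → a + (a + b) ≡ 2 * a + b
    regroup = solve-∀
    nbrs : ∑ nbr ≡ d
    nbrs = sym (trans (degree≡# G v) (trans (sum-remove {n} {v} (𝟙 ∘ adjacent G v))
             (cong (λ b → 𝟙 b + ∑ nbr) (adjacent-irrefl G v))))

-- Repeatedly deletes a vertex of degree less than κ. The weights u are those of the vertices
-- that count; an isolated vertex may have weight 0.
peel : ∀ {n} (G : Graph n) κ (u : Fin n → ℕ) → (∀ v → u v ≡ 0 → degree G v ≡ 0) →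
       0 < ∑ (degree G) → 2 * κ * ∑ u ≤ ∑ (degree G) →
       Σ (Subgraph G) λ H → let open Subgraph H in
         (∀ D → (∀ v → degree G v ≤ D) → ∀ v → degree graph v ≤ D) × (∀ v → κ ≤ degree graph v)
peel {suc n} G κ u iso 0<∑ dense with Fin.any? (λ v → degree G v <? κ)
... | no all≥κ = record { order = suc n ; graph = G ; embedding = ⊑-refl {G = G} } ,
                 (λ _ deg≤D → deg≤D) , λ v → ≮⇒≥ (λ d<κ → all≥κ (v , d<κ))
... | yes (v , d<κ) =
  let H , max-H , min-H = peel G′ κ (u ∘ punchIn v) iso′ (proj₁ smaller) (proj₂ smaller)
  in inside {G = G} (delete-⊑ G v) H ,
     (λ D deg≤D → max-H D (λ x → ≤-trans (deg′≤deg x) (deg≤D (punchIn v x)))) , min-H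
  where
  G′ = delete G v
  d  = degree G v
  s  = ∑ (degree G)
  s′ = ∑ (degree G′)
  U  = ∑ (u ∘ punchIn v)
  deg′≤deg : ∀ x → degree G′ x ≤ degree G (punchIn v x)
  deg′≤deg x = ≤-trans (m≤n+m _ _) (≤-reflexive (sym (degree-delete G v x)))
  iso′ : ∀ x → u (punchIn v x) ≡ 0 → degree G′ x ≡ 0
  iso′ x u≡0 = n≤0⇒n≡0 (≤-trans (deg′≤deg x) (≤-reflexive (iso (punchIn v x) u≡0)))
  dense′ : 2 * κ * (u v + U) ≤ 2 * d + s′
  dense′ = subst₂ _≤_ (cong (2 * κ *_) (sum-remove {n} {v} u)) (∑-degree-delete G v) dense
  smaller : 0 < s′ × 2 * κ * U ≤ s′
  smaller with u v in uv
  ... | zero  = subst (0 <_) s≡s′ 0<∑ , ≤-trans (*-monoʳ-≤ (2 * κ) (m≤n+m U (u v)))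
                  (subst (2 * κ * (u v + U) ≤_) (cong (λ e → 2 * e + s′) (iso v uv)) dense′)
    where
    s≡s′ : s ≡ s′
    s≡s′ = trans (∑-degree-delete G v) (cong (λ e → 2 * e + s′) (iso v uv))
  -- Strictness shows in addition that edges are left, so the peeling never ends with an empty
  -- graph.
  ... | suc w = ≤-<-trans z≤n strict , <⇒≤ strict
    where
    strict : 2 * κ * U < s′
    strict = +-cancelˡ-< (2 * d) _ _ (begin-strict
      2 * d + 2 * κ * U          <⟨ +-monoˡ-< (2 * κ * U) (*-monoʳ-< 2 d<κ) ⟩
      2 * κ + 2 * κ * U          ≤⟨ m≤m+n _ (2 * κ * w) ⟩
      2 * κ + 2 * κ * U + 2 * κ * w  ≡⟨ regroup κ U w ⟩
      2 * κ * (suc w + U)        ≡⟨ cong (λ e → 2 * κ * (e + U)) uv ⟨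
      2 * κ * (u v + U)          ≤⟨ dense′ ⟩
      2 * d + s′                 ∎)
      where
      open ≤-Reasoning
      regroup : ∀ a b c → 2 * a + 2 * a * b + 2 * a * c ≡ 2 * a * (suc c + b)
      regroup = solve-∀

-- The form of the conclusion at which all the combinatorics aims: it gives both
-- 64-almost-regularity and average degree at least κ.
HasPiece : ∀ {n} → ℕ → Graph n → Set₁
HasPiece κ G = Σ (Subgraph G) λ H → let open Subgraph H in
  (∀ v → degree graph v ≤ κ * 64) × (∀ v → κ ≤ degree graph v)

HasPiece-⊑ : ∀ {m n} {H : Graph m} {G : Graph n} {κ} → H ⊑ G → HasPiece κ H → HasPiece κ G
HasPiece-⊑ {H = H} {G} H⊑G (K , max-K , min-K) = inside {H = H} {G} H⊑G K , max-K , min-K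

-- Bipartite incidence matrices

-- Rows and columns are both indexed by all vertices. `E` points from the side `true` to the side
-- `false`, so no vertex has both a non-empty row and a non-empty column.
Bipartite : ∀ {n} → Graph n → (Fin n → Bool) → (Fin n → Fin n → Bool) → Set
Bipartite G side E = ∀ a b → E a b ≡ true → side a ≡ true × side b ≡ false × adjacent G a b ≡ true

not-true : ∀ {b} → ¬ (b ≡ true) → b ≡ false
not-true {true}  b≢true = contradiction refl b≢true
not-true {false} _      = refl

does-true : ∀ {p} {P : Set p} (P? : Dec P) → does P? ≡ true → P
does-true (yes p) _ = p

does-false : ∀ {p} {P : Set p} (P? : Dec P) → does P? ≡ false → ¬ P
does-false (no ¬p) _ = ¬p

#-zero : ∀ {n} (f : Fin n → Bool) → (∀ i → f i ≡ false) → # f ≡ 0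
#-zero f f≡false = ∑-zero (λ i → cong 𝟙 (f≡false i))

record Greedy {p m : ℕ} (E : Fin p → Fin m → Bool) (k : ℕ) : Set where
  field
    F    : Fin p → Fin m → Bool
    sel  : Fin p → Bool
    F⊆E  : ∀ a → F a ⊆ E a
    rows : ∀ a → # (F a) ≡ k * 𝟙 (sel a)
  load : Fin m → ℕ
  load b = # (λ a → F a b)
  field
    load≤k    : ∀ b → load b ≤ k
    saturated : ∀ a → sel a ≡ false → # (λ b → E a b ∧ does (load b <? k)) ≤ k

-- Rows are tried one at a time, and a row is taken if k of its columns still have room. Loads only
-- grow, so a row that was refused once stays saturated.
greedy : ∀ {p m} (E : Fin p → Fin m → Bool) k → Greedy E k
greedy {zero}  E k = record
  { F = λ () ; sel = λ () ; F⊆E = λ () ; rows = λ () ; load≤k = λ _ → z≤n ; saturated = λ () }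
greedy {suc p} {m} E k with greedy (E ∘ suc) k
... | g with k ≤? # (λ b → E zero b ∧ does (Greedy.load g b <? k))
...   | no k≰free = record
  { F         = (λ _ → false) Vector.∷ F
  ; sel       = false Vector.∷ sel
  ; F⊆E       = λ { zero b () ; (suc a) → F⊆E a }
  ; rows      = λ { zero → trans (#-zero {m} (λ _ → false) (λ _ → refl)) (sym (*-zeroʳ k)) ; (suc a) → rows a }
  ; load≤k    = load≤k
  ; saturated = λ { zero _ → ≰⇒≥ k≰free ; (suc a) → saturated a }
  } where open Greedy g
...   | yes k≤free with select (λ b → E zero b ∧ does (Greedy.load g b <? k)) k k≤free
...     | f , f⊆free , #f = record
  { F         = f Vector.∷ F
  ; sel       = true Vector.∷ sel
  ; F⊆E       = λ { zero b fb → proj₁ (∧-true (f⊆free b fb)) ; (suc a) → F⊆E a }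
  ; rows      = λ { zero → trans #f (sym (*-identityʳ k)) ; (suc a) → rows a }
  ; load≤k    = load′≤k
  ; saturated = λ { zero () ; (suc a) a∉sel → ≤-trans (#-mono (still a)) (saturated a a∉sel) }
  }
  where
  open Greedy g
  load′≤k : ∀ b → 𝟙 (f b) + load b ≤ k
  load′≤k b with f b in fb
  ... | false = load≤k b
  ... | true  = does-true (load b <? k) (proj₂ (∧-true (f⊆free b fb)))
  still : ∀ a → (λ b → E (suc a) b ∧ does (𝟙 (f b) + load b <? k)) ⊆ (λ b → E (suc a) b ∧ does (load b <? k))
  still a b eq with ∧-true {E (suc a) b} eq
  ... | Eab , l<k = ∧-intro Eab (dec-true (load b <? k)
                      (≤-<-trans (m≤n+m _ _) (does-true (𝟙 (f b) + load b <? k) l<k)))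

module _ {n : ℕ} (G : Graph n) {side : Fin n → Bool} {E : Fin n → Fin n → Bool} (bip : Bipartite G side E) where

  bipartiteGraph : Graph n
  bipartiteGraph = record
    { _~_    = λ u v → E u v ∨ E v u ≡ true
    ; _~?_   = λ u v → (E u v ∨ E v u) Bool.≟ true
    ; sym    = λ {u} {v} u~v → trans (Bool.∨-comm (E v u) (E u v)) u~v
    ; irrefl = λ { {v} refl v~v → loop v v~v }
    }
    where
    loop : ∀ v → ¬ (E v v ∨ E v v ≡ true)
    loop v v~v with bip v v (trans (sym (Bool.∨-idem (E v v))) v~v)
    ... | v∈A , v∈B , _ = true≢false v∈A v∈B

  bipartiteGraph-⊑ : bipartiteGraph ⊑ G
  bipartiteGraph-⊑ = id , id , hom _ _
    where
    hom : ∀ u v → E u v ∨ E v u ≡ true → Graph._~_ G u v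
    hom u v u~v with E u v in uv | E v u in vu
    ... | true  | _    = adjacent⇒~ G (proj₂ (proj₂ (bip u v uv)))
    ... | false | true = Graph.sym G (adjacent⇒~ G (proj₂ (proj₂ (bip v u vu))))

  bipartiteGraph-degree : ∀ v → degree bipartiteGraph v ≡ # (E v) + # (λ u → E u v)
  bipartiteGraph-degree v = trans (degree≡# bipartiteGraph v) (trans (∑-cong split) (∑-distrib-+ (𝟙 ∘ E v) (λ u → 𝟙 (E u v))))
    where
    split : ∀ u → 𝟙 (adjacent bipartiteGraph v u) ≡ 𝟙 (E v u) + 𝟙 (E u v)
    split u with E v u in vu | E u v in uv
    ... | false | false = refl
    ... | false | true  = refl
    ... | true  | false = refl
    ... | true  | true  = contradiction (proj₁ (proj₂ (bip u v uv))) (true≢false (proj₁ (bip v u vu)))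

module Cover {n : ℕ} (G : Graph n) {side : Fin n → Bool} {E : Fin n → Fin n → Bool} (bip : Bipartite G side E)
             (B : Fin n → Bool) (E⊆B : ∀ a → E a ⊆ B) (κ : ℕ) .{{_ : NonZero κ}} where

  k = κ * 64

  open Greedy (greedy E k)

  instance
    k≢0 : NonZero k
    k≢0 = m*n≢0 κ 64

  S : Fin n → Bool
  S b = not (does (load b <? k))

  ∑-load : ∑ load ≡ k * # sel
  ∑-load = trans (∑-comm (λ b a → 𝟙 (F a b))) (trans (∑-cong rows) (∑-*ˡ k (𝟙 ∘ sel)))

  #S≤#sel : # S ≤ # sel
  #S≤#sel = *-cancelˡ-≤ k (begin
    k * # S                  ≡⟨ ∑-*ˡ k (𝟙 ∘ S) ⟨
    ∑ (λ b → k * 𝟙 (S b))    ≤⟨ ∑-mono full ⟩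
    ∑ load                   ≡⟨ ∑-load ⟩
    k * # sel                ∎)
    where
    open ≤-Reasoning
    full′ : ∀ {l} (l<k? : Dec (l < k)) → k * 𝟙 (not (does l<k?)) ≤ l
    full′ (yes _)  = ≤-trans (≤-reflexive (*-zeroʳ k)) z≤n
    full′ (no l≮k) = ≤-trans (≤-reflexive (*-identityʳ k)) (≮⇒≥ l≮k)
    full : ∀ b → k * 𝟙 (S b) ≤ load b
    full b = full′ (load b <? k)

  few : ∀ a → sel a ≡ false → # (λ b → E a b ∧ not (S b)) ≤ k
  few a a∉sel = ≤-trans (≤-reflexive (∑-cong (λ b → cong (λ s → 𝟙 (E a b ∧ s)) (Bool.not-involutive _)))) (saturated a a∉sel)

  F-bip : Bipartite G side F
  F-bip a b Fab = bip a b (F⊆E a b Fab)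

  H : Graph n
  H = bipartiteGraph G F-bip

  H-degree : ∀ v → degree H v ≡ # (F v) + load v
  H-degree = bipartiteGraph-degree G F-bip

  rows≤k : ∀ a → # (F a) ≤ k
  rows≤k a = ≤-trans (≤-reflexive (rows a)) (≤-trans (*-monoʳ-≤ k (𝟙≤1 (sel a))) (≤-reflexive (*-identityʳ k)))

  H-degree≤k : ∀ v → degree H v ≤ k
  H-degree≤k v with side v in side-v
  ... | true  = ≤-trans (≤-reflexive (trans (H-degree v) (trans (cong (# (F v) +_) (#-zero (λ a → F a v) no-col)) (+-identityʳ _)))) (rows≤k v)
    where
    no-col : ∀ a → F a v ≡ false
    no-col a = not-true (λ Fav → true≢false side-v (proj₁ (proj₂ (F-bip a v Fav))))
  ... | false = ≤-trans (≤-reflexive (trans (H-degree v) (cong (_+ load v) (#-zero (F v) no-row)))) (load≤k v)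
    where
    no-row : ∀ b → F v b ≡ false
    no-row b = not-true (λ Fvb → true≢false (proj₁ (F-bip v b Fvb)) side-v)

  ∑-H-degree : ∑ (degree H) ≡ 2 * (k * # sel)
  ∑-H-degree = trans (∑-cong H-degree) (trans (∑-distrib-+ (λ v → # (F v)) load)
    (cong₂ _+_ (trans (∑-cong rows) (∑-*ˡ k (𝟙 ∘ sel))) (trans ∑-load (sym (+-identityʳ _)))))

  weight : Fin n → ℕ
  weight v = 𝟙 (sel v) + 𝟙 (B v)

  isolated : ∀ v → weight v ≡ 0 → degree H v ≡ 0
  isolated v w≡0 = trans (H-degree v) (cong₂ _+_
    (trans (rows v) (trans (cong (k *_) (m+n≡0⇒m≡0 (𝟙 (sel v)) w≡0)) (*-zeroʳ k)))
    (#-zero (λ a → F a v) (λ a → not-true (λ Fav → true≢false (E⊆B a v (F⊆E a v Fav)) (v∉B (m+n≡0⇒n≡0 (𝟙 (sel v)) w≡0))))))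
    where
    v∉B : 𝟙 (B v) ≡ 0 → B v ≡ false
    v∉B eq with B v
    ... | false = refl

  -- The origin of 64: `H` has `k * # sel` edges on at most 64 `# sel` vertices of positive weight,
  -- so with `k = κ * 64` its average degree there is at least 2κ. Peeling leaves minimum degree κ,
  -- while no degree exceeds k.
  piece : 0 < # sel → # B ≤ # sel * 63 → HasPiece κ G
  piece 0<sel B≤sel =
    let K , max-K , min-K = peel H κ weight isolated
          (subst (0 <_) (sym ∑-H-degree) (*-monoʳ-< 2 (≤-<-trans (≤-reflexive (sym (*-zeroʳ k))) (*-monoʳ-< k 0<sel))))
          dense
    in inside {H = H} {G} (bipartiteGraph-⊑ G F-bip) K , max-K k H-degree≤k , min-K
    where
    open ≤-Reasoning
    regroup : ∀ c → 2 * κ * (c + c * 63) ≡ 2 * (κ * 64 * c)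
    regroup c = lemma κ c
      where
      lemma : ∀ a c → 2 * a * (c + c * 63) ≡ 2 * (a * 64 * c)
      lemma = solve-∀
    dense : 2 * κ * ∑ weight ≤ ∑ (degree H)
    dense = begin
      2 * κ * ∑ weight             ≡⟨ cong (2 * κ *_) (∑-distrib-+ (𝟙 ∘ sel) (𝟙 ∘ B)) ⟩
      2 * κ * (# sel + # B)        ≤⟨ *-monoʳ-≤ (2 * κ) (+-monoʳ-≤ (# sel) B≤sel) ⟩
      2 * κ * (# sel + # sel * 63) ≡⟨ regroup (# sel) ⟩
      2 * (k * # sel)              ≡⟨ ∑-H-degree ⟨
      ∑ (degree H)                 ∎

-- A maximal family of rows with k = 64κ entries each, no column being used more than k times,
-- is either large, giving a subgraph as required, or its rows A and saturated columns S
-- account for nearly all of E.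
cover : ∀ {n} (G : Graph n) {side E} → Bipartite G side E → ∀ (B : Fin n → Bool) → (∀ a → E a ⊆ B) →
        ∀ κ .{{_ : NonZero κ}} →
        HasPiece κ G ⊎ ∃₂ λ A S → # A * 63 ≤ # B × # S ≤ # A ×
          (∀ a → A a ≡ false → # (λ b → E a b ∧ not (S b)) ≤ κ * 64)
cover G {E = E} bip B E⊆B κ = decide (# sel * 63 ≤? # B) (0 <? # sel)
  where
  open Cover G bip B E⊆B κ
  open Greedy (greedy E k) using (sel)
  decide : Dec (# sel * 63 ≤ # B) → Dec (0 < # sel) → _
  decide (yes small) _           = inj₂ (sel , S , small , #S≤#sel , few)
  decide (no large)  (yes 0<sel) = inj₁ (piece 0<sel (≰⇒≥ large))
  decide (no large)  (no sel≯0)  =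
    contradiction (≤-trans (≤-reflexive (cong (_* 63) (n≤0⇒n≡0 (≮⇒≥ sel≯0)))) z≤n) large

-- Complete bipartite subgraphs

completeBipartite-degree : ∀ t v → degree (completeBipartite t t) v ≡ t
completeBipartite-degree t v = trans (degree≡# K v) (trans (∑-splitAt t (𝟙 ∘ adjacent K v)) (by-side v))
  where
  K = completeBipartite t t
  left : ∀ i j → Graph._~_ K (i ↑ˡ t) (t ↑ʳ j)
  left i j eq rewrite Fin.splitAt-↑ˡ t i t | Fin.splitAt-↑ʳ t t j = case eq of λ ()
  left-left : ∀ i j → ¬ Graph._~_ K (i ↑ˡ t) (j ↑ˡ t)
  left-left i j ne rewrite Fin.splitAt-↑ˡ t i t | Fin.splitAt-↑ˡ t j t = ne refl
  right-right : ∀ i j → ¬ Graph._~_ K (t ↑ʳ i) (t ↑ʳ j)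
  right-right i j ne rewrite Fin.splitAt-↑ʳ t t i | Fin.splitAt-↑ʳ t t j = ne refl
  ones : ∀ {f : Fin t → Bool} → (∀ i → f i ≡ true) → # f ≡ t
  ones f≡true = trans (∑-cong (λ i → cong 𝟙 (f≡true i))) (trans (∑-const t 1) (*-identityʳ t))
  Total : Fin (t + t) → Set
  Total v = ∑ (λ i → 𝟙 (adjacent K v (i ↑ˡ t))) + ∑ (λ j → 𝟙 (adjacent K v (t ↑ʳ j))) ≡ t
  total-left : ∀ i → Total (i ↑ˡ t)
  total-left i = cong₂ _+_
    (#-zero (λ j → adjacent K (i ↑ˡ t) (j ↑ˡ t)) (λ j → dec-false (Graph._~?_ K (i ↑ˡ t) (j ↑ˡ t)) (left-left i j)))
    (ones (λ j → dec-true (Graph._~?_ K (i ↑ˡ t) (t ↑ʳ j)) (left i j)))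
  total-right : ∀ j → Total (t ↑ʳ j)
  total-right j = trans (cong₂ _+_
    (ones (λ i → dec-true (Graph._~?_ K (t ↑ʳ j) (i ↑ˡ t)) (Graph.sym K {i ↑ˡ t} {t ↑ʳ j} (left i j))))
    (#-zero (λ i → adjacent K (t ↑ʳ j) (t ↑ʳ i)) (λ i → dec-false (Graph._~?_ K (t ↑ʳ j) (t ↑ʳ i)) (right-right j i))))
    (+-identityʳ t)
  by-side : ∀ v → Total v
  by-side v = by-splitAt (splitAt t v) refl
    where
    by-splitAt : ∀ s → splitAt t v ≡ s → Total v
    by-splitAt (inj₁ i) eq = subst Total (Fin.splitAt⁻¹-↑ˡ eq) (total-left i)
    by-splitAt (inj₂ j) eq = subst Total (Fin.splitAt⁻¹-↑ʳ eq) (total-right j)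

completeBipartite-piece : ∀ {n} (G : Graph n) t .{{_ : NonZero t}} → completeBipartite t t ⊑ G → HasPiece t G
completeBipartite-piece G t K⊑G =
  record { order = t + t ; nonEmpty = >-nonZero (≤-trans (>-nonZero⁻¹ t) (m≤m+n t t)) ; graph = completeBipartite t t ; embedding = K⊑G } ,
  (λ v → ≤-trans (≤-reflexive (completeBipartite-degree t v)) (m≤m*n t 64)) ,
  (λ v → ≤-reflexive (sym (completeBipartite-degree t v)))

completeBipartite-⊑ : ∀ {n} (G : Graph n) {side E} → Bipartite G side E → ∀ {t} (p q : Fin t → Fin n) →
                      Injective _≡_ _≡_ p → Injective _≡_ _≡_ q → (∀ i j → E (p i) (q j) ≡ true) →
                      completeBipartite t t ⊑ G
completeBipartite-⊑ {n} G {side} {E} bip {t} p q p-inj q-inj Epq = f , f-inj , f-hom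
  where
  f : Fin (t + t) → Fin n
  f = [ p , q ]′ ∘ splitAt t
  p≢q : ∀ {i j} → p i ≢ q j
  p≢q {i} {j} eq = true≢false (subst (λ v → side v ≡ true) eq (proj₁ (bip _ _ (Epq i j)))) (proj₁ (proj₂ (bip _ _ (Epq i j))))
  f-inj : Injective _≡_ _≡_ f
  f-inj {u} {v} eq with splitAt t u in eu | splitAt t v in ev
  ... | inj₁ i | inj₁ j rewrite p-inj eq = trans (sym (Fin.splitAt⁻¹-↑ˡ eu)) (Fin.splitAt⁻¹-↑ˡ ev)
  ... | inj₁ i | inj₂ j = contradiction eq p≢q
  ... | inj₂ i | inj₁ j = contradiction (sym eq) p≢q
  ... | inj₂ i | inj₂ j rewrite q-inj eq = trans (sym (Fin.splitAt⁻¹-↑ʳ eu)) (Fin.splitAt⁻¹-↑ʳ ev)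
  edge : ∀ i j → Graph._~_ G (p i) (q j)
  edge i j = adjacent⇒~ G (proj₂ (proj₂ (bip _ _ (Epq i j))))
  f-hom : ∀ {u v} → Graph._~_ (completeBipartite t t) u v → Graph._~_ G (f u) (f v)
  f-hom {u} {v} ne with splitAt t u | splitAt t v
  ... | inj₁ i | inj₁ j = contradiction refl ne
  ... | inj₁ i | inj₂ j = edge i j
  ... | inj₂ i | inj₁ j = Graph.sym G (edge j i)
  ... | inj₂ i | inj₂ j = contradiction refl ne

-- Weighted counting over all subsets of the columns

-- ∏ x times the expectation of f S for the random set S that contains each b with
-- probability 1 / x b independently. Needs x b ≥ 1.
𝔼 : ∀ {n} → (Fin n → ℕ) → ((Fin n → Bool) → ℕ) → ℕ
𝔼 {zero}  x f = f Vector.[]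
𝔼 {suc n} x f = 𝔼 (x ∘ suc) (λ S → f (true Vector.∷ S)) + (x zero ∸ 1) * 𝔼 (x ∘ suc) (λ S → f (false Vector.∷ S))

𝔼₁ : ∀ {n} → (Fin (suc n) → ℕ) → Bool → ((Fin (suc n) → Bool) → ℕ) → ℕ
𝔼₁ x s f = 𝔼 (x ∘ suc) (λ S → f (s Vector.∷ S))

𝔼-cong : ∀ {n} (x : Fin n → ℕ) {f g} → (∀ S → f S ≡ g S) → 𝔼 x f ≡ 𝔼 x g
𝔼-cong {zero}  x f≗g = f≗g Vector.[]
𝔼-cong {suc n} x f≗g = cong₂ (λ t e → t + (x zero ∸ 1) * e) (𝔼-cong (x ∘ suc) (λ S → f≗g _)) (𝔼-cong (x ∘ suc) (λ S → f≗g _))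

𝔼-+ : ∀ {n} (x : Fin n → ℕ) f g → 𝔼 x (λ S → f S + g S) ≡ 𝔼 x f + 𝔼 x g
𝔼-+ {zero}  x f g = refl
𝔼-+ {suc n} x f g = trans (cong₂ (λ t e → t + (x zero ∸ 1) * e) (each true) (each false))
                          (regroup (x zero ∸ 1) (𝔼₁ x true f) (𝔼₁ x true g) (𝔼₁ x false f) (𝔼₁ x false g))
  where
  each : ∀ s → 𝔼₁ x s (λ S → f S + g S) ≡ 𝔼₁ x s f + 𝔼₁ x s g
  each s = 𝔼-+ (x ∘ suc) (λ S → f (s Vector.∷ S)) (λ S → g (s Vector.∷ S))
  regroup : ∀ c a b d e → a + b + c * (d + e) ≡ a + c * d + (b + c * e)
  regroup = solve-∀

𝔼-*ˡ : ∀ {n} (x : Fin n → ℕ) c f → 𝔼 x (λ S → c * f S) ≡ c * 𝔼 x f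
𝔼-*ˡ {zero}  x c f = refl
𝔼-*ˡ {suc n} x c f = trans (cong₂ (λ t e → t + (x zero ∸ 1) * e) (each true) (each false))
                           (regroup (x zero ∸ 1) c (𝔼₁ x true f) (𝔼₁ x false f))
  where
  each : ∀ s → 𝔼₁ x s (λ S → c * f S) ≡ c * 𝔼₁ x s f
  each s = 𝔼-*ˡ (x ∘ suc) c (λ S → f (s Vector.∷ S))
  regroup : ∀ d c a b → c * a + d * (c * b) ≡ c * (a + d * b)
  regroup = solve-∀

𝔼-zero : ∀ {n} (x : Fin n → ℕ) → 𝔼 x (λ _ → 0) ≡ 0
𝔼-zero x = 𝔼-*ˡ x 0 (λ _ → 0)

𝔼-∑ : ∀ {m n} (x : Fin n → ℕ) (f : Fin m → (Fin n → Bool) → ℕ) → 𝔼 x (λ S → ∑ (λ i → f i S)) ≡ ∑ (λ i → 𝔼 x (f i))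
𝔼-∑ {zero}  x f = 𝔼-zero x
𝔼-∑ {suc m} x f = trans (𝔼-+ x (f zero) (λ S → ∑ (λ i → f (suc i) S))) (cong (𝔼 x (f zero) +_) (𝔼-∑ x (f ∘ suc)))

𝔼-<⇒∃ : ∀ {n} (x : Fin n → ℕ) f g → 𝔼 x f < 𝔼 x g → ∃ λ S → f S < g S
𝔼-<⇒∃ {zero}  x f g lt = Vector.[] , lt
𝔼-<⇒∃ {suc n} x f g lt
  with 𝔼 (x ∘ suc) (λ S → f (true Vector.∷ S)) <? 𝔼 (x ∘ suc) (λ S → g (true Vector.∷ S))
     | 𝔼 (x ∘ suc) (λ S → f (false Vector.∷ S)) <? 𝔼 (x ∘ suc) (λ S → g (false Vector.∷ S))
... | yes lt₁ | _       = let S , fS<gS = 𝔼-<⇒∃ (x ∘ suc) _ _ lt₁ in true Vector.∷ S , fS<gS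
... | no _    | yes lt₀ = let S , fS<gS = 𝔼-<⇒∃ (x ∘ suc) _ _ lt₀ in false Vector.∷ S , fS<gS
... | no ≮₁   | no ≮₀   = contradiction (+-mono-≤ (≮⇒≥ ≮₁) (*-monoʳ-≤ (x zero ∸ 1) (≮⇒≥ ≮₀))) (<⇒≱ lt)

-- Independence of the choices for different columns.
𝔼-∏ : ∀ {n} (x : Fin n → ℕ) (φ : Fin n → Bool → ℕ) →
      𝔼 x (λ S → ∏ (λ b → φ b (S b))) ≡ ∏ (λ b → φ b true + (x b ∸ 1) * φ b false)
𝔼-∏ {zero}  x φ = refl
𝔼-∏ {suc n} x φ = trans
  (cong₂ (λ t e → t + (x zero ∸ 1) * e) (each true) (each false))
  (trans (regroup (x zero ∸ 1) (φ zero true) (φ zero false) (𝔼 (x ∘ suc) tail))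
         (cong ((φ zero true + (x zero ∸ 1) * φ zero false) *_) (𝔼-∏ (x ∘ suc) (φ ∘ suc))))
  where
  tail : (Fin _ → Bool) → ℕ
  tail S = ∏ (λ b → φ (suc b) (S b))
  each : ∀ s → 𝔼 (x ∘ suc) (λ S → φ zero s * tail S) ≡ φ zero s * 𝔼 (x ∘ suc) tail
  each s = 𝔼-*ˡ (x ∘ suc) (φ zero s) tail
  regroup : ∀ c a b e → a * e + c * (b * e) ≡ (a + c * b) * e
  regroup = solve-∀

∏-one : ∀ {n} {f : Fin n → ℕ} → (∀ i → f i ≡ 1) → ∏ f ≡ 1
∏-one {zero}  f≡1 = refl
∏-one {suc n} f≡1 = cong₂ _*_ (f≡1 zero) (∏-one (f≡1 ∘ suc))

∏-mono : ∀ {n} {f g : Fin n → ℕ} → (∀ i → f i ≤ g i) → ∏ f ≤ ∏ g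
∏-mono {zero}  f≤g = ≤-refl
∏-mono {suc n} f≤g = *-mono-≤ (f≤g zero) (∏-mono (f≤g ∘ suc))

∏-if-^ : ∀ {n} (g : Fin n → Bool) X → ∏ (λ i → if g i then X else 1) ≡ X ^ # g
∏-if-^ {zero}  g X = refl
∏-if-^ {suc n} g X with g zero
... | true  = cong (X *_) (∏-if-^ (g ∘ suc) X)
... | false = trans (+-identityʳ _) (∏-if-^ (g ∘ suc) X)

𝔼-one : ∀ {n} (x : Fin n → ℕ) → (∀ b → 1 ≤ x b) → 𝔼 x (λ _ → 1) ≡ ∏ x
𝔼-one {zero}  x x≥1 = refl
𝔼-one {suc n} x x≥1 = trans (cong (λ e → e + (x zero ∸ 1) * e) (𝔼-one (x ∘ suc) (x≥1 ∘ suc)))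
                            (cong (_* ∏ (x ∘ suc)) (m+[n∸m]≡n (x≥1 zero)))

𝔼-member : ∀ {n} (x : Fin n → ℕ) → (∀ b → 1 ≤ x b) → ∀ b → x b * 𝔼 x (λ S → 𝟙 (S b)) ≡ ∏ x
𝔼-member {suc n} x x≥1 zero    = cong (x zero *_) (trans
  (cong₂ (λ t e → t + (x zero ∸ 1) * e) (𝔼-one (x ∘ suc) (x≥1 ∘ suc)) (𝔼-zero (x ∘ suc)))
  (trans (cong (∏ (x ∘ suc) +_) (*-zeroʳ (x zero ∸ 1))) (+-identityʳ _)))
𝔼-member {suc n} x x≥1 (suc b) = trans (regroup (x (suc b)) (x zero ∸ 1) (𝔼 (x ∘ suc) (λ S → 𝟙 (S b))))
  (cong₂ _*_ (m+[n∸m]≡n (x≥1 zero)) (𝔼-member (x ∘ suc) (x≥1 ∘ suc) b))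
  where
  regroup : ∀ a c e → a * (e + c * e) ≡ (1 + c) * (a * e)
  regroup = solve-∀

-- Either x b is the only factor, or the bound Λ is counted at least once.
∏-≤ : ∀ {n} (g : Fin n → Bool) (x : Fin n → ℕ) Λ b → g b ≡ true → ∏ (λ i → if g i then x i else 1) ≤ Λ →
      ∏ (λ i → if g i then x i else 1) ≤ x b + Λ * # (λ i → not (does (b Fin.≟ i)) ∧ g i)
∏-≤ {suc n} g x Λ b gb ∏≤Λ with # (λ i → not (does (b Fin.≟ i)) ∧ g i) in others
... | suc m = ≤-trans ∏≤Λ (≤-trans (m≤m*n Λ (suc m)) (m≤n+m _ (x b)))
... | zero  = ≤-trans (≤-reflexive (begin
    ∏ f                           ≡⟨ ∏-remove {n} {b} f ⟩
    f b * ∏ (f ∘ punchIn b)       ≡⟨ cong₂ _*_ (cong (if_then x b else 1) gb) (∏-one (λ j → cong (if_then x (punchIn b j) else 1) (none j))) ⟩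
    x b * 1                       ≡⟨ *-identityʳ (x b) ⟩
    x b                           ∎)) (m≤m+n (x b) _)
  where
  open ≡-Reasoning
  f = λ i → if g i then x i else 1
  none : ∀ j → g (punchIn b j) ≡ false
  none j with ∑≡0⇒ (λ i → 𝟙 (not (does (b Fin.≟ i)) ∧ g i)) others (punchIn b j)
  ... | eq rewrite dec-false (b Fin.≟ punchIn b j) (Fin.punchInᵢ≢i b j ∘ sym) = not-true (λ g≡true → case trans (cong 𝟙 (sym g≡true)) eq of λ ())

-- Second moments for a random set of columns

if-≤ : ∀ b {x y z} → (b ≡ true → x ≤ z) → (b ≡ false → y ≤ z) → (if b then x else y) ≤ z
if-≤ true  x≤z _   = x≤z refl
if-≤ false _   y≤z = y≤z refl

-- The weight w S a of the row a is nonzero only if S contains the columns of a, and it is scaled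
-- so that all rows have the same expected weight; Y S b and P S are the total weights of the rows
-- that meet the column b and of all rows.
module Core {n : ℕ} (E : Fin n → Fin n → Bool) (A B : Fin n → Bool) (E⊆B : ∀ a → E a ⊆ B)
            (r : ℕ) (rows : ∀ a → # (E a) ≡ r * 𝟙 (A a))
            (N δ X T : ℕ) (codegree : ∀ b b′ → b ≢ b′ → # (λ a → E a b ∧ E a b′) ≤ T)
            (x : Fin n → ℕ) (x≥1 : ∀ b → 1 ≤ x b) (x≤X : ∀ b → x b ≤ X)
            (xc≤N : ∀ b → x b * # (λ a → E a b) ≤ N)
            (N≤xc : ∀ b → N ≤ x b * ((# (λ a → E a b) + δ) * 2))
            (δB≤A : # B * δ ≤ r * # A)
            (rXT≤N : X ^ r * (r * T) ≤ N) (rX≤N : X ^ r * r ≤ N) where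

  Z = ∏ x

  e : Fin n → Fin n → ℕ
  e a b = 𝟙 (E a b)

  c : Fin n → ℕ
  c b = # (λ a → E a b)

  y : Fin n → ℕ
  y a = ∏ (λ b → if E a b then x b else 1)

  [_⊆_]ₒ : Fin n → (Fin n → Bool) → ℕ
  [ a ⊆ S ]ₒ = ∏ (λ b → if E a b then 𝟙 (S b) else 1)

  w : (Fin n → Bool) → Fin n → ℕ
  w S a = y a * [ a ⊆ S ]ₒ

  Y : (Fin n → Bool) → Fin n → ℕ
  Y S b = ∑ (λ a → e a b * w S a)

  P : (Fin n → Bool) → ℕ
  P S = ∑ (λ a → 𝟙 (A a) * w S a)

  ∑-c : ∑ c ≡ r * # A
  ∑-c = trans (∑-comm (λ b a → e a b)) (trans (∑-cong rows) (∑-*ˡ r (𝟙 ∘ A)))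

  #E≤r : ∀ a → # (E a) ≤ r
  #E≤r a = ≤-trans (≤-reflexive (rows a)) (≤-trans (*-monoʳ-≤ r (𝟙≤1 (A a))) (≤-reflexive (*-identityʳ r)))

  X≥1 : Fin n → 1 ≤ X
  X≥1 b = ≤-trans (x≥1 b) (x≤X b)

  X^≤ : Fin n → ∀ {m} → m ≤ r → X ^ m ≤ X ^ r
  X^≤ b = ^-monoʳ-≤ X {{>-nonZero (X≥1 b)}}

  y≤ : ∀ a → y a ≤ X ^ r
  y≤ a = ≤-trans (∏-mono bound) (≤-trans (≤-reflexive (∏-if-^ (E a) X)) (X^≤ a (#E≤r a)))
    where
    bound : ∀ b → (if E a b then x b else 1) ≤ (if E a b then X else 1)
    bound b with E a b
    ... | true  = x≤X b
    ... | false = ≤-refl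

  [⊆]≤1 : ∀ S a → [ a ⊆ S ]ₒ ≤ 1
  [⊆]≤1 S a = ≤-trans (∏-mono (λ b → if-≤ (E a b) (λ _ → 𝟙≤1 (S b)) (λ _ → ≤-refl))) (≤-reflexive (∏-one {n} (λ _ → refl)))

  w≤ : ∀ S a → w S a ≤ X ^ r
  w≤ S a = ≤-trans (*-mono-≤ (y≤ a) ([⊆]≤1 S a)) (≤-reflexive (*-identityʳ (X ^ r)))

  𝔼-w : ∀ a → 𝔼 x (λ S → w S a) ≡ Z
  𝔼-w a = begin
    𝔼 x (λ S → y a * [ a ⊆ S ]ₒ)                       ≡⟨ 𝔼-*ˡ x (y a) (λ S → [ a ⊆ S ]ₒ) ⟩
    y a * 𝔼 x (λ S → [ a ⊆ S ]ₒ)                       ≡⟨ cong (y a *_) (𝔼-∏ x (λ b s → if E a b then 𝟙 s else 1)) ⟩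
    y a * ∏ p                                          ≡⟨ ∏-distrib-* (λ b → if E a b then x b else 1) p ⟨
    ∏ (λ b → (if E a b then x b else 1) * p b)         ≡⟨ ∏-cong factor ⟩
    Z                                                  ∎
    where
    open ≡-Reasoning
    p : Fin n → ℕ
    p b = (if E a b then 1 else 1) + (x b ∸ 1) * (if E a b then 0 else 1)
    factor : ∀ b → (if E a b then x b else 1) * p b ≡ x b
    factor b with E a b
    ... | true  = trans (cong (λ q → x b * (1 + q)) (*-zeroʳ (x b ∸ 1))) (*-identityʳ (x b))
    ... | false = trans (+-identityʳ _) (trans (cong (1 +_) (*-identityʳ (x b ∸ 1))) (m+[n∸m]≡n (x≥1 b)))

  meet : Fin n → Fin n → ℕ
  meet a a′ = ∏ (λ b → if E a b ∧ E a′ b then x b else 1)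

  -- A column shared by both rows has to be sampled only once but is compensated for twice, which
  -- leaves one factor `x b` for each shared column.
  𝔼-ww : ∀ a a′ → 𝔼 x (λ S → w S a * w S a′) ≡ Z * meet a a′
  𝔼-ww a a′ = begin
    𝔼 x (λ S → w S a * w S a′)                                     ≡⟨ 𝔼-cong x (λ S → trans (regroup (y a) [ a ⊆ S ]ₒ (y a′) [ a′ ⊆ S ]ₒ) (cong (y a * y a′ *_) (sym (∏-distrib-* (in? a S) (in? a′ S))))) ⟩
    𝔼 x (λ S → y a * y a′ * ∏ (λ b → in? a S b * in? a′ S b))      ≡⟨ 𝔼-*ˡ x (y a * y a′) (λ S → ∏ (λ b → in? a S b * in? a′ S b)) ⟩
    y a * y a′ * 𝔼 x (λ S → ∏ (λ b → in? a S b * in? a′ S b))      ≡⟨ cong₂ _*_ (sym (∏-distrib-* (out a) (out a′))) (𝔼-∏ x (λ b s → (if E a b then 𝟙 s else 1) * (if E a′ b then 𝟙 s else 1))) ⟩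
    ∏ (λ b → out a b * out a′ b) * ∏ p                             ≡⟨ ∏-distrib-* (λ b → out a b * out a′ b) p ⟨
    ∏ (λ b → out a b * out a′ b * p b)                             ≡⟨ ∏-cong factor ⟩
    ∏ (λ b → x b * (if E a b ∧ E a′ b then x b else 1))            ≡⟨ ∏-distrib-* x (λ b → if E a b ∧ E a′ b then x b else 1) ⟩
    Z * meet a a′                                                  ∎
    where
    open ≡-Reasoning
    in? : Fin n → (Fin n → Bool) → Fin n → ℕ
    in? a S b = if E a b then 𝟙 (S b) else 1
    out : Fin n → Fin n → ℕ
    out a b = if E a b then x b else 1
    p : Fin n → ℕ
    p b = (if E a b then 1 else 1) * (if E a′ b then 1 else 1) + (x b ∸ 1) * ((if E a b then 0 else 1) * (if E a′ b then 0 else 1))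
    regroup : ∀ a b c d → a * b * (c * d) ≡ a * c * (b * d)
    regroup = solve-∀
    both : ∀ z z⁻ → z * z * (1 + z⁻ * 0) ≡ z * z
    both = solve-∀
    left : ∀ z z⁻ → z * 1 * (1 + z⁻ * 0) ≡ z * 1
    left = solve-∀
    right : ∀ z z⁻ → 1 * z * (1 + z⁻ * 0) ≡ z * 1
    right = solve-∀
    neither : ∀ z⁻ → 1 * 1 * (1 + z⁻ * 1) ≡ (1 + z⁻) * 1
    neither = solve-∀
    factor : ∀ b → out a b * out a′ b * p b ≡ x b * (if E a b ∧ E a′ b then x b else 1)
    factor b with E a b | E a′ b
    ... | true  | true  = both (x b) (x b ∸ 1)
    ... | true  | false = left (x b) (x b ∸ 1)
    ... | false | true  = right (x b) (x b ∸ 1)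
    ... | false | false = trans (neither (x b ∸ 1)) (cong (_* 1) (m+[n∸m]≡n (x≥1 b)))

  𝔼-P : 𝔼 x P ≡ Z * # A
  𝔼-P = begin
    𝔼 x P                                              ≡⟨ 𝔼-∑ x (λ a S → 𝟙 (A a) * w S a) ⟩
    ∑ (λ a → 𝔼 x (λ S → 𝟙 (A a) * w S a))              ≡⟨ ∑-cong (λ a → trans (𝔼-*ˡ x (𝟙 (A a)) (λ S → w S a)) (cong (𝟙 (A a) *_) (𝔼-w a))) ⟩
    ∑ (λ a → 𝟙 (A a) * Z)                              ≡⟨ ∑-*ʳ Z (𝟙 ∘ A) ⟩
    # A * Z                                            ≡⟨ *-comm (# A) Z ⟩
    Z * # A                                            ∎
    where open ≡-Reasoning

  -- A row that meets `a` only in `b` contributes `x b`, and all of these together at most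
  -- `x b * c b ≤ N`. A row that meets `a` in a further column contributes at most `X ^ r`, and by
  -- the codegree bound there are at most `r * T` of them, counted with multiplicity.
  meet-≤ : ∀ a b → E a b ≡ true → ∑ (λ a′ → e a′ b * meet a a′) ≤ N * 2
  meet-≤ a b Eab = begin
    ∑ (λ a′ → e a′ b * meet a a′)                                                    ≤⟨ ∑-mono (λ a′ → 𝟙-*-≤ (E a′ b) (λ Ea′b → ∏-≤ (common a′) x (X ^ r) b (∧-intro Eab Ea′b) (meet≤ a′))) ⟩
    ∑ (λ a′ → e a′ b * (x b + X ^ r * # (other a′)))                                 ≡⟨ ∑-cong (λ a′ → regroup (e a′ b) (x b) (X ^ r) (# (other a′))) ⟩
    ∑ (λ a′ → x b * e a′ b + X ^ r * (e a′ b * # (other a′)))                        ≡⟨ ∑-linear (X ^ r) (λ a′ → x b * e a′ b) (λ a′ → e a′ b * # (other a′)) ⟩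
    ∑ (λ a′ → x b * e a′ b) + X ^ r * ∑ (λ a′ → e a′ b * # (other a′))               ≡⟨ cong₂ (λ s t → s + X ^ r * t) (∑-*ˡ (x b) (λ a′ → e a′ b)) (trans (∑-cong (λ a′ → sym (∑-*ˡ (e a′ b) (𝟙 ∘ other a′)))) (∑-comm (λ a′ b′ → e a′ b * 𝟙 (other a′ b′)))) ⟩
    x b * c b + X ^ r * ∑ (λ b′ → ∑ (λ a′ → e a′ b * 𝟙 (other a′ b′)))               ≤⟨ +-mono-≤ (xc≤N b) (*-monoʳ-≤ (X ^ r) (≤-trans (∑-mono column) (≤-trans (≤-reflexive (∑-*ʳ T (e a))) (*-monoˡ-≤ T (#E≤r a))))) ⟩
    N + X ^ r * (r * T)                                                              ≤⟨ +-monoʳ-≤ N rXT≤N ⟩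
    N + N                                                                            ≡⟨ double N ⟩
    N * 2                                                                            ∎
    where
    open ≤-Reasoning
    double : ∀ m → m + m ≡ m * 2
    double = solve-∀
    regroup : ∀ s t u v → s * (t + u * v) ≡ t * s + u * (s * v)
    regroup = solve-∀
    common : Fin n → Fin n → Bool
    common a′ b′ = E a b′ ∧ E a′ b′
    other : Fin n → Fin n → Bool
    other a′ b′ = not (does (b Fin.≟ b′)) ∧ common a′ b′
    meet≤ : ∀ a′ → meet a a′ ≤ X ^ r
    meet≤ a′ = ≤-trans (∏-mono bound) (≤-trans (≤-reflexive (∏-if-^ (common a′) X))
                 (X^≤ b (≤-trans (#-mono (λ b′ eq → proj₁ (∧-true {E a b′} eq))) (#E≤r a))))
      where
      bound : ∀ b′ → (if common a′ b′ then x b′ else 1) ≤ (if common a′ b′ then X else 1)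
      bound b′ with common a′ b′
      ... | true  = x≤X b′
      ... | false = ≤-refl
    column : ∀ b′ → ∑ (λ a′ → e a′ b * 𝟙 (other a′ b′)) ≤ e a b′ * T
    column b′ with b Fin.≟ b′
    ... | yes _ = ≤-trans (≤-reflexive (∑-zero (λ a′ → *-zeroʳ (e a′ b)))) z≤n
    ... | no b≢b′ with E a b′
    ...   | false = ≤-trans (≤-reflexive (∑-zero (λ a′ → *-zeroʳ (e a′ b)))) z≤n
    ...   | true  = ≤-trans (≤-reflexive (∑-cong (λ a′ → sym (𝟙-∧ (E a′ b) (E a′ b′)))))
                      (≤-trans (codegree b b′ b≢b′) (≤-reflexive (sym (+-identityʳ T))))

  𝔼-Y² : 𝔼 x (λ S → ∑ (λ b → Y S b * Y S b)) ≤ Z * (N * 2 * (r * # A))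
  𝔼-Y² = begin
    𝔼 x (λ S → ∑ (λ b → Y S b * Y S b))                                          ≡⟨ 𝔼-∑ x (λ b S → Y S b * Y S b) ⟩
    ∑ (λ b → 𝔼 x (λ S → Y S b * Y S b))                                          ≡⟨ ∑-cong square ⟩
    ∑ (λ b → ∑ (λ a → e a b * (Z * ∑ (λ a′ → e a′ b * meet a a′))))              ≤⟨ ∑-mono (λ b → ∑-mono (λ a → 𝟙-*-≤ (E a b) (λ Eab → *-monoʳ-≤ Z (meet-≤ a b Eab)))) ⟩
    ∑ (λ b → ∑ (λ a → e a b * (Z * (N * 2))))                                    ≡⟨ ∑-cong (λ b → ∑-*ʳ (Z * (N * 2)) (λ a → e a b)) ⟩
    ∑ (λ b → c b * (Z * (N * 2)))                                                ≡⟨ ∑-*ʳ (Z * (N * 2)) c ⟩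
    ∑ c * (Z * (N * 2))                                                          ≡⟨ cong (_* (Z * (N * 2))) ∑-c ⟩
    r * # A * (Z * (N * 2))                                                      ≡⟨ regroup (r * # A) Z (N * 2) ⟩
    Z * (N * 2 * (r * # A))                                                      ∎
    where
    open ≤-Reasoning
    regroup : ∀ s t u → s * (t * u) ≡ t * (u * s)
    regroup = solve-∀
    regroup₄ : ∀ s t u v → s * t * (u * v) ≡ s * u * (t * v)
    regroup₄ = solve-∀
    regroup₅ : ∀ s t u v → s * t * (u * v) ≡ s * (u * (t * v))
    regroup₅ = solve-∀
    square : ∀ b → 𝔼 x (λ S → Y S b * Y S b) ≡ ∑ (λ a → e a b * (Z * ∑ (λ a′ → e a′ b * meet a a′)))
    square b = begin-equality
      𝔼 x (λ S → Y S b * Y S b)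
        ≡⟨ 𝔼-cong x (λ S → trans (sym (∑-*ʳ (Y S b) (λ a → e a b * w S a)))
             (∑-cong (λ a → sym (∑-*ˡ (e a b * w S a) (λ a′ → e a′ b * w S a′))))) ⟩
      𝔼 x (λ S → ∑ (λ a → ∑ (λ a′ → e a b * w S a * (e a′ b * w S a′))))
        ≡⟨ trans (𝔼-∑ x (λ a S → ∑ (λ a′ → e a b * w S a * (e a′ b * w S a′))))
             (∑-cong (λ a → 𝔼-∑ x (λ a′ S → e a b * w S a * (e a′ b * w S a′)))) ⟩
      ∑ (λ a → ∑ (λ a′ → 𝔼 x (λ S → e a b * w S a * (e a′ b * w S a′))))
        ≡⟨ ∑-cong (λ a → ∑-cong (λ a′ → trans (𝔼-cong x (λ S → regroup₄ (e a b) (w S a) (e a′ b) (w S a′)))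
             (trans (𝔼-*ˡ x (e a b * e a′ b) (λ S → w S a * w S a′)) (cong (e a b * e a′ b *_) (𝔼-ww a a′))))) ⟩
      ∑ (λ a → ∑ (λ a′ → e a b * e a′ b * (Z * meet a a′)))
        ≡⟨ ∑-cong (λ a → trans (∑-cong (λ a′ → regroup₅ (e a b) (e a′ b) Z (meet a a′)))
             (trans (∑-*ˡ (e a b) (λ a′ → Z * (e a′ b * meet a a′))) (cong (e a b *_) (∑-*ˡ Z (λ a′ → e a′ b * meet a a′))))) ⟩
      ∑ (λ a → e a b * (Z * ∑ (λ a′ → e a′ b * meet a a′)))                      ∎

  -- The column b is chosen with probability at most 2 (c b + δ) / N. The degrees sum to `r * # A`,
  -- and by `δB≤A` so do, at most, the terms δ, so the floor that keeps the probabilities away from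
  -- 0 no more than doubles the bound.
  𝔼-# : 𝔼 x (λ S → N * # (λ b → S b ∧ B b)) ≤ Z * (r * # A * 4)
  𝔼-# = begin
    𝔼 x (λ S → N * # (λ b → S b ∧ B b))                        ≡⟨ 𝔼-cong x (λ S → trans (sym (∑-*ˡ N (λ b → 𝟙 (S b ∧ B b)))) (∑-cong (λ b → trans (cong (N *_) (𝟙-∧ (S b) (B b))) (regroup N (𝟙 (S b)) (𝟙 (B b)))))) ⟩
    𝔼 x (λ S → ∑ (λ b → 𝟙 (B b) * N * 𝟙 (S b)))                ≡⟨ trans (𝔼-∑ x (λ b S → 𝟙 (B b) * N * 𝟙 (S b))) (∑-cong (λ b → 𝔼-*ˡ x (𝟙 (B b) * N) (λ S → 𝟙 (S b)))) ⟩
    ∑ (λ b → 𝟙 (B b) * N * 𝔼 x (λ S → 𝟙 (S b)))                ≤⟨ ∑-mono (λ b → bound b) ⟩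
    ∑ (λ b → Z * 2 * (c b + 𝟙 (B b) * δ))                      ≡⟨ trans (∑-*ˡ (Z * 2) (λ b → c b + 𝟙 (B b) * δ)) (cong (Z * 2 *_) (trans (∑-distrib-+ c (λ b → 𝟙 (B b) * δ)) (cong₂ _+_ ∑-c (∑-*ʳ δ (𝟙 ∘ B))))) ⟩
    Z * 2 * (r * # A + # B * δ)                                ≤⟨ *-monoʳ-≤ (Z * 2) (+-monoʳ-≤ (r * # A) δB≤A) ⟩
    Z * 2 * (r * # A + r * # A)                                ≡⟨ regroup′ Z (r * # A) ⟩
    Z * (r * # A * 4)                                          ∎
    where
    open ≤-Reasoning
    regroup : ∀ s t u → s * (t * u) ≡ u * s * t
    regroup = solve-∀
    regroup′ : ∀ s t → s * 2 * (t + t) ≡ s * (t * 4)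
    regroup′ = solve-∀
    regroup″ : ∀ s t u → s * (t * 2) * u ≡ s * u * 2 * t
    regroup″ = solve-∀
    bound : ∀ b → 𝟙 (B b) * N * 𝔼 x (λ S → 𝟙 (S b)) ≤ Z * 2 * (c b + 𝟙 (B b) * δ)
    bound b with B b in Bb
    ... | false = z≤n
    ... | true  = begin
      (N + 0) * 𝔼 x (λ S → 𝟙 (S b))                      ≤⟨ *-monoˡ-≤ _ (≤-trans (≤-reflexive (+-identityʳ N)) (N≤xc b)) ⟩
      x b * ((c b + δ) * 2) * 𝔼 x (λ S → 𝟙 (S b))        ≡⟨ regroup″ (x b) (c b + δ) (𝔼 x (λ S → 𝟙 (S b))) ⟩
      x b * 𝔼 x (λ S → 𝟙 (S b)) * 2 * (c b + δ)          ≡⟨ cong₂ (λ z d → z * 2 * (c b + d)) (𝔼-member x x≥1 b) (sym (+-identityʳ δ)) ⟩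
      Z * 2 * (c b + (δ + 0))                            ∎

  N*# : (Fin n → Bool) → ℕ
  N*# S = N * # (λ b → S b ∧ B b)

  Y² : (Fin n → Bool) → ℕ
  Y² S = ∑ (λ b → Y S b * Y S b)

  ∑-Y : ∀ S → ∑ (Y S) ≡ r * P S
  ∑-Y S = begin
    ∑ (λ b → ∑ (λ a → e a b * w S a))    ≡⟨ ∑-comm (λ b a → e a b * w S a) ⟩
    ∑ (λ a → ∑ (λ b → e a b * w S a))    ≡⟨ ∑-cong (λ a → trans (∑-*ʳ (w S a) (e a)) (trans (cong (_* w S a) (rows a)) (*-assoc r (𝟙 (A a)) (w S a)))) ⟩
    ∑ (λ a → r * (𝟙 (A a) * w S a))      ≡⟨ ∑-*ˡ r (λ a → 𝟙 (A a) * w S a) ⟩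
    r * P S                              ∎
    where open ≡-Reasoning

  module _ (S : Fin n → Bool) where

    -- In expectation the sum of the squares of `Y` is at most 2N times the sum of `Y` (`𝔼-Y²`), so
    -- columns above the threshold 4N carry at most half of the total.
    light : Fin n → Bool
    light b = does (Y S b ≤? N * 4)

    B′ : Fin n → Bool
    B′ b = (S b ∧ B b) ∧ light b

    E′ : Fin n → Fin n → Bool
    E′ a b = E a b ∧ B′ b

    unused : ∀ b → S b ∧ B b ≡ false → Y S b ≡ 0
    unused b eq = ∑-zero zero-term
      where
      zero-term : ∀ a → e a b * w S a ≡ 0
      zero-term a with E a b in Eab
      ... | false = refl
      ... | true  = trans (+-identityʳ _) (trans (cong (y a *_) not⊆) (*-zeroʳ (y a)))
        where
        Sb : S b ≡ false
        Sb = not-true (λ Sb≡true → true≢false (∧-intro Sb≡true (E⊆B a b Eab)) eq)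
        not⊆ : [ a ⊆ S ]ₒ ≡ 0
        not⊆ = ∏-zero b (trans (cong (if_then 𝟙 (S b) else 1) Eab) (cong 𝟙 Sb))
          where
          ∏-zero : ∀ {m} {f : Fin m → ℕ} i → f i ≡ 0 → ∏ f ≡ 0
          ∏-zero {f = f} zero    eq rewrite eq = refl
          ∏-zero {f = f} (suc i) eq rewrite ∏-zero {f = f ∘ suc} i eq = *-zeroʳ (f zero)

    heavy-≤ : ∀ b → N * 4 * Y S b ≤ N * 4 * (𝟙 (B′ b) * Y S b) + Y S b * Y S b
    heavy-≤ b with S b ∧ B b in SBb
    ... | false = ≤-trans (≤-reflexive (trans (cong (N * 4 *_) (unused b SBb)) (*-zeroʳ (N * 4)))) z≤n
    ... | true  = by-weight (Y S b ≤? N * 4)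
      where
      by-weight : (Yb≤? : Dec (Y S b ≤ N * 4)) → N * 4 * Y S b ≤ N * 4 * (𝟙 (does Yb≤?) * Y S b) + Y S b * Y S b
      by-weight (yes _)   = ≤-trans (≤-reflexive (cong (N * 4 *_) (sym (+-identityʳ (Y S b))))) (m≤m+n _ _)
      by-weight (no Yb≰)  = ≤-trans (*-monoˡ-≤ (Y S b) (≰⇒≥ Yb≰)) (m≤n+m _ _)

    light-≤ : ∀ b → 𝟙 (B′ b) * Y S b ≤ N * 4
    light-≤ b with B′ b in eq
    ... | false = z≤n
    ... | true  = ≤-trans (≤-reflexive (+-identityʳ _)) (does-true (Y S b ≤? N * 4) (proj₂ (∧-true {S b ∧ B b} eq)))

    light-edges : ∑ (λ b → 𝟙 (B′ b) * Y S b) ≡ ∑ (λ a → w S a * # (E′ a))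
    light-edges = begin
      ∑ (λ b → 𝟙 (B′ b) * Y S b)                              ≡⟨ ∑-cong (λ b → sym (∑-*ˡ (𝟙 (B′ b)) (λ a → e a b * w S a))) ⟩
      ∑ (λ b → ∑ (λ a → 𝟙 (B′ b) * (e a b * w S a)))          ≡⟨ ∑-comm (λ b a → 𝟙 (B′ b) * (e a b * w S a)) ⟩
      ∑ (λ a → ∑ (λ b → 𝟙 (B′ b) * (e a b * w S a)))          ≡⟨ ∑-cong (λ a → ∑-cong (λ b → trans (regroup (𝟙 (B′ b)) (e a b) (w S a)) (cong (w S a *_) (sym (𝟙-∧ (E a b) (B′ b)))))) ⟩
      ∑ (λ a → ∑ (λ b → w S a * 𝟙 (E′ a b)))                  ≡⟨ ∑-cong (λ a → ∑-*ˡ (w S a) (𝟙 ∘ E′ a)) ⟩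
      ∑ (λ a → w S a * # (E′ a))                              ∎
      where
      open ≡-Reasoning
      regroup : ∀ s t u → s * (t * u) ≡ u * (t * s)
      regroup = solve-∀

    -- Three kinds of entries: a row in `A″` has weighted size at most `X ^ r * r ≤ N`; the columns
    -- in `S″` that count are light, so each carries at most 4N, and there are at most `# A″` of
    -- them; any other row has at most k entries outside `S″`.
    covered : ∀ k (A″ S″ : Fin n → Bool) → (∀ a → A″ a ≡ false → # (λ b → E′ a b ∧ not (S″ b)) ≤ k) → # S″ ≤ # A″ →
              ∑ (λ b → 𝟙 (B′ b) * Y S b) ≤ N * 5 * # A″ + k * P S
    covered k A″ S″ few S≤A = begin
      ∑ (λ b → 𝟙 (B′ b) * Y S b)                                                                   ≡⟨ light-edges ⟩
      ∑ (λ a → w S a * # (E′ a))                                                                   ≤⟨ ∑-mono row ⟩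
      ∑ (λ a → 𝟙 (A″ a) * N + w S a * # (λ b → E′ a b ∧ S″ b) + k * (𝟙 (A a) * w S a))              ≡⟨ ∑-linear k (λ a → 𝟙 (A″ a) * N + w S a * # (λ b → E′ a b ∧ S″ b)) (λ a → 𝟙 (A a) * w S a) ⟩
      ∑ (λ a → 𝟙 (A″ a) * N + w S a * # (λ b → E′ a b ∧ S″ b)) + k * P S                            ≡⟨ cong (_+ k * P S) (trans (∑-distrib-+ (λ a → 𝟙 (A″ a) * N) (λ a → w S a * # (λ b → E′ a b ∧ S″ b))) (cong₂ _+_ (∑-*ʳ N (𝟙 ∘ A″)) columns)) ⟩
      # A″ * N + ∑ (λ b → 𝟙 (S″ b) * (𝟙 (B′ b) * Y S b)) + k * P S                                  ≤⟨ +-monoˡ-≤ (k * P S) (+-monoʳ-≤ (# A″ * N) (≤-trans (∑-mono (λ b → *-monoʳ-≤ (𝟙 (S″ b)) (light-≤ b))) (≤-trans (≤-reflexive (∑-*ʳ (N * 4) (𝟙 ∘ S″))) (*-monoˡ-≤ (N * 4) S≤A)))) ⟩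
      # A″ * N + # A″ * (N * 4) + k * P S                                                           ≡⟨ cong (_+ k * P S) (regroup (# A″) N) ⟩
      N * 5 * # A″ + k * P S                                                                        ∎
      where
      open ≤-Reasoning
      regroup : ∀ s t → s * t + s * (t * 4) ≡ t * 5 * s
      regroup = solve-∀
      regroup′ : ∀ s t u v → u * (t * s * v) ≡ s * t * v * u
      regroup′ = solve-∀
      columns : ∑ (λ a → w S a * # (λ b → E′ a b ∧ S″ b)) ≡ ∑ (λ b → 𝟙 (S″ b) * (𝟙 (B′ b) * Y S b))
      columns = begin-equality
        ∑ (λ a → w S a * # (λ b → E′ a b ∧ S″ b))                              ≡⟨ ∑-cong (λ a → trans (sym (∑-*ˡ (w S a) (λ b → 𝟙 (E′ a b ∧ S″ b)))) (∑-cong (entry a))) ⟩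
        ∑ (λ a → ∑ (λ b → 𝟙 (S″ b) * 𝟙 (B′ b) * (e a b * w S a)))              ≡⟨ ∑-comm (λ a b → 𝟙 (S″ b) * 𝟙 (B′ b) * (e a b * w S a)) ⟩
        ∑ (λ b → ∑ (λ a → 𝟙 (S″ b) * 𝟙 (B′ b) * (e a b * w S a)))              ≡⟨ ∑-cong (λ b → trans (∑-*ˡ (𝟙 (S″ b) * 𝟙 (B′ b)) (λ a → e a b * w S a)) (*-assoc (𝟙 (S″ b)) (𝟙 (B′ b)) (Y S b))) ⟩
        ∑ (λ b → 𝟙 (S″ b) * (𝟙 (B′ b) * Y S b))                                ∎
        where
        entry : ∀ a b → w S a * 𝟙 (E′ a b ∧ S″ b) ≡ 𝟙 (S″ b) * 𝟙 (B′ b) * (e a b * w S a)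
        entry a b = trans (cong (w S a *_) (trans (𝟙-∧ (E′ a b) (S″ b)) (cong (_* 𝟙 (S″ b)) (𝟙-∧ (E a b) (B′ b)))))
                          (shuffle (w S a) (e a b) (𝟙 (B′ b)) (𝟙 (S″ b)))
          where
          shuffle : ∀ s t u v → s * (t * u * v) ≡ v * u * (t * s)
          shuffle = solve-∀
      row : ∀ a → w S a * # (E′ a) ≤ 𝟙 (A″ a) * N + w S a * # (λ b → E′ a b ∧ S″ b) + k * (𝟙 (A a) * w S a)
      row a with A″ a in A″a
      ... | true  = begin
        w S a * # (E′ a)      ≤⟨ *-mono-≤ (w≤ S a) (≤-trans (#-mono (λ b eq → proj₁ (∧-true {E a b} eq))) (#E≤r a)) ⟩
        X ^ r * r             ≤⟨ rX≤N ⟩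
        N                     ≡⟨ +-identityʳ N ⟨
        N + 0                 ≤⟨ ≤-trans (m≤m+n _ _) (m≤m+n _ _) ⟩
        N + 0 + w S a * # (λ b → E′ a b ∧ S″ b) + k * (𝟙 (A a) * w S a) ∎
      ... | false with A a in Aa
      ...   | false = ≤-trans (≤-reflexive (trans (cong (w S a *_) no-entries) (*-zeroʳ (w S a)))) z≤n
        where
        no-entries : # (E′ a) ≡ 0
        no-entries = n≤0⇒n≡0 (≤-trans (#-mono (λ b eq → proj₁ (∧-true {E a b} eq)))
          (≤-reflexive (trans (rows a) (trans (cong (λ s → r * 𝟙 s) Aa) (*-zeroʳ r)))))
      ...   | true  = begin
        w S a * # (E′ a)                                                                     ≡⟨ cong (w S a *_) (trans (∑-cong (λ b → 𝟙-split (E′ a b) (S″ b))) (∑-distrib-+ (λ b → 𝟙 (E′ a b ∧ S″ b)) (λ b → 𝟙 (E′ a b ∧ not (S″ b))))) ⟩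
        w S a * (# (λ b → E′ a b ∧ S″ b) + # (λ b → E′ a b ∧ not (S″ b)))                    ≤⟨ *-monoʳ-≤ (w S a) (+-monoʳ-≤ (# (λ b → E′ a b ∧ S″ b)) (few a A″a)) ⟩
        w S a * (# (λ b → E′ a b ∧ S″ b) + k)                                                ≡⟨ spread (w S a) (# (λ b → E′ a b ∧ S″ b)) k ⟩
        w S a * # (λ b → E′ a b ∧ S″ b) + k * (w S a + 0)                                    ∎
        where
        spread : ∀ s t u → s * (t + u) ≡ s * t + u * (s + 0)
        spread = solve-∀

  𝔼-small : ∀ α β γ → r * (α * 4 + β * 2) < γ → 0 < # A → 0 < N →
            𝔼 x (λ S → N * α * N*# S + β * Y² S) < 𝔼 x (λ S → N * γ * P S)
  𝔼-small α β γ <γ 0<A 0<N = begin-strict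
    𝔼 x (λ S → N * α * N*# S + β * Y² S)                          ≡⟨ trans (𝔼-+ x (λ S → N * α * N*# S) (λ S → β * Y² S)) (cong₂ _+_ (𝔼-*ˡ x (N * α) N*#) (𝔼-*ˡ x β Y²)) ⟩
    N * α * 𝔼 x N*# + β * 𝔼 x Y²                                  ≤⟨ +-mono-≤ (*-monoʳ-≤ (N * α) 𝔼-#) (*-monoʳ-≤ β 𝔼-Y²) ⟩
    N * α * (Z * (r * # A * 4)) + β * (Z * (N * 2 * (r * # A)))    ≡⟨ collect N α Z r (# A) β ⟩
    N * (Z * # A) * (r * (α * 4 + β * 2))                          <⟨ *-monoʳ-< (N * (Z * # A)) {{>-nonZero (*-mono-< 0<N (*-mono-< 0<Z 0<A))}} <γ ⟩
    N * (Z * # A) * γ                                              ≡⟨ final N (Z * # A) γ ⟩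
    N * γ * (Z * # A)                                              ≡⟨ cong (N * γ *_) 𝔼-P ⟨
    N * γ * 𝔼 x P                                                  ≡⟨ 𝔼-*ˡ x (N * γ) P ⟨
    𝔼 x (λ S → N * γ * P S)                                        ∎
    where
    open ≤-Reasoning
    collect : ∀ s α z u a β → s * α * (z * (u * a * 4)) + β * (z * (s * 2 * (u * a))) ≡ s * (z * a) * (u * (α * 4 + β * 2))
    collect = solve-∀
    final : ∀ s z γ → s * z * γ ≡ s * γ * z
    final = solve-∀
    0<Z : 0 < Z
    0<Z = ≤-trans (≤-reflexive (sym (∏-one {n} (λ _ → refl)))) (∏-mono x≥1)

  module _ {G : Graph n} {side : Fin n → Bool} (bip : Bipartite G side E) (κ : ℕ) .{{_ : NonZero κ}} (r≡ : r ≡ κ * 512) where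

    -- The total `N * 4 * ∑ (Y S)` is split into heavy columns, paid for by `Y²`, and light ones,
    -- bounded by `covered`, where 63 `# A″` is at most the number of chosen columns. The
    -- coefficient 112896 = 63 · 4 · (512 - 64) is what remains of `P S`.
    outcome : ∀ S → HasPiece κ G ⊎ N * (κ * 112896) * P S ≤ N * 20 * N*# S + 63 * Y² S
    outcome S with cover G {E = E′ S} (λ a b eq → bip a b (proj₁ (∧-true {E a b} eq))) (B′ S) (λ a b eq → proj₂ (∧-true {E a b} eq)) κ
    ... | inj₁ piece = inj₁ piece
    ... | inj₂ (A″ , S″ , A″≤B′ , S″≤A″ , few) = inj₂ (+-cancelˡ-≤ (N * P S * κ * 16128) _ _ (begin
      N * P S * κ * 16128 + N * (κ * 112896) * P S                             ≡⟨ total N (P S) κ ⟩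
      N * 4 * (κ * 512 * P S) * 63                                             ≡⟨ cong (λ s → N * 4 * s * 63) (trans (cong (_* P S) (sym r≡)) (sym (∑-Y S))) ⟩
      N * 4 * ∑ (Y S) * 63                                                     ≡⟨ cong (_* 63) (∑-*ˡ (N * 4) (Y S)) ⟨
      ∑ (λ b → N * 4 * Y S b) * 63                                             ≤⟨ *-monoˡ-≤ 63 (∑-mono (heavy-≤ S)) ⟩
      ∑ (λ b → N * 4 * (𝟙 (B′ S b) * Y S b) + Y S b * Y S b) * 63              ≡⟨ cong (_* 63) (trans (∑-distrib-+ (λ b → N * 4 * (𝟙 (B′ S b) * Y S b)) (λ b → Y S b * Y S b)) (cong (_+ Y² S) (∑-*ˡ (N * 4) (λ b → 𝟙 (B′ S b) * Y S b)))) ⟩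
      (N * 4 * ∑ (λ b → 𝟙 (B′ S b) * Y S b) + Y² S) * 63                       ≤⟨ *-monoˡ-≤ 63 (+-monoˡ-≤ (Y² S) (*-monoʳ-≤ (N * 4) (covered S (κ * 64) A″ S″ few S″≤A″))) ⟩
      (N * 4 * (N * 5 * # A″ + κ * 64 * P S) + Y² S) * 63                      ≡⟨ expand N (# A″) κ (P S) (Y² S) ⟩
      N * P S * κ * 16128 + (N * 20 * (N * (# A″ * 63)) + 63 * Y² S)           ≤⟨ +-monoʳ-≤ (N * P S * κ * 16128) (+-monoˡ-≤ (63 * Y² S) (*-monoʳ-≤ (N * 20) (*-monoʳ-≤ N (≤-trans A″≤B′ (#-mono (λ b eq → proj₁ (∧-true {S b ∧ B b} eq))))))) ⟩
      N * P S * κ * 16128 + (N * 20 * N*# S + 63 * Y² S)                      ∎))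
      where
      open ≤-Reasoning
      total : ∀ s t u → s * t * u * 16128 + s * (u * 112896) * t ≡ s * 4 * (u * 512 * t) * 63
      total s t u = trans (merge s t u 16128 112896) (sym (pull s t u 4 512 63))
        where
        merge : ∀ s t u m n → s * t * u * m + s * (u * n) * t ≡ s * t * u * (m + n)
        merge = solve-∀
        pull : ∀ s t u l m n → s * l * (u * m * t) * n ≡ s * t * u * (l * m * n)
        pull = solve-∀
      expand : ∀ s a u t q → (s * 4 * (s * 5 * a + u * 64 * t) + q) * 63 ≡ s * t * u * 16128 + (s * 20 * (s * (a * 63)) + 63 * q)
      expand s a u t q = pull s a u t q 4 5 64 63
        where
        pull : ∀ s a u t q k l m n → (s * k * (s * l * a + u * m * t) + q) * n ≡ s * t * u * (k * m * n) + (s * (k * l) * (s * (a * n)) + n * q)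
        pull = solve-∀

    -- On average over S and in units of `r * # A`, light columns carry at least 1/2, while a
    -- failure of `cover` for every S would leave them at most 20/63 + 1/8. The term 1/8 is `κ * 64`
    -- against `r = κ * 512`. In integers this is the comparison below, with 206 = 20 · 4 + 63 · 2
    -- from `𝔼-#` and `𝔼-Y²`.
    core-piece : 0 < # A → 0 < N → HasPiece κ G
    core-piece 0<A 0<N = [ id , (λ ge → contradiction (proj₂ good) (≤⇒≯ ge)) ]′ (outcome (proj₁ good))
      where
      coefficients : r * 206 < κ * 112896
      coefficients = begin-strict
        r * 206         ≡⟨ trans (cong (_* 206) r≡) (*-assoc κ 512 206) ⟩
        κ * 105472      <⟨ *-monoʳ-< κ (<ᵇ⇒< 105472 112896 _) ⟩
        κ * 112896      ∎
        where open ≤-Reasoning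
      good : ∃ λ S → N * 20 * N*# S + 63 * Y² S < N * (κ * 112896) * P S
      good = 𝔼-<⇒∃ x (λ S → N * 20 * N*# S + 63 * Y² S) (λ S → N * (κ * 112896) * P S) (𝔼-small 20 63 (κ * 112896) coefficients 0<A 0<N)

-- Independent sets or stars, and Kővári-Sós-Turán counting

#-singleton : ∀ {n} (b : Fin n) → # (λ i → does (b Fin.≟ i)) ≡ 1
#-singleton {suc n} b = trans (sum-remove {n} {b} (λ i → 𝟙 (does (b Fin.≟ i))))
  (cong₂ _+_ (cong 𝟙 (dec-true (b Fin.≟ b) refl))
             (#-zero (λ j → does (b Fin.≟ punchIn b j)) (λ j → dec-false (b Fin.≟ punchIn b j) (Fin.punchInᵢ≢i b j ∘ sym))))

#-remove : ∀ {n} (f : Fin n → Bool) b → # f ≤ suc (# (λ i → f i ∧ not (does (b Fin.≟ i))))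
#-remove f b = begin
  # f                                                                ≤⟨ ∑-mono (λ i → split (f i) (does (b Fin.≟ i))) ⟩
  ∑ (λ i → 𝟙 (does (b Fin.≟ i)) + 𝟙 (f i ∧ not (does (b Fin.≟ i))))  ≡⟨ ∑-distrib-+ (λ i → 𝟙 (does (b Fin.≟ i))) (λ i → 𝟙 (f i ∧ not (does (b Fin.≟ i)))) ⟩
  # (λ i → does (b Fin.≟ i)) + # (λ i → f i ∧ not (does (b Fin.≟ i))) ≡⟨ cong (_+ # (λ i → f i ∧ not (does (b Fin.≟ i)))) (#-singleton b) ⟩
  suc (# (λ i → f i ∧ not (does (b Fin.≟ i))))                       ∎
  where
  open ≤-Reasoning
  split : ∀ s d → 𝟙 s ≤ 𝟙 d + 𝟙 (s ∧ not d)
  split false d     = z≤n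
  split true  true  = ≤-refl
  split true  false = ≤-refl

#-insert : ∀ {n} (g : Fin n → Bool) b → g b ≡ false → # (λ i → does (b Fin.≟ i) ∨ g i) ≡ suc (# g)
#-insert g b gb = trans (∑-cong split) (trans (∑-distrib-+ (λ i → 𝟙 (does (b Fin.≟ i))) (𝟙 ∘ g)) (cong (_+ # g) (#-singleton b)))
  where
  split : ∀ i → 𝟙 (does (b Fin.≟ i) ∨ g i) ≡ 𝟙 (does (b Fin.≟ i)) + 𝟙 (g i)
  split i with b Fin.≟ i
  ... | yes refl rewrite gb = refl
  ... | no _     = refl

Independent : ∀ {n} → (Fin n → Fin n → Bool) → (Fin n → Bool) → Set
Independent h g = ∀ b b′ → g b ≡ true → g b′ ≡ true → h b b′ ≡ false

-- A greedy choice: unless `b` is the centre of a star, taking it removes `b` and fewer than t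
-- neighbours, so at most t candidates per chosen element.
independent-or-star :
  ∀ {n} (h : Fin n → Fin n → Bool) → (∀ b b′ → h b b′ ≡ h b′ b) → (∀ b → h b b ≡ false) → ∀ t .{{_ : NonZero t}} r f → r * t ≤ # f →
  (∃ λ g → g ⊆ f × # g ≡ r × Independent h g) ⊎ (∃ λ b → f b ≡ true × t ≤ # (λ b′ → f b′ ∧ h b b′))
independent-or-star {n} h h-sym h-irrefl t zero    f _ = inj₁ ((λ _ → false) , (λ _ ()) , #-zero {n} (λ _ → false) (λ _ → refl) , (λ _ _ ()))
independent-or-star {n} h h-sym h-irrefl t (suc r) f t≤f
  with 0<#⇒∃ f (≤-trans (>-nonZero⁻¹ t) (≤-trans (m≤m+n t (r * t)) t≤f))
... | b , fb with t ≤? # (λ b′ → f b′ ∧ h b b′)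
...   | yes star = inj₂ (b , fb , star)
...   | no t≰d = extend (independent-or-star h h-sym h-irrefl t r f′ r≤f′)
  where
  f′ : Fin n → Bool
  f′ i = (f i ∧ not (h b i)) ∧ not (does (b Fin.≟ i))
  f′⇒ : ∀ {i} → f′ i ≡ true → f i ≡ true × h b i ≡ false × b ≢ i
  f′⇒ {i} f′i with f i | h b i | b Fin.≟ i
  ... | true | false | no b≢i = refl , refl , b≢i
  r≤f′ : r * t ≤ # f′
  r≤f′ = +-cancelˡ-≤ t _ _ (begin
    t + r * t                                                        ≤⟨ t≤f ⟩
    # f                                                              ≡⟨ trans (∑-cong (λ i → 𝟙-split (f i) (h b i))) (∑-distrib-+ (λ i → 𝟙 (f i ∧ h b i)) (λ i → 𝟙 (f i ∧ not (h b i)))) ⟩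
    # (λ i → f i ∧ h b i) + # (λ i → f i ∧ not (h b i))              ≤⟨ +-monoʳ-≤ (# (λ i → f i ∧ h b i)) (#-remove (λ i → f i ∧ not (h b i)) b) ⟩
    # (λ i → f i ∧ h b i) + suc (# f′)                               ≡⟨ +-suc (# (λ i → f i ∧ h b i)) (# f′) ⟩
    suc (# (λ i → f i ∧ h b i)) + # f′                               ≤⟨ +-monoˡ-≤ (# f′) (≰⇒> t≰d) ⟩
    t + # f′                                                         ∎)
    where open ≤-Reasoning
  extend : _ → _
  extend (inj₂ (c , f′c , star)) = inj₂ (c , proj₁ (f′⇒ f′c) , ≤-trans star (#-mono (λ i eq →
    let f′i , hci = ∧-true {f′ i} eq in ∧-intro (proj₁ (f′⇒ f′i)) hci)))
  extend (inj₁ (g , g⊆f′ , #g , indep)) = inj₁ (g⁺ , g⁺⊆f , trans (#-insert g b gb) (cong suc #g) , indep⁺)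
    where
    g⁺ : Fin n → Bool
    g⁺ i = does (b Fin.≟ i) ∨ g i
    g⁺⇒ : ∀ {i} → g⁺ i ≡ true → b ≡ i ⊎ g i ≡ true
    g⁺⇒ {i} eq with b Fin.≟ i
    ... | yes b≡i = inj₁ b≡i
    ... | no _    = inj₂ eq
    gb : g b ≡ false
    gb = not-true (λ eq → proj₂ (proj₂ (f′⇒ (g⊆f′ b eq))) refl)
    g⁺⊆f : g⁺ ⊆ f
    g⁺⊆f i eq with g⁺⇒ {i} eq
    ... | inj₁ refl = fb
    ... | inj₂ gi   = proj₁ (f′⇒ (g⊆f′ i gi))
    indep⁺ : Independent h g⁺
    indep⁺ i j gi gj with g⁺⇒ {i} gi | g⁺⇒ {j} gj
    ... | inj₁ refl | inj₁ refl = h-irrefl b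
    ... | inj₁ refl | inj₂ gj′  = proj₁ (proj₂ (f′⇒ (g⊆f′ j gj′)))
    ... | inj₂ gi′  | inj₁ refl = trans (h-sym i b) (proj₁ (proj₂ (f′⇒ (g⊆f′ i gi′))))
    ... | inj₂ gi′  | inj₂ gj′  = indep i j gi′ gj′

pigeonhole : ∀ {n} (C : Fin n → Bool) (s : Fin n → ℕ) m → # C * m < ∑ (λ b → 𝟙 (C b) * s b) → ∃ λ b → C b ≡ true × m < s b
pigeonhole C s m lt with ∑<∑⇒∃ (λ b → 𝟙 (C b) * m) (λ b → 𝟙 (C b) * s b) (subst (_< _) (sym (∑-*ʳ m (𝟙 ∘ C))) lt)
... | b , lt′ with C b in Cb
...   | true = b , Cb , +-cancelʳ-< 0 _ _ lt′

-- The columns are found one at a time by pigeonhole. Every row of `A` still has an entry in `C`, so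
-- some column of `C` keeps more than a fraction 1 / h of the rows. That column then leaves `C`,
-- which costs each kept row one entry.
kővári-sós-turán :
  ∀ t {p n} (M : Fin p → Fin n → Bool) (A : Fin p → Bool) (C : Fin n → Bool) h m → # C ≤ h →
  (∀ a → A a ≡ true → t ≤ # (λ b → M a b ∧ C b)) → h ^ t * m < # A →
  ∃₂ λ (q : Fin t → Fin n) A′ → Injective _≡_ _≡_ q × (∀ i → C (q i) ≡ true) ×
    m < # A′ × (∀ a → A′ a ≡ true → A a ≡ true × ∀ i → M a (q i) ≡ true)
kővári-sós-turán zero M A C h m _ _ lt =
  (λ ()) , A , (λ { {()} }) , (λ ()) , subst (_< # A) (+-identityʳ m) lt , λ a Aa → Aa , λ ()
kővári-sós-turán (suc t) {p} {n} M A C h m C≤h rows lt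
  with pigeonhole C (λ b → # (λ a → A a ∧ M a b)) (h ^ t * m) many
  where
  open ≤-Reasoning
  swap : ∀ b → ∑ (λ a → 𝟙 (A a) * 𝟙 (M a b ∧ C b)) ≡ 𝟙 (C b) * # (λ a → A a ∧ M a b)
  swap b = trans (∑-cong entry) (∑-*ˡ (𝟙 (C b)) (λ a → 𝟙 (A a ∧ M a b)))
    where
    regroup : ∀ s t u → s * (t * u) ≡ u * (s * t)
    regroup = solve-∀
    entry : ∀ a → 𝟙 (A a) * 𝟙 (M a b ∧ C b) ≡ 𝟙 (C b) * 𝟙 (A a ∧ M a b)
    entry a = trans (cong (𝟙 (A a) *_) (𝟙-∧ (M a b) (C b)))
                    (trans (regroup (𝟙 (A a)) (𝟙 (M a b)) (𝟙 (C b))) (cong (𝟙 (C b) *_) (sym (𝟙-∧ (A a) (M a b)))))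
  row : ∀ a → 𝟙 (A a) ≤ 𝟙 (A a) * # (λ b → M a b ∧ C b)
  row a with A a in Aa
  ... | false = z≤n
  ... | true  = ≤-trans (s≤s z≤n) (≤-trans (rows a Aa) (≤-reflexive (sym (+-identityʳ _))))
  many : # C * (h ^ t * m) < ∑ (λ b → 𝟙 (C b) * # (λ a → A a ∧ M a b))
  many = begin-strict
    # C * (h ^ t * m)                                            ≤⟨ *-monoˡ-≤ (h ^ t * m) C≤h ⟩
    h * (h ^ t * m)                                              ≡⟨ *-assoc h (h ^ t) m ⟨
    h * h ^ t * m                                                <⟨ lt ⟩
    # A                                                          ≤⟨ ∑-mono row ⟩
    ∑ (λ a → 𝟙 (A a) * # (λ b → M a b ∧ C b))                    ≡⟨ ∑-cong (λ a → sym (∑-*ˡ (𝟙 (A a)) (λ b → 𝟙 (M a b ∧ C b)))) ⟩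
    ∑ (λ a → ∑ (λ b → 𝟙 (A a) * 𝟙 (M a b ∧ C b)))                ≡⟨ ∑-comm (λ a b → 𝟙 (A a) * 𝟙 (M a b ∧ C b)) ⟩
    ∑ (λ b → ∑ (λ a → 𝟙 (A a) * 𝟙 (M a b ∧ C b)))                ≡⟨ ∑-cong swap ⟩
    ∑ (λ b → 𝟙 (C b) * # (λ a → A a ∧ M a b))                    ∎
... | b , Cb , large with kővári-sós-turán t M (λ a → A a ∧ M a b) (λ i → C i ∧ not (does (b Fin.≟ i))) h m
                          (≤-trans (#-mono (λ i eq → proj₁ (∧-true {C i} eq))) C≤h) rows′ large
  where
  rows′ : ∀ a → A a ∧ M a b ≡ true → t ≤ # (λ i → M a i ∧ (C i ∧ not (does (b Fin.≟ i))))
  rows′ a eq = s≤s⁻¹ (≤-trans (rows a (proj₁ (∧-true {A a} eq))) (≤-trans (#-remove (λ i → M a i ∧ C i) b)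
    (s≤s (≤-reflexive (∑-cong (λ i → cong 𝟙 (Bool.∧-assoc (M a i) (C i) _)))))))
...   | q , A′ , q-inj , Cq , m<A′ , A′⇒ = (b Vector.∷ q) , A′ , injective , C∋ , m<A′ , all
  where
  b≢q : ∀ i → b ≢ q i
  b≢q i b≡q with b Fin.≟ q i | Cq i
  ... | no b≢q | _   = b≢q b≡q
  ... | yes _  | eq with C (q i)
  b≢q i b≡q | yes _ | () | true
  b≢q i b≡q | yes _ | () | false
  injective : Injective _≡_ _≡_ (b Vector.∷ q)
  injective {zero}  {zero}  _  = refl
  injective {zero}  {suc j} eq = contradiction eq (b≢q j)
  injective {suc i} {zero}  eq = contradiction (sym eq) (b≢q i)
  injective {suc i} {suc j} eq = cong suc (q-inj eq)
  C∋ : ∀ i → C ((b Vector.∷ q) i) ≡ true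
  C∋ zero    = Cb
  C∋ (suc i) = proj₁ (∧-true {C (q i)} (Cq i))
  all : ∀ a → A′ a ≡ true → A a ≡ true × ∀ i → M a ((b Vector.∷ q) i) ≡ true
  all a A′a with A′⇒ a A′a
  ... | AMa , Mq = proj₁ (∧-true {A a} AMa) , λ { zero → proj₂ (∧-true {A a} AMa) ; (suc i) → Mq i }

-- One range of column degrees

∑-columns : ∀ {p n} (E : Fin p → Fin n → Bool) (B : Fin n → Bool) →
            ∑ (λ b → 𝟙 (B b) * # (λ a → E a b)) ≡ ∑ (λ a → # (λ b → E a b ∧ B b))
∑-columns E B = trans (∑-cong (λ b → sym (∑-*ˡ (𝟙 (B b)) (λ a → 𝟙 (E a b)))))
  (trans (∑-comm (λ b a → 𝟙 (B b) * 𝟙 (E a b)))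
         (∑-cong (λ a → ∑-cong (λ b → trans (*-comm (𝟙 (B b)) (𝟙 (E a b))) (sym (𝟙-∧ (E a b) (B b)))))))

-- The inverse probability of a column of degree c is N divided by the maximum of c and δ. The floor
-- δ keeps it bounded for sparse columns, and since the quotient is at least 1, rounding down loses
-- at most a factor 2.
quotient : ∀ N c δ → 0 < δ → c ≤ N → δ ≤ N → ∃ λ x → 1 ≤ x × x * c ≤ N × x * δ ≤ N × N ≤ x * ((c + δ) * 2)
quotient N c δ 0<δ c≤N δ≤N = x , x≥1 ,
  ≤-trans (*-monoʳ-≤ x (m≤m⊔n c δ)) xm≤N , ≤-trans (*-monoʳ-≤ x (m≤n⊔m c δ)) xm≤N , (begin
    N                        ≡⟨ m≡m%n+[m/n]*n N m ⟩
    N % m + x * m            ≤⟨ +-monoˡ-≤ (x * m) (<⇒≤ (m%n<n N m)) ⟩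
    m + x * m                ≤⟨ +-monoˡ-≤ (x * m) (m≤n*m m x {{>-nonZero x≥1}}) ⟩
    x * m + x * m            ≡⟨ double x m ⟩
    x * (m * 2)              ≤⟨ *-monoʳ-≤ x (*-monoˡ-≤ 2 (m⊔n≤m+n c δ)) ⟩
    x * ((c + δ) * 2)        ∎)
  where
  open ≤-Reasoning
  m = c ⊔ δ
  instance
    m≢0 : NonZero m
    m≢0 = >-nonZero (≤-trans 0<δ (m≤n⊔m c δ))
  x = N / m
  x≥1 : 1 ≤ x
  x≥1 = m≥n⇒m/n>0 (⊔-lub c≤N δ≤N)
  xm≤N : x * m ≤ N
  xm≤N = m/n*n≤m N m
  double : ∀ a b → a * b + a * b ≡ a * (b * 2)
  double = solve-∀

module DegreeRange
  {n : ℕ} (G : Graph n) {side : Fin n → Bool} {E : Fin n → Fin n → Bool} (bip : Bipartite G side E)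
  (d : ℕ) (rows≤d : ∀ a → # (E a) ≤ d) (κ : ℕ) {{_ : NonZero κ}} (t : ℕ) {{_ : NonZero t}}
  (s : ℕ) (d≤2^s : d * 4 ≤ 2 ^ s) (R≤2^s : κ * 512 * t ≤ 2 ^ s)
  (L : ℕ) (s≪L : s + (s + (s * 2 + s * 2 * (κ * 512)) * t) ≤ L)
  (B : Fin n → Bool)
  (2^L≤c : ∀ b → B b ≡ true → 2 ^ L ≤ # (λ a → E a b))
  (c≤2^[L+s] : ∀ b → B b ≡ true → # (λ a → E a b) ≤ 2 ^ (L + s)) where

  r = κ * 512
  R = r * t
  -- With `N = 2 ^ (L + s)` and the floor `2 ^ L₁` for column degrees, inverse probabilities are at
  -- most `2 ^ (s * 2)`, so the weight of a row with r entries is at most `2 ^ u`. The codegree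
  -- threshold `T` lies below `2 ^ L` by exactly this factor, and the bound `h` on the number of
  -- partners above the threshold results from it.
  u = s * 2 * r
  v = s * 2 + u
  L₁ = L ∸ s
  τ  = L ∸ u
  T  = 2 ^ τ
  h  = 2 ^ v

  r≤R : r ≤ R
  r≤R = m≤m*n r t

  t≤R : t ≤ R
  t≤R = m≤n*m t r {{m*n≢0 κ 512}}

  s+L₁≡L : s + L₁ ≡ L
  s+L₁≡L = m+[n∸m]≡n (≤-trans (m≤m+n s _) s≪L)

  u+τ≡L : u + τ ≡ L
  u+τ≡L = m+[n∸m]≡n (≤-trans (≤-trans (m≤n+m u (s * 2)) (m≤m*n v t)) (≤-trans (≤-trans (m≤n+m _ s) (m≤n+m _ s)) s≪L))

  h^t*t≤2^L₁ : h ^ t * t ≤ 2 ^ L₁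
  h^t*t≤2^L₁ = begin
    h ^ t * t              ≤⟨ *-monoʳ-≤ (h ^ t) (≤-trans t≤R R≤2^s) ⟩
    (2 ^ v) ^ t * 2 ^ s    ≡⟨ cong (_* 2 ^ s) (^-*-assoc 2 v t) ⟩
    2 ^ (v * t) * 2 ^ s    ≡⟨ ^-distribˡ-+-* 2 (v * t) s ⟨
    2 ^ (v * t + s)        ≤⟨ ^-monoʳ-≤ 2 (+-cancelˡ-≤ s _ _ (begin
        s + (v * t + s)    ≡⟨ cong (s +_) (+-comm (v * t) s) ⟩
        s + (s + v * t)    ≤⟨ s≪L ⟩
        L                  ≡⟨ s+L₁≡L ⟨
        s + L₁             ∎)) ⟩
    2 ^ L₁                 ∎
    where open ≤-Reasoning

  cancel-2^s : ∀ {x y} → 2 ^ L * x < 2 ^ s * y → 2 ^ L₁ * x < y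
  cancel-2^s {x} {y} lt = *-cancelˡ-< (2 ^ s) _ _ (subst (_< 2 ^ s * y)
    (trans (cong (λ l → 2 ^ l * x) (sym s+L₁≡L)) (trans (cong (_* x) (^-distribˡ-+-* 2 s L₁)) (*-assoc (2 ^ s) (2 ^ L₁) x))) lt)

  E₀ : Fin n → Fin n → Bool
  E₀ a b = E a b ∧ B b

  c : Fin n → ℕ
  c b = # (λ a → E a b)

  W = ∑ (λ b → 𝟙 (B b) * c b)

  2^L*B≤W : 2 ^ L * # B ≤ W
  2^L*B≤W = ≤-trans (≤-reflexive (sym (∑-*ˡ (2 ^ L) (𝟙 ∘ B)))) (∑-mono (λ b →
    ≤-trans (≤-reflexive (*-comm (2 ^ L) (𝟙 (B b)))) (𝟙-*-≤ (B b) (2^L≤c b))))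

  A₀ : Fin n → Bool
  A₀ a = does (R ≤? # (E₀ a))

  pick : ∀ a → ∃ λ g → g ⊆ E₀ a × # g ≡ R * 𝟙 (A₀ a)
  pick a = by-size (R ≤? # (E₀ a))
    where
    by-size : (R≤? : Dec (R ≤ # (E₀ a))) → ∃ λ g → g ⊆ E₀ a × # g ≡ R * 𝟙 (does R≤?)
    by-size (yes R≤) = let g , g⊆ , #g = select (E₀ a) R R≤ in g , g⊆ , trans #g (sym (*-identityʳ R))
    by-size (no _)   = (λ _ → false) , (λ _ ()) , trans (#-zero {n} (λ _ → false) (λ _ → refl)) (sym (*-zeroʳ R))

  E₁ : Fin n → Fin n → Bool
  E₁ a = proj₁ (pick a)

  E₁⊆E₀ : ∀ a → E₁ a ⊆ E₀ a
  E₁⊆E₀ a = proj₁ (proj₂ (pick a))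

  E₁⊆E : ∀ a → E₁ a ⊆ E a
  E₁⊆E a b eq = proj₁ (∧-true {E a b} (E₁⊆E₀ a b eq))

  E₁⊆B : ∀ a → E₁ a ⊆ B
  E₁⊆B a b eq = proj₂ (∧-true {E a b} (E₁⊆E₀ a b eq))

  #E₁ : ∀ a → # (E₁ a) ≡ R * 𝟙 (A₀ a)
  #E₁ a = proj₂ (proj₂ (pick a))

  #E₁≤R : ∀ a → # (E₁ a) ≤ R
  #E₁≤R a = ≤-trans (≤-reflexive (#E₁ a)) (≤-trans (*-monoʳ-≤ R (𝟙≤1 (A₀ a))) (≤-reflexive (*-identityʳ R)))

  W≤ : W ≤ n * R + # A₀ * d
  W≤ = begin
    W                                      ≡⟨ ∑-columns E B ⟩
    ∑ (λ a → # (E₀ a))                     ≤⟨ ∑-mono bound ⟩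
    ∑ (λ a → R + 𝟙 (A₀ a) * d)             ≡⟨ ∑-distrib-+ (λ _ → R) (λ a → 𝟙 (A₀ a) * d) ⟩
    ∑ {n} (λ _ → R) + ∑ (λ a → 𝟙 (A₀ a) * d)   ≡⟨ cong₂ _+_ (∑-const n R) (∑-*ʳ d (𝟙 ∘ A₀)) ⟩
    n * R + # A₀ * d                       ∎
    where
    open ≤-Reasoning
    bound : ∀ a → # (E₀ a) ≤ R + 𝟙 (A₀ a) * d
    bound a = by-size (R ≤? # (E₀ a))
      where
      by-size : (R≤? : Dec (R ≤ # (E₀ a))) → # (E₀ a) ≤ R + 𝟙 (does R≤?) * d
      by-size (yes _) = ≤-trans (≤-trans (#-mono (λ b eq → proj₁ (∧-true {E a b} eq))) (rows≤d a))
                          (≤-trans (≤-reflexive (sym (+-identityʳ d))) (m≤n+m (d + 0) R))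
      by-size (no R≰) = ≤-trans (≰⇒≥ R≰) (m≤m+n R 0)

  codegree : Fin n → Fin n → ℕ
  codegree b b′ = # (λ a → E₁ a b ∧ E₁ a b′)

  heavy : Fin n → Fin n → Bool
  heavy b b′ = not (does (b Fin.≟ b′)) ∧ does (T <? codegree b b′)

  heavy-sym : ∀ b b′ → heavy b b′ ≡ heavy b′ b
  heavy-sym b b′ = cong₂ (λ e m → not e ∧ does (T <? m)) ≟-sym (∑-cong (λ a → cong 𝟙 (Bool.∧-comm (E₁ a b) (E₁ a b′))))
    where
    ≟-sym : does (b Fin.≟ b′) ≡ does (b′ Fin.≟ b)
    ≟-sym with b Fin.≟ b′
    ... | yes b≡b′ = sym (dec-true (b′ Fin.≟ b) (sym b≡b′))
    ... | no  b≢b′ = sym (dec-false (b′ Fin.≟ b) (b≢b′ ∘ sym))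

  heavy-irrefl : ∀ b → heavy b b ≡ false
  heavy-irrefl b = cong (λ e → not e ∧ does (T <? codegree b b)) (dec-true (b Fin.≟ b) refl)

  -- The codegrees of `b` sum to at most `c b * R`, as each row through `b` has at most R entries,
  -- and every heavy partner uses more than T of this sum.
  #heavy≤h : ∀ b → B b ≡ true → # (heavy b) ≤ h
  #heavy≤h b Bb = *-cancelˡ-≤ T {{m^n≢0 2 τ}} (begin
    T * # (heavy b)                                      ≡⟨ ∑-*ˡ T (𝟙 ∘ heavy b) ⟨
    ∑ (λ b′ → T * 𝟙 (heavy b b′))                        ≤⟨ ∑-mono bound ⟩
    ∑ (λ b′ → codegree b b′)                             ≡⟨ ∑-comm (λ b′ a → 𝟙 (E₁ a b ∧ E₁ a b′)) ⟩
    ∑ (λ a → # (λ b′ → E₁ a b ∧ E₁ a b′))                ≡⟨ ∑-cong (λ a → trans (∑-cong (λ b′ → 𝟙-∧ (E₁ a b) (E₁ a b′))) (∑-*ˡ (𝟙 (E₁ a b)) (𝟙 ∘ E₁ a))) ⟩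
    ∑ (λ a → 𝟙 (E₁ a b) * # (E₁ a))                      ≤⟨ ∑-mono (λ a → *-mono-≤ (𝟙-mono (E₁⊆E a b)) (#E₁≤R a)) ⟩
    ∑ (λ a → 𝟙 (E a b) * R)                              ≡⟨ ∑-*ʳ R (λ a → 𝟙 (E a b)) ⟩
    c b * R                                              ≤⟨ *-mono-≤ (c≤2^[L+s] b Bb) R≤2^s ⟩
    2 ^ (L + s) * 2 ^ s                                  ≡⟨ ^-distribˡ-+-* 2 (L + s) s ⟨
    2 ^ (L + s + s)                                      ≡⟨ cong (2 ^_) (trans (cong (λ l → l + s + s) (sym u+τ≡L)) (regroup u τ s)) ⟩
    2 ^ (τ + v)                                          ≡⟨ ^-distribˡ-+-* 2 τ v ⟩
    T * h                                                ∎)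
    where
    open ≤-Reasoning
    regroup : ∀ x y z → x + y + z + z ≡ y + (z * 2 + x)
    regroup = solve-∀
    bound : ∀ b′ → T * 𝟙 (heavy b b′) ≤ codegree b b′
    bound b′ with heavy b b′ in eq
    ... | false = ≤-trans (≤-reflexive (*-zeroʳ T)) z≤n
    ... | true  = ≤-trans (≤-reflexive (*-identityʳ T))
                    (<⇒≤ (does-true (T <? codegree b b′) (proj₂ (∧-true {not (does (b Fin.≟ b′))} eq))))

  star : Fin n → Fin n → Bool
  star a b = E₁ a b ∧ does (t ≤? # (λ b′ → E₁ a b′ ∧ heavy b b′))

  record Row (a : Fin n) : Set where
    field
      entries     : Fin n → Bool
      good bad    : Bool
      entries⊆E₁  : entries ⊆ E₁ a
      #entries    : # entries ≡ r * 𝟙 good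
      independent : Independent heavy entries
      centre      : bad ≡ true → ∃ λ b → star a b ≡ true
      good+bad    : 𝟙 (A₀ a) ≤ 𝟙 good + 𝟙 bad

  none : ∀ {a} (bad : Bool) → (bad ≡ true → ∃ λ b → star a b ≡ true) → 𝟙 (A₀ a) ≤ 𝟙 bad → Row a
  none bad centre A₀≤ = record
    { entries = λ _ → false ; good = false ; bad = bad ; entries⊆E₁ = λ _ ()
    ; #entries = trans (#-zero {n} (λ _ → false) (λ _ → refl)) (sym (*-zeroʳ r))
    ; independent = λ _ _ () ; centre = centre ; good+bad = A₀≤ }

  row : ∀ a → Row a
  row a with A₀ a in A₀a
  ... | false = none false (λ ()) (≤-reflexive (cong 𝟙 A₀a))
  ... | true with independent-or-star heavy heavy-sym heavy-irrefl t r (E₁ a)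
                    (≤-reflexive (sym (trans (#E₁ a) (trans (cong (λ x → R * 𝟙 x) A₀a) (*-identityʳ R)))))
  ...   | inj₁ (g , g⊆E₁ , #g , indep) = record
    { entries = g ; good = true ; bad = false ; entries⊆E₁ = g⊆E₁
    ; #entries = trans #g (sym (*-identityʳ r)) ; independent = indep ; centre = λ () ; good+bad = 𝟙≤1 (A₀ a) }
  ...   | inj₂ (b , E₁ab , t≤) = none true (λ _ → b , ∧-intro E₁ab (dec-true (t ≤? _) t≤)) (𝟙≤1 (A₀ a))

  good : Fin n → Bool
  good a = Row.good (row a)

  bad : Fin n → Bool
  bad a = Row.bad (row a)

  -- Some column b is the centre of stars in more than `h ^ t * t` rows. All leaves of these stars
  -- lie among the at most h heavy partners of b, so t of the partners are common to more than t of
  -- the rows.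
  many-bad⇒K : 2 ^ L * # B < 2 ^ s * # bad → completeBipartite t t ⊑ G
  many-bad⇒K lt with pigeonhole B (λ b → # (λ a → star a b)) (h ^ t * t) (begin-strict
      # B * (h ^ t * t)                         ≤⟨ *-monoʳ-≤ (# B) h^t*t≤2^L₁ ⟩
      # B * 2 ^ L₁                              ≡⟨ *-comm (# B) (2 ^ L₁) ⟩
      2 ^ L₁ * # B                              <⟨ cancel-2^s lt ⟩
      # bad                                     ≤⟨ ∑-mono centres ⟩
      ∑ (λ a → ∑ (λ b → 𝟙 (B b) * 𝟙 (star a b)))  ≡⟨ ∑-comm (λ a b → 𝟙 (B b) * 𝟙 (star a b)) ⟩
      ∑ (λ b → ∑ (λ a → 𝟙 (B b) * 𝟙 (star a b)))  ≡⟨ ∑-cong (λ b → ∑-*ˡ (𝟙 (B b)) (λ a → 𝟙 (star a b))) ⟩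
      ∑ (λ b → 𝟙 (B b) * # (λ a → star a b))      ∎)
    where
    open ≤-Reasoning
    centres : ∀ a → 𝟙 (bad a) ≤ ∑ (λ b → 𝟙 (B b) * 𝟙 (star a b))
    centres a with bad a in eq
    ... | false = z≤n
    ... | true with Row.centre (row a) eq
    ...   | b , star-ab = ≤-trans (≤-reflexive (sym (cong₂ (λ x y → 𝟙 x * 𝟙 y) (E₁⊆B a b (proj₁ (∧-true {E₁ a b} star-ab))) star-ab)))
                            (f≤∑ (λ b → 𝟙 (B b) * 𝟙 (star a b)) b)
  ... | b , Bb , many with kővári-sós-turán t E₁ (λ a → star a b) (heavy b) h t (#heavy≤h b Bb)
                             (λ a eq → does-true (t ≤? _) (proj₂ (∧-true {E₁ a b} eq))) many
  ...   | q , A′ , q-inj , _ , t<A′ , A′⇒ with enumerate A′ t (<⇒≤ t<A′)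
  ...     | p , p-inj , A′p = completeBipartite-⊑ G {E = E₁} (λ a b eq → bip a b (E₁⊆E a b eq)) p q p-inj q-inj
                                (λ i j → proj₂ (A′⇒ (p i) (A′p i)) j)

  -- An instance of `Core` with δ = `2 ^ L₁`. The hypothesis, divided by `2 ^ s`, says that the good
  -- rows outnumber `2 ^ L₁ * # B`, so the floor adds little to the expected number of chosen
  -- columns.
  many-good⇒piece : 2 ^ L * # B < 2 ^ s * # good → HasPiece κ G
  many-good⇒piece lt = Core.core-piece E₂ good B (λ a b eq → E₁⊆B a b (E₂⊆E₁ a b eq)) r (λ a → Row.#entries (row a))
      N (2 ^ L₁) X T codegree₂ x (λ b → proj₁ (proj₂ (quot b))) x≤X
      (λ b → proj₁ (proj₂ (proj₂ (quot b)))) (λ b → proj₂ (proj₂ (proj₂ (proj₂ (quot b)))))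
      (begin
        # B * 2 ^ L₁     ≡⟨ *-comm (# B) (2 ^ L₁) ⟩
        2 ^ L₁ * # B     ≤⟨ <⇒≤ (cancel-2^s lt) ⟩
        # good           ≤⟨ m≤n*m (# good) r {{m*n≢0 κ 512}} ⟩
        r * # good       ∎)
      rXT≤N
      (≤-trans (*-monoʳ-≤ (X ^ r) (m≤m*n r T {{m^n≢0 2 τ}})) rXT≤N)
      {G = G} (λ a b eq → bip a b (E₁⊆E a b (E₂⊆E₁ a b eq))) κ refl
      (≤-<-trans z≤n (cancel-2^s lt)) (m^n>0 2 (L + s))
    where
    open ≤-Reasoning
    E₂ : Fin n → Fin n → Bool
    E₂ a = Row.entries (row a)
    E₂⊆E₁ : ∀ a → E₂ a ⊆ E₁ a
    E₂⊆E₁ a = Row.entries⊆E₁ (row a)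
    N = 2 ^ (L + s)
    X = 2 ^ (s * 2)
    c₂≤N : ∀ b → # (λ a → E₂ a b) ≤ N
    c₂≤N b with B b in Bb
    ... | true  = ≤-trans (#-mono (λ a eq → E₁⊆E a b (E₂⊆E₁ a b eq))) (c≤2^[L+s] b Bb)
    ... | false = ≤-trans (≤-reflexive (#-zero (λ a → E₂ a b) (λ a → not-true (λ eq → true≢false (E₁⊆B a b (E₂⊆E₁ a b eq)) Bb)))) z≤n
    quot : ∀ b → _
    quot b = quotient N (# (λ a → E₂ a b)) (2 ^ L₁) (m^n>0 2 L₁) (c₂≤N b)
               (^-monoʳ-≤ 2 (≤-trans (m≤n+m L₁ s) (≤-trans (≤-reflexive s+L₁≡L) (m≤m+n L s))))
    x : Fin n → ℕ
    x b = proj₁ (quot b)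
    x≤X : ∀ b → x b ≤ X
    x≤X b = *-cancelʳ-≤ (x b) X (2 ^ L₁) {{m^n≢0 2 L₁}} (begin
      x b * 2 ^ L₁          ≤⟨ proj₁ (proj₂ (proj₂ (proj₂ (quot b)))) ⟩
      2 ^ (L + s)           ≡⟨ cong (2 ^_) (trans (cong (_+ s) (sym s+L₁≡L)) (regroup s L₁)) ⟩
      2 ^ (s * 2 + L₁)      ≡⟨ ^-distribˡ-+-* 2 (s * 2) L₁ ⟩
      X * 2 ^ L₁            ∎)
      where
      regroup : ∀ y z → y + z + y ≡ y * 2 + z
      regroup = solve-∀
    rXT≤N : X ^ r * (r * T) ≤ N
    rXT≤N = begin
      X ^ r * (r * T)           ≤⟨ *-monoʳ-≤ (X ^ r) (*-monoˡ-≤ T (≤-trans r≤R R≤2^s)) ⟩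
      X ^ r * (2 ^ s * T)       ≡⟨ cong₂ _*_ (^-*-assoc 2 (s * 2) r) (sym (^-distribˡ-+-* 2 s τ)) ⟩
      2 ^ u * 2 ^ (s + τ)       ≡⟨ ^-distribˡ-+-* 2 u (s + τ) ⟨
      2 ^ (u + (s + τ))         ≡⟨ cong (2 ^_) (trans (regroup u s τ) (cong (_+ s) u+τ≡L)) ⟩
      2 ^ (L + s)               ∎
      where
      regroup : ∀ x y z → x + (y + z) ≡ x + z + y
      regroup = solve-∀
    -- Two columns of positive codegree in `E₂` lie in a common independent set, so the pair is not
    -- heavy in `E₁`, which contains `E₂`.
    codegree₂ : ∀ b b′ → b ≢ b′ → # (λ a → E₂ a b ∧ E₂ a b′) ≤ T
    codegree₂ b b′ b≢b′ with 0 <? # (λ a → E₂ a b ∧ E₂ a b′)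
    ... | no none = ≤-trans (≮⇒≥ none) z≤n
    ... | yes some with 0<#⇒∃ (λ a → E₂ a b ∧ E₂ a b′) some
    ...   | a , eq with ∧-true {E₂ a b} eq
    ...     | E₂ab , E₂ab′ = ≤-trans
      (#-mono (λ a eq → let p , q = ∧-true {E₂ a b} eq in ∧-intro (E₂⊆E₁ a b p) (E₂⊆E₁ a b′ q)))
      (≮⇒≥ (does-false (T <? codegree b b′) light))
      where
      light : does (T <? codegree b b′) ≡ false
      light = not-true (λ eq → true≢false (∧-intro (cong not (dec-false (b Fin.≟ b′) b≢b′)) eq)
                                          (Row.independent (row a) b b′ E₂ab E₂ab′))

  result : HasPiece κ G ⊎ (completeBipartite t t ⊑ G) ⊎ W ≤ n * (R * 2)
  result with W ≤? n * (R * 2)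
  ... | yes W≤ = inj₂ (inj₂ W≤)
  ... | no W≰ = choose (# A₀ ≤? # good * 2)
    where
    open ≤-Reasoning
    -- If `W` exceeds `n * (R * 2)`, rows with fewer than R entries in the range account for less
    -- than half of it, so more than `W` / (2d) rows are in `A₀`. Half of these are good or half are
    -- bad, which makes the total loss 4d, the quantity that `2 ^ s` dominates.
    2^L*B< : 2 ^ L * # B < # A₀ * (d * 2)
    2^L*B< = ≤-<-trans 2^L*B≤W (+-cancelˡ-< W _ _ (begin-strict
      W + W                               ≤⟨ +-mono-≤ W≤ W≤ ⟩
      n * R + # A₀ * d + (n * R + # A₀ * d) ≡⟨ regroup n R (# A₀) d ⟩
      n * (R * 2) + # A₀ * (d * 2)        <⟨ +-monoˡ-< (# A₀ * (d * 2)) (≰⇒> W≰) ⟩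
      W + # A₀ * (d * 2)                  ∎))
      where
      regroup : ∀ x y z w → x * y + z * w + (x * y + z * w) ≡ x * (y * 2) + z * (w * 2)
      regroup = solve-∀
    half : ∀ m → # A₀ ≤ m * 2 → 2 ^ L * # B < 2 ^ s * m
    half m A₀≤ = begin-strict
      2 ^ L * # B        <⟨ 2^L*B< ⟩
      # A₀ * (d * 2)     ≤⟨ *-monoˡ-≤ (d * 2) A₀≤ ⟩
      m * 2 * (d * 2)    ≡⟨ regroup m d ⟩
      d * 4 * m          ≤⟨ *-monoˡ-≤ m d≤2^s ⟩
      2 ^ s * m          ∎
      where
      regroup : ∀ x y → x * 2 * (y * 2) ≡ y * 4 * x
      regroup = solve-∀
    A₀≤good+bad : # A₀ ≤ # good + # bad
    A₀≤good+bad = ≤-trans (∑-mono (λ a → Row.good+bad (row a))) (≤-reflexive (∑-distrib-+ (𝟙 ∘ good) (𝟙 ∘ bad)))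
    choose : Dec (# A₀ ≤ # good * 2) → _
    choose (yes A₀≤) = inj₁ (many-good⇒piece (half (# good) A₀≤))
    choose (no A₀≰)  = inj₂ (inj₁ (many-bad⇒K (half (# bad) (+-cancelˡ-≤ (# A₀) _ _ (begin
      # A₀ + # A₀                           ≤⟨ +-mono-≤ A₀≤good+bad A₀≤good+bad ⟩
      # good + # bad + (# good + # bad)     ≡⟨ regroup (# good) (# bad) ⟩
      # good * 2 + # bad * 2                ≤⟨ +-monoˡ-≤ (# bad * 2) (≰⇒≥ A₀≰) ⟩
      # A₀ + # bad * 2                      ∎)))))
      where
      regroup : ∀ x y → x + y + (x + y) ≡ x * 2 + y * 2
      regroup = solve-∀

-- Summation over all degree ranges

module Ranges
  {n : ℕ} (G : Graph n) {side : Fin n → Bool} {E : Fin n → Fin n → Bool} (bip : Bipartite G side E)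
  (d : ℕ) (rows≤d : ∀ a → # (E a) ≤ d) (κ : ℕ) {{_ : NonZero κ}} (t : ℕ) {{_ : NonZero t}} where

  Outcome : Set → Set₁
  Outcome X = (HasPiece κ G ⊎ (completeBipartite t t ⊑ G)) ⊎ X

  c : Fin n → ℕ
  c b = # (λ a → E a b)

  k = κ * 64
  r = κ * 512
  R = r * t

  below : ℕ → Fin n → Bool
  below m b = does (c b <? m)

  W : ℕ → ℕ
  W m = ∑ (λ b → 𝟙 (below m b) * c b)

  between : ℕ → ℕ → Fin n → Bool
  between m m′ b = below m′ b ∧ not (below m b)

  between⇒ : ∀ m m′ b → between m m′ b ≡ true → m ≤ c b × c b ≤ m′
  between⇒ m m′ b eq with ∧-true {below m′ b} eq
  ... | <m′ , ≮m = ≮⇒≥ (does-false (c b <? m) (trans (sym (Bool.not-involutive _)) (cong not ≮m))) , <⇒≤ (does-true (c b <? m′) <m′)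

  below-split : ∀ {m m′} → m ≤ m′ → ∀ b → 𝟙 (below m′ b) ≡ 𝟙 (below m b) + 𝟙 (between m m′ b)
  below-split {m} {m′} m≤m′ b = trans (𝟙-split (below m′ b) (below m b)) (cong (λ x → 𝟙 x + 𝟙 (between m m′ b)) absorb)
    where
    absorb : below m′ b ∧ below m b ≡ below m b
    absorb with below m b in eq
    ... | false = Bool.∧-zeroʳ (below m′ b)
    ... | true  = ∧-intro (dec-true (c b <? m′) (<-≤-trans (does-true (c b <? m) eq) m≤m′)) refl

  W-split : ∀ {m m′} → m ≤ m′ → W m′ ≡ W m + ∑ (λ b → 𝟙 (between m m′ b) * c b)
  W-split {m} {m′} m≤m′ = trans
    (∑-cong (λ b → trans (cong (_* c b) (below-split m≤m′ b)) (*-distribʳ-+ (c b) (𝟙 (below m b)) (𝟙 (between m m′ b)))))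
    (∑-distrib-+ (λ b → 𝟙 (below m b) * c b) (λ b → 𝟙 (between m m′ b) * c b))

  -- When `cover` gives no piece, the covering rows and saturated columns hold at most
  -- `# A * (d + 2 * m)` entries, and 63 `# A` is at most `# B`. Because column degrees are at least
  -- m, `# B * (2 * m)` is at most 2V and is absorbed by the left side, where 61 of the 63 remain.
  dyadic : ∀ m (B : Fin n → Bool) → (∀ b → B b ≡ true → m ≤ c b × c b ≤ 2 * m) →
           Outcome (∑ (λ b → 𝟙 (B b) * c b) * 61 ≤ # B * d + n * (k * 63))
  dyadic m B range with cover G {E = λ a b → E a b ∧ B b} (λ a b eq → bip a b (proj₁ (∧-true {E a b} eq))) B (λ a b eq → proj₂ (∧-true {E a b} eq)) κ
  ... | inj₁ piece = inj₁ (inj₁ piece)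
  ... | inj₂ (A , S , A≤B , S≤A , few) = inj₂ (+-cancelˡ-≤ (V * 2) _ _ (begin
    V * 2 + V * 61                                             ≡⟨ *-distribˡ-+ V 2 61 ⟨
    V * 63                                                     ≤⟨ *-monoˡ-≤ 63 V≤ ⟩
    (# A * (d + 2 * m) + n * k) * 63                           ≡⟨ regroup₁ (# A) (d + 2 * m) n k 63 ⟩
    # A * 63 * (d + 2 * m) + n * (k * 63)                      ≤⟨ +-monoˡ-≤ _ (*-monoˡ-≤ (d + 2 * m) A≤B) ⟩
    # B * (d + 2 * m) + n * (k * 63)                           ≡⟨ regroup₂ (# B) d m (n * (k * 63)) ⟩
    # B * m * 2 + (# B * d + n * (k * 63))                     ≤⟨ +-monoˡ-≤ _ (*-monoˡ-≤ 2 (≤-trans (≤-reflexive (sym (∑-*ʳ m (𝟙 ∘ B)))) (∑-mono (λ b → 𝟙-*-≤ (B b) (proj₁ ∘ range b))))) ⟩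
    V * 2 + (# B * d + n * (k * 63))                           ∎))
    where
    open ≤-Reasoning
    V = ∑ (λ b → 𝟙 (B b) * c b)
    regroup₁ : ∀ a x y z w → (a * x + y * z) * w ≡ a * w * x + y * (z * w)
    regroup₁ = solve-∀
    regroup₂ : ∀ b x y z → b * (x + 2 * y) + z ≡ b * y * 2 + (b * x + z)
    regroup₂ = solve-∀
    regroup₃ : ∀ x y z w → x * y + x * z + w ≡ x * (y + z) + w
    regroup₃ = solve-∀
    E₀ : Fin n → Fin n → Bool
    E₀ a b = E a b ∧ B b
    row : ∀ a → # (E₀ a) ≤ 𝟙 (A a) * d + # (λ b → E₀ a b ∧ S b) + k
    row a with A a in Aa
    ... | true  = ≤-trans (≤-trans (#-mono (λ b eq → proj₁ (∧-true {E a b} eq))) (rows≤d a))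
                    (≤-trans (≤-reflexive (sym (+-identityʳ d))) (≤-trans (m≤m+n (d + 0) _) (m≤m+n _ k)))
    ... | false = ≤-trans (≤-reflexive (trans (∑-cong (λ b → 𝟙-split (E₀ a b) (S b))) (∑-distrib-+ (λ b → 𝟙 (E₀ a b ∧ S b)) (λ b → 𝟙 (E₀ a b ∧ not (S b))))))
                    (+-monoʳ-≤ _ (few a Aa))
    S-columns : ∑ (λ a → # (λ b → E₀ a b ∧ S b)) ≤ # S * (2 * m)
    S-columns = begin
      ∑ (λ a → # (λ b → E₀ a b ∧ S b))              ≡⟨ ∑-cong (λ a → ∑-cong (λ b → cong 𝟙 (Bool.∧-assoc (E a b) (B b) (S b)))) ⟩
      ∑ (λ a → # (λ b → E a b ∧ (B b ∧ S b)))       ≡⟨ ∑-columns E (λ b → B b ∧ S b) ⟨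
      ∑ (λ b → 𝟙 (B b ∧ S b) * c b)                 ≤⟨ ∑-mono (λ b → 𝟙-*-≤ (B b ∧ S b) (λ eq → proj₂ (range b (proj₁ (∧-true {B b} eq))))) ⟩
      ∑ (λ b → 𝟙 (B b ∧ S b) * (2 * m))             ≡⟨ ∑-*ʳ (2 * m) (λ b → 𝟙 (B b ∧ S b)) ⟩
      # (λ b → B b ∧ S b) * (2 * m)                 ≤⟨ *-monoˡ-≤ (2 * m) (#-mono (λ b eq → proj₂ (∧-true {B b} eq))) ⟩
      # S * (2 * m)                                 ∎
    V≤ : V ≤ # A * (d + 2 * m) + n * k
    V≤ = begin
      V                                                                         ≡⟨ ∑-columns E B ⟩
      ∑ (λ a → # (E₀ a))                                                        ≤⟨ ∑-mono row ⟩
      ∑ (λ a → 𝟙 (A a) * d + # (λ b → E₀ a b ∧ S b) + k)                        ≡⟨ trans (∑-distrib-+ (λ a → 𝟙 (A a) * d + # (λ b → E₀ a b ∧ S b)) (λ _ → k)) (cong₂ _+_ (trans (∑-distrib-+ (λ a → 𝟙 (A a) * d) (λ a → # (λ b → E₀ a b ∧ S b))) (cong (_+ ∑ (λ a → # (λ b → E₀ a b ∧ S b))) (∑-*ʳ d (𝟙 ∘ A)))) (∑-const n k)) ⟩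
      # A * d + ∑ (λ a → # (λ b → E₀ a b ∧ S b)) + n * k                        ≤⟨ +-monoˡ-≤ (n * k) (+-monoʳ-≤ (# A * d) (≤-trans S-columns (*-monoˡ-≤ (2 * m) S≤A))) ⟩
      # A * d + # A * (2 * m) + n * k                                           ≡⟨ regroup₃ (# A) d (2 * m) (n * k) ⟩
      # A * (d + 2 * m) + n * k                                                 ∎

  -- The ranges are disjoint, so the terms `# B * d` add up to one term for all columns below; only
  -- `n * (k * 63)` is paid anew for each range.
  low : ∀ H → Outcome (W (2 ^ H) * 61 ≤ # (below (2 ^ H)) * d + H * (n * (k * 63)))
  low zero = inj₂ (≤-trans (≤-reflexive (cong (_* 61) (∑-zero isolated))) z≤n)
    where
    isolated : ∀ b → 𝟙 (below 1 b) * c b ≡ 0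
    isolated b with below 1 b in eq
    ... | false = refl
    ... | true  = trans (+-identityʳ (c b)) (n<1⇒n≡0 (does-true (c b <? 1) eq))
  low (suc H) with low H | dyadic (2 ^ H) (between (2 ^ H) (2 ^ suc H)) (between⇒ (2 ^ H) (2 ^ suc H))
  ... | inj₁ found | _          = inj₁ found
  ... | inj₂ _     | inj₁ found = inj₁ found
  ... | inj₂ IH    | inj₂ step  = inj₂ (begin
    W m′ * 61                                                       ≡⟨ cong (_* 61) (W-split m≤m′) ⟩
    (W m + ∑ (λ b → 𝟙 (between m m′ b) * c b)) * 61                 ≡⟨ *-distribʳ-+ 61 (W m) _ ⟩
    W m * 61 + ∑ (λ b → 𝟙 (between m m′ b) * c b) * 61              ≤⟨ +-mono-≤ IH step ⟩
    # (below m) * d + H * X + (# (between m m′) * d + X)            ≡⟨ regroup (# (below m)) d (H * X) (# (between m m′)) X ⟩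
    (# (below m) + # (between m m′)) * d + (X + H * X)              ≡⟨ cong (λ x → x * d + (X + H * X)) (trans (∑-cong (below-split m≤m′)) (∑-distrib-+ (𝟙 ∘ below m) (𝟙 ∘ between m m′))) ⟨
    # (below m′) * d + suc H * X                                    ∎)
    where
    open ≤-Reasoning
    m  = 2 ^ H
    m′ = 2 ^ suc H
    X  = n * (k * 63)
    m≤m′ : m ≤ m′
    m≤m′ = m≤m+n m (m + 0)
    regroup : ∀ x d y z w → x * d + y + (z * d + w) ≡ (x + z) * d + (w + y)
    regroup = solve-∀

  -- `Q` is a ratio L / s from which on a range of exponents from L to L + s is narrow enough for
  -- `DegreeRange`.
  module _ (Q : ℕ) (≤Q : 2 + (2 + 2 * r) * t ≤ Q) where

    slab : ℕ
    slab = n * (R * 2)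

    steps : ∀ s → d * 4 ≤ 2 ^ s → R ≤ 2 ^ s → ∀ j → Outcome (W (2 ^ (s * (Q + j))) ≤ W (2 ^ (s * Q)) + j * slab)
    steps s d≤ R≤ zero = inj₂ (≤-reflexive (trans (cong (λ q → W (2 ^ (s * q))) (+-identityʳ Q)) (sym (+-identityʳ _))))
    steps s d≤ R≤ (suc j) with steps s d≤ R≤ j
      | DegreeRange.result G bip d rows≤d κ t s d≤ R≤ L s≪L (between (2 ^ L) (2 ^ (L + s)))
          (λ b eq → proj₁ (between⇒ (2 ^ L) (2 ^ (L + s)) b eq)) (λ b eq → proj₂ (between⇒ (2 ^ L) (2 ^ (L + s)) b eq))
      where
      L = s * (Q + j)
      regroup : ∀ s r t → s + (s + (s * 2 + s * 2 * r) * t) ≡ s * (2 + (2 + 2 * r) * t)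
      regroup = solve-∀
      s≪L : s + (s + (s * 2 + s * 2 * r) * t) ≤ L
      s≪L = ≤-trans (≤-reflexive (regroup s r t)) (*-monoʳ-≤ s (≤-trans ≤Q (m≤m+n Q j)))
    ... | inj₁ found | _                  = inj₁ found
    ... | inj₂ _     | inj₁ piece         = inj₁ (inj₁ piece)
    ... | inj₂ _     | inj₂ (inj₁ K⊑G)    = inj₁ (inj₂ K⊑G)
    ... | inj₂ IH    | inj₂ (inj₂ step)   = inj₂ (begin
      W (2 ^ (s * (Q + suc j)))             ≡⟨ cong (λ l → W (2 ^ l)) (next s Q j) ⟩
      W (2 ^ (L + s))                       ≡⟨ W-split (^-monoʳ-≤ 2 (m≤m+n L s)) ⟩
      W (2 ^ L) + ∑ (λ b → 𝟙 (between (2 ^ L) (2 ^ (L + s)) b) * c b)   ≤⟨ +-mono-≤ IH step ⟩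
      W (2 ^ (s * Q)) + j * slab + slab     ≡⟨ regroup (W (2 ^ (s * Q))) (j * slab) slab ⟩
      W (2 ^ (s * Q)) + (slab + j * slab)   ∎)
      where
      open ≤-Reasoning
      L = s * (Q + j)
      next : ∀ s q j → s * (q + (1 + j)) ≡ s * (q + j) + s
      next = solve-∀
      regroup : ∀ x y z → x + y + z ≡ x + (z + y)
      regroup = solve-∀

    -- Q ranges of width s lead from the exponent s Q to 2 s Q, where the doubled width is
    -- admissible. Hence m rounds of Q ranges each reach `2 ^ m * s * Q`, and m of order log log n
    -- is enough for all degrees up to n.
    doublings : ∀ m s → d * 4 ≤ 2 ^ s → R ≤ 2 ^ s → Outcome (W (2 ^ (2 ^ m * s * Q)) ≤ W (2 ^ (s * Q)) + m * (Q * slab))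
    doublings zero s _ _ = inj₂ (≤-reflexive (trans (cong (λ l → W (2 ^ (l * Q))) (+-identityʳ s)) (sym (+-identityʳ _))))
    doublings (suc m) s d≤ R≤ with steps s d≤ R≤ Q | doublings m (s * 2) (≤-trans d≤ grow) (≤-trans R≤ grow)
      where
      grow : 2 ^ s ≤ 2 ^ (s * 2)
      grow = ^-monoʳ-≤ 2 (m≤m*n s 2)
    ... | inj₁ found | _          = inj₁ found
    ... | inj₂ _     | inj₁ found = inj₁ found
    ... | inj₂ first | inj₂ IH    = inj₂ (begin
      W (2 ^ (2 * 2 ^ m * s * Q))                       ≡⟨ cong (λ l → W (2 ^ (l * Q))) (regroup₁ (2 ^ m) s) ⟩
      W (2 ^ (2 ^ m * (s * 2) * Q))                     ≤⟨ IH ⟩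
      W (2 ^ (s * 2 * Q)) + m * (Q * slab)              ≡⟨ cong (λ l → W (2 ^ l) + m * (Q * slab)) (regroup₂ s Q) ⟩
      W (2 ^ (s * (Q + Q))) + m * (Q * slab)            ≤⟨ +-monoˡ-≤ (m * (Q * slab)) first ⟩
      W (2 ^ (s * Q)) + Q * slab + m * (Q * slab)       ≡⟨ +-assoc (W (2 ^ (s * Q))) (Q * slab) (m * (Q * slab)) ⟩
      W (2 ^ (s * Q)) + suc m * (Q * slab)              ∎)
      where
      open ≤-Reasoning
      regroup₁ : ∀ x y → 2 * x * y ≡ x * (y * 2)
      regroup₁ = solve-∀
      regroup₂ : ∀ x y → x * 2 * y ≡ x * (y + y)
      regroup₂ = solve-∀

    -- In the inequality multiplied by 4 · 61, the low ranges contribute at most (4 + 16) n d and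
    -- the others at most 16 n d: 36 against 61. The factors 16 in the hypotheses are chosen for
    -- this, using 4 · 63 ≤ 16 · 16 and 4 · 61 ≤ 16 · 16.
    total : ∀ m s → d * 4 ≤ 2 ^ s → R ≤ 2 ^ s → (∀ b → c b < 2 ^ (2 ^ m * s * Q)) →
            s * Q * k * 16 ≤ d → m * (Q * (R * 2)) * 16 ≤ d → n * d ≤ ∑ c * 4 → 0 < n * d →
            HasPiece κ G ⊎ (completeBipartite t t ⊑ G)
    total m s d≤ R≤ c< low≤d high≤d nd≤ 0<nd with low (s * Q) | doublings m s d≤ R≤
    ... | inj₁ found | _          = found
    ... | inj₂ _     | inj₁ found = found
    ... | inj₂ lows  | inj₂ highs = contradiction (begin
      n * d * 61                                                         ≤⟨ *-monoˡ-≤ 61 nd≤ ⟩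
      ∑ c * 4 * 61                                                       ≡⟨ cong (λ w → w * 4 * 61) all ⟨
      W (2 ^ (2 ^ m * s * Q)) * 4 * 61                                   ≤⟨ *-monoˡ-≤ 61 (*-monoˡ-≤ 4 highs) ⟩
      (w + m * (Q * (n * (R * 2)))) * 4 * 61                             ≡⟨ regroup₁ w m Q n (R * 2) 4 61 ⟩
      w * 61 * 4 + n * (m * (Q * (R * 2)) * 244)                         ≤⟨ +-mono-≤ (*-monoˡ-≤ 4 (≤-trans lows (+-monoˡ-≤ _ (*-monoˡ-≤ d (#≤n (below (2 ^ (s * Q)))))))) (*-monoʳ-≤ n (≤-trans (*-monoʳ-≤ (m * (Q * (R * 2))) (≤ᵇ⇒≤ 244 256 _)) (≤-trans (≤-reflexive (sym (*-assoc (m * (Q * (R * 2))) 16 16))) (*-monoˡ-≤ 16 high≤d)))) ⟩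
      (n * d + s * Q * (n * (k * 63))) * 4 + n * (d * 16)                ≡⟨ regroup₂ n d (s * Q) k 63 4 16 ⟩
      n * d * 20 + n * (s * Q * k * 252)                                 ≤⟨ +-monoʳ-≤ (n * d * 20) (*-monoʳ-≤ n (≤-trans (*-monoʳ-≤ (s * Q * k) (≤ᵇ⇒≤ 252 256 _)) (≤-trans (≤-reflexive (sym (*-assoc (s * Q * k) 16 16))) (*-monoˡ-≤ 16 low≤d)))) ⟩
      n * d * 20 + n * (d * 16)                                          ≡⟨ regroup₃ n d 20 16 ⟩
      n * d * 36                                                         ∎)
      (<⇒≱ (*-monoʳ-< (n * d) {{>-nonZero 0<nd}} (<ᵇ⇒< 36 61 _)))
      where
      open ≤-Reasoning
      w = W (2 ^ (s * Q))
      all : W (2 ^ (2 ^ m * s * Q)) ≡ ∑ c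
      all = ∑-cong (λ b → trans (cong (λ x → 𝟙 x * c b) (dec-true (c b <? 2 ^ (2 ^ m * s * Q)) (c< b))) (+-identityʳ (c b)))
      regroup₁ : ∀ w m q n r i j → (w + m * (q * (n * r))) * i * j ≡ w * j * i + n * (m * (q * r) * (i * j))
      regroup₁ = solve-∀
      regroup₂ : ∀ n d x k i j l → (n * d + x * (n * (k * i))) * j + n * (d * l) ≡ n * d * (j + l) + n * (x * k * (i * j))
      regroup₂ = solve-∀
      regroup₃ : ∀ n d i j → n * d * i + n * (d * j) ≡ n * d * (i + j)
      regroup₃ = solve-∀

-- Directed cuts: a uniformly random side keeps each arc with probability 1/4

two : ∀ {n} → Fin n → ℕ
two _ = 2

1≤two : ∀ {n} (b : Fin n) → 1 ≤ two b
1≤two _ = s≤s z≤n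

𝔼-nonmember : ∀ {n} (v : Fin n) → 𝔼 two (λ S → 𝟙 (not (S v))) * 2 ≡ ∏ (two {n})
𝔼-nonmember {n} v = +-cancelˡ-≡ (∏ (two {n})) _ _ (begin
  Z + p̄ * 2           ≡⟨ cong (_+ p̄ * 2) (𝔼-member two 1≤two v) ⟨
  2 * p + p̄ * 2       ≡⟨ regroup p p̄ ⟩
  (p + p̄) * 2         ≡⟨ cong (_* 2) (trans (sym (𝔼-+ two (λ S → 𝟙 (S v)) (λ S → 𝟙 (not (S v))))) (trans (𝔼-cong {n} two (λ S → either (S v))) (𝔼-one {n} two 1≤two))) ⟩
  Z * 2               ≡⟨ double Z ⟩
  Z + Z               ∎)
  where
  open ≡-Reasoning
  Z = ∏ (two {n})
  p = 𝔼 {n} two (λ S → 𝟙 (S v))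
  p̄ = 𝔼 {n} two (λ S → 𝟙 (not (S v)))
  either : ∀ s → 𝟙 s + 𝟙 (not s) ≡ 1
  either true  = refl
  either false = refl
  regroup : ∀ x y → 2 * x + y * 2 ≡ (x + y) * 2
  regroup = solve-∀
  double : ∀ x → x * 2 ≡ x + x
  double = solve-∀

𝔼-separated : ∀ {n} (u v : Fin n) → u ≢ v → 𝔼 two (λ S → 𝟙 (S u ∧ not (S v))) * 4 ≡ ∏ (two {n})
𝔼-separated {suc n} zero    zero    u≢v = contradiction refl u≢v
𝔼-separated {suc n} zero    (suc v) u≢v = begin
  (p̄ + 1 * 𝔼 {n} two (λ _ → 0)) * 4   ≡⟨ cong (λ z → (p̄ + 1 * z) * 4) (𝔼-zero {n} two) ⟩
  (p̄ + 0) * 4                         ≡⟨ regroup p̄ ⟩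
  2 * (p̄ * 2)                         ≡⟨ cong (2 *_) (𝔼-nonmember v) ⟩
  2 * ∏ (two {n})                     ∎
  where
  open ≡-Reasoning
  p̄ = 𝔼 {n} two (λ S → 𝟙 (not (S v)))
  regroup : ∀ x → (x + 0) * 4 ≡ 2 * (x * 2)
  regroup = solve-∀
𝔼-separated {suc n} (suc u) zero    u≢v = begin
  (𝔼 {n} two (λ S → 𝟙 (S u ∧ false)) + 1 * 𝔼 {n} two (λ S → 𝟙 (S u ∧ true))) * 4
    ≡⟨ cong₂ (λ x y → (x + 1 * y) * 4) (trans (𝔼-cong {n} two (λ S → cong 𝟙 (Bool.∧-zeroʳ (S u)))) (𝔼-zero {n} two)) (𝔼-cong {n} two (λ S → cong 𝟙 (Bool.∧-identityʳ (S u)))) ⟩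
  (0 + 1 * p) * 4                     ≡⟨ regroup p ⟩
  2 * (2 * p)                         ≡⟨ cong (2 *_) (𝔼-member two 1≤two u) ⟩
  2 * ∏ (two {n})                     ∎
  where
  open ≡-Reasoning
  p = 𝔼 {n} two (λ S → 𝟙 (S u))
  regroup : ∀ x → (0 + 1 * x) * 4 ≡ 2 * (2 * x)
  regroup = solve-∀
𝔼-separated {suc n} (suc u) (suc v) u≢v = trans (regroup (𝔼 {n} two (λ S → 𝟙 (S u ∧ not (S v))))) (cong (2 *_) (𝔼-separated u v (u≢v ∘ cong suc)))
  where
  regroup : ∀ x → (x + 1 * x) * 4 ≡ 2 * (x * 4)
  regroup = solve-∀

directed-cut : ∀ {n} (O : Fin n → Fin n → Bool) → (∀ v → O v v ≡ false) →
               ∃ λ side → ∑ (λ u → # (O u)) ≤ ∑ (λ u → # (λ v → O u v ∧ (side u ∧ not (side v)))) * 4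
directed-cut {n} O irrefl = by-size (∑ (λ u → # (O u))) refl
  where
  Z = ∏ (two {n})
  cut : (Fin n → Bool) → ℕ
  cut S = ∑ (λ u → # (λ v → O u v ∧ (S u ∧ not (S v))))
  0<Z : 0 < Z
  0<Z = ≤-trans (≤-reflexive (sym (∏-one {n} (λ _ → refl)))) (∏-mono {n} 1≤two)
  arc : ∀ u v → 𝔼 two (λ S → 𝟙 (O u v ∧ (S u ∧ not (S v)))) * 4 ≡ 𝟙 (O u v) * Z
  arc u v with O u v in Ouv
  ... | false = cong (_* 4) (𝔼-zero {n} two)
  ... | true  = trans (𝔼-separated u v (λ { refl → true≢false Ouv (irrefl u) })) (sym (+-identityʳ Z))
  𝔼-cut : 𝔼 two cut * 4 ≡ ∑ (λ u → # (O u)) * Z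
  𝔼-cut = begin
    𝔼 two cut * 4                                                               ≡⟨ cong (_* 4) (trans (𝔼-∑ two (λ u S → # (λ v → O u v ∧ (S u ∧ not (S v))))) (∑-cong (λ u → 𝔼-∑ two (λ v S → 𝟙 (O u v ∧ (S u ∧ not (S v))))))) ⟩
    ∑ (λ u → ∑ (λ v → 𝔼 two (λ S → 𝟙 (O u v ∧ (S u ∧ not (S v)))))) * 4          ≡⟨ trans (sym (∑-*ʳ 4 (λ u → ∑ (λ v → 𝔼 two (λ S → 𝟙 (O u v ∧ (S u ∧ not (S v)))))))) (∑-cong (λ u → sym (∑-*ʳ 4 (λ v → 𝔼 two (λ S → 𝟙 (O u v ∧ (S u ∧ not (S v)))))))) ⟩
    ∑ (λ u → ∑ (λ v → 𝔼 two (λ S → 𝟙 (O u v ∧ (S u ∧ not (S v)))) * 4))          ≡⟨ ∑-cong (λ u → trans (∑-cong (arc u)) (∑-*ʳ Z (𝟙 ∘ O u))) ⟩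
    ∑ (λ u → # (O u) * Z)                                                       ≡⟨ ∑-*ʳ Z (λ u → # (O u)) ⟩
    ∑ (λ u → # (O u)) * Z                                                       ∎
    where open ≡-Reasoning
  by-size : ∀ m → ∑ (λ u → # (O u)) ≡ m → ∃ λ side → m ≤ cut side * 4
  by-size zero    _  = (λ _ → false) , z≤n
  -- `𝔼-<⇒∃` works with a strict inequality. The constant `m` is one less than the number of arcs,
  -- so a cut strictly above it loses nothing.
  by-size (suc m) eq = let S , lt = 𝔼-<⇒∃ two (λ _ → m) (λ S → 4 * cut S) smaller in S , ≤-trans lt (≤-reflexive (*-comm 4 (cut S)))
    where
    open ≤-Reasoning
    smaller : 𝔼 {n} two (λ _ → m) < 𝔼 {n} two (λ S → 4 * cut S)
    smaller = begin-strict
      𝔼 {n} two (λ _ → m)           ≡⟨ 𝔼-cong {n} two (λ _ → sym (*-identityʳ m)) ⟩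
      𝔼 {n} two (λ _ → m * 1)       ≡⟨ trans (𝔼-*ˡ {n} two m (λ _ → 1)) (cong (m *_) (𝔼-one {n} two 1≤two)) ⟩
      m * Z                         <⟨ +-monoˡ-≤ (m * Z) 0<Z ⟩
      suc m * Z                     ≡⟨ trans (cong (_* Z) (sym eq)) (sym 𝔼-cut) ⟩
      𝔼 two cut * 4                 ≡⟨ *-comm (𝔼 two cut) 4 ⟩
      4 * 𝔼 two cut                 ≡⟨ 𝔼-*ˡ two 4 cut ⟨
      𝔼 {n} two (λ S → 4 * cut S)   ∎

-- From edge density to a piece

n<2^n : ∀ n → n < 2 ^ n
n<2^n zero    = s≤s z≤n
n<2^n (suc n) = ≤-trans (+-mono-≤ (m^n>0 2 n) (n<2^n n)) (≤-reflexive (cong (2 ^ n +_) (sym (+-identityʳ (2 ^ n)))))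

-- Every vertex chooses exactly d of its neighbours, and the chosen arcs are cut. Rows are thereby
-- bounded by d however irregular the graph is; all irregularity moves to the columns. The cut
-- retains at least a quarter of the n d arcs.
minDegree⇒piece :
  ∀ {n} (G : Graph n) d κ {{_ : NonZero κ}} t {{_ : NonZero t}} Q s ℓ → 2 + (2 + 2 * (κ * 512)) * t ≤ Q →
  d * 4 ≤ 2 ^ s → κ * 512 * t ≤ 2 ^ s → 1 ≤ s → s * Q * (κ * 64) * 16 ≤ d → ℓ * (Q * (κ * 512 * t * 2)) * 16 ≤ d →
  n ≤ 2 ^ (2 ^ ℓ) → (∀ v → d ≤ degree G v) → 0 < n * d →
  HasPiece κ G ⊎ (completeBipartite t t ⊑ G)
minDegree⇒piece {n} G d κ t Q s ℓ ≤Q d≤ R≤ 1≤s low≤d high≤d n≤ d≤deg 0<nd =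
  Ranges.total G {E = E} bip d rows≤d κ t Q ≤Q ℓ s d≤ R≤ c< low≤d high≤d nd≤ 0<nd
  where
  out : ∀ v → ∃ λ g → g ⊆ adjacent G v × # g ≡ d
  out v = select (adjacent G v) d (≤-trans (d≤deg v) (≤-reflexive (degree≡# G v)))
  O : Fin n → Fin n → Bool
  O v = proj₁ (out v)
  O⊆adjacent : ∀ v → O v ⊆ adjacent G v
  O⊆adjacent v = proj₁ (proj₂ (out v))
  cut = directed-cut O (λ v → not-true (λ Ovv → true≢false (O⊆adjacent v v Ovv) (adjacent-irrefl G v)))
  side : Fin n → Bool
  side = proj₁ cut
  E : Fin n → Fin n → Bool
  E u v = O u v ∧ (side u ∧ not (side v))
  bip : Bipartite G side E
  bip u v Euv with ∧-true {O u v} Euv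
  ... | Ouv , sides with ∧-true {side u} sides
  ...   | u∈A , v∉A = u∈A , trans (sym (Bool.not-involutive (side v))) (cong not v∉A) , O⊆adjacent u v Ouv
  rows≤d : ∀ u → # (E u) ≤ d
  rows≤d u = ≤-trans (#-mono (λ v Euv → proj₁ (∧-true {O u v} Euv))) (≤-reflexive (proj₂ (proj₂ (out u))))
  nd≤ : n * d ≤ ∑ (λ v → # (λ u → E u v)) * 4
  nd≤ = begin
    n * d                             ≡⟨ trans (∑-cong (λ v → proj₂ (proj₂ (out v)))) (∑-const n d) ⟨
    ∑ (λ u → # (O u))                 ≤⟨ proj₂ cut ⟩
    ∑ (λ u → # (E u)) * 4             ≡⟨ cong (_* 4) (∑-comm (λ u v → 𝟙 (E u v))) ⟩
    ∑ (λ v → # (λ u → E u v)) * 4     ∎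
    where open ≤-Reasoning
  c< : ∀ v → # (λ u → E u v) < 2 ^ (2 ^ ℓ * s * Q)
  c< v = ≤-<-trans (≤-trans (#≤n (λ u → E u v)) n≤) (^-monoʳ-< 2 (s≤s (s≤s z≤n)) (begin-strict
    2 ^ ℓ                <⟨ m<m*n (2 ^ ℓ) 2 {{m^n≢0 2 ℓ}} (s≤s (s≤s z≤n)) ⟩
    2 ^ ℓ * 2            ≤⟨ *-mono-≤ (m≤m*n (2 ^ ℓ) s {{>-nonZero 1≤s}}) (≤-trans (m≤m+n 2 _) ≤Q) ⟩
    2 ^ ℓ * s * Q        ∎))
    where open ≤-Reasoning

dense⇒piece :
  ∀ {n} (G : Graph n) d κ {{_ : NonZero κ}} t {{_ : NonZero t}} Q s ℓ → 2 + (2 + 2 * (κ * 512)) * t ≤ Q →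
  d * 4 ≤ 2 ^ s → κ * 512 * t ≤ 2 ^ s → 1 ≤ s → s * Q * (κ * 64) * 16 ≤ d → ℓ * (Q * (κ * 512 * t * 2)) * 16 ≤ d →
  n ≤ 2 ^ (2 ^ ℓ) → 0 < n * d → n * d ≤ edgeCount G →
  HasPiece κ G ⊎ (completeBipartite t t ⊑ G)
dense⇒piece {n} G d κ t Q s ℓ ≤Q d≤ R≤ 1≤s low≤d high≤d n≤ 0<nd nd≤e =
  [ inj₁ ∘ HasPiece-⊑ {H = graph} {G} embedding , (λ K⊑H → inj₂ (⊑-trans {F = completeBipartite t t} {graph} {G} K⊑H embedding)) ]′
    (minDegree⇒piece graph d κ t Q s ℓ ≤Q d≤ R≤ 1≤s low≤d high≤d
      (≤-trans (Fin.injective⇒≤ (λ eq → proj₁ (proj₂ embedding) eq)) n≤) (proj₂ (proj₂ core))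
      (*-mono-< (>-nonZero⁻¹ order {{nonEmpty}}) (0<m*n⇒0<n n d 0<nd)))
  where
  0<m*n⇒0<n : ∀ m n → 0 < m * n → 0 < n
  0<m*n⇒0<n m (suc n) _ = s≤s z≤n
  0<m*n⇒0<n m zero lt = contradiction lt (≤⇒≯ (≤-reflexive (*-zeroʳ m)))
  dense : 2 * d * ∑ {n} (λ _ → 1) ≤ ∑ (degree G)
  dense = begin
    2 * d * ∑ {n} (λ _ → 1)      ≡⟨ cong (2 * d *_) (∑-const n 1) ⟩
    2 * d * (n * 1)              ≡⟨ regroup d n ⟩
    2 * (n * d)                  ≤⟨ *-monoʳ-≤ 2 nd≤e ⟩
    2 * edgeCount G              ≡⟨ handshake G ⟨
    ∑ (degree G)                 ∎
    where
    open ≤-Reasoning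
    regroup : ∀ x y → 2 * x * (y * 1) ≡ 2 * (y * x)
    regroup = solve-∀
  core = peel G d (λ _ → 1) (λ _ ()) (≤-trans (≤-trans 0<nd nd≤e) (≤-trans (m≤m+n (edgeCount G) _) (≤-reflexive (sym (handshake G))))) dense
  open Subgraph (proj₁ core)

-- Here ℓ stands for log log n and λ₂ for the logarithm of the density. The two lower bounds on d in
-- `dense⇒piece` amount to `κ * κ * (t * t) * (λ₂ * ℓ)` times at most 64 · 1028 · 64 · 16 =
-- 67371008, and 134217728 = 2 ^ 27 is the next power of two.
required : ℕ → ℕ → ℕ → ℕ → ℕ
required κ t λ₂ ℓ = κ * κ * (t * t) * (λ₂ * ℓ) * 134217728

very-dense⇒piece :
  ∀ {n} (G : Graph n) κ {{_ : NonZero κ}} t {{_ : NonZero t}} λ₂ {{_ : NonZero λ₂}} ℓ {{_ : NonZero ℓ}} →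
  κ ≤ 2 ^ λ₂ → n ≤ 2 ^ (2 ^ ℓ) → 0 < n → n * required κ t λ₂ ℓ ≤ edgeCount G →
  HasPiece κ G ⊎ (completeBipartite t t ⊑ G)
very-dense⇒piece {n} G κ t λ₂ ℓ κ≤ n≤ 0<n nd≤e =
  dense⇒piece G d κ t (κ * t * 1028) s ℓ ≤Q d≤ (≤-trans R≤d d≤) 1≤s low≤d high≤d n≤ (*-mono-< 0<n 0<d) nd≤e
  where
  open ≤-Reasoning
  d = required κ t λ₂ ℓ
  p = t * (λ₂ * ℓ)
  -- `2 ^ s` has to dominate 4d. The factors of 4d have logarithms at most 2 λ₂, 2 t, λ₂ + ℓ and 29,
  -- in all at most 35 p, because p is at least each of 1, t, λ₂ and ℓ.
  s = p * 64
  instance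
    λℓ≢0 : NonZero (λ₂ * ℓ)
    λℓ≢0 = m*n≢0 λ₂ ℓ
    p≢0 : NonZero p
    p≢0 = m*n≢0 t (λ₂ * ℓ)
    κt≢0 : NonZero (κ * t)
    κt≢0 = m*n≢0 κ t
    κκ≢0 : NonZero (κ * κ)
    κκ≢0 = m*n≢0 κ κ
    tt≢0 : NonZero (t * t)
    tt≢0 = m*n≢0 t t
    κκtt≢0 : NonZero (κ * κ * (t * t))
    κκtt≢0 = m*n≢0 (κ * κ) (t * t)
  1≤s : 1 ≤ s
  1≤s = >-nonZero⁻¹ s {{m*n≢0 p 64}}
  0<d : 0 < d
  0<d = >-nonZero⁻¹ d {{m*n≢0 (κ * κ * (t * t) * (λ₂ * ℓ)) 134217728 {{m*n≢0 (κ * κ * (t * t)) (λ₂ * ℓ)}}}}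
  ≤Q : 2 + (2 + 2 * (κ * 512)) * t ≤ κ * t * 1028
  ≤Q = begin
    2 + (2 + 2 * (κ * 512)) * t         ≡⟨ regroup₁ κ t 512 ⟩
    1 * 2 + t * 2 + κ * t * 1024        ≤⟨ +-monoˡ-≤ _ (+-mono-≤ (*-monoˡ-≤ 2 (>-nonZero⁻¹ (κ * t))) (*-monoˡ-≤ 2 (m≤n*m t κ))) ⟩
    κ * t * 2 + κ * t * 2 + κ * t * 1024  ≡⟨ regroup₂ (κ * t) 2 2 1024 ⟩
    κ * t * 1028                        ∎
    where
    regroup₁ : ∀ x y c → 2 + (2 + 2 * (x * c)) * y ≡ 1 * 2 + y * 2 + x * y * (2 * c)
    regroup₁ = solve-∀
    regroup₂ : ∀ x i j l → x * i + x * j + x * l ≡ x * (i + j + l)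
    regroup₂ = solve-∀
  R≤d : κ * 512 * t ≤ d * 4
  R≤d = begin
    κ * 512 * t                                        ≡⟨ regroup κ t 512 ⟩
    κ * t * 512                                        ≤⟨ *-mono-≤ (≤-trans (*-mono-≤ (m≤m*n κ κ) (m≤m*n t t)) (m≤m*n (κ * κ * (t * t)) (λ₂ * ℓ))) (≤ᵇ⇒≤ 512 134217728 _) ⟩
    d                                                  ≤⟨ m≤m*n d 4 ⟩
    d * 4                                              ∎
    where
    regroup : ∀ x y c → x * c * y ≡ x * y * c
    regroup = solve-∀
  low≤d : s * (κ * t * 1028) * (κ * 64) * 16 ≤ d
  low≤d = begin
    p * 64 * (κ * t * 1028) * (κ * 64) * 16            ≡⟨ regroup κ t (λ₂ * ℓ) 64 1028 64 16 ⟩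
    κ * κ * (t * t) * (λ₂ * ℓ) * 67371008              ≤⟨ *-monoʳ-≤ (κ * κ * (t * t) * (λ₂ * ℓ)) (≤ᵇ⇒≤ 67371008 134217728 _) ⟩
    d                                                  ∎
    where
    regroup : ∀ x y z i j k l → y * z * i * (x * y * j) * (x * k) * l ≡ x * x * (y * y) * z * (i * j * k * l)
    regroup = solve-∀
  high≤d : ℓ * (κ * t * 1028 * (κ * 512 * t * 2)) * 16 ≤ d
  high≤d = begin
    ℓ * (κ * t * 1028 * (κ * 512 * t * 2)) * 16        ≡⟨ regroup κ t ℓ 1028 512 2 16 ⟩
    κ * κ * (t * t) * ℓ * 16842752                     ≤⟨ *-mono-≤ (*-monoʳ-≤ (κ * κ * (t * t)) (m≤n*m ℓ λ₂)) (≤ᵇ⇒≤ 16842752 134217728 _) ⟩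
    d                                                  ∎
    where
    regroup : ∀ x y z i j k l → z * (x * y * i * (x * j * y * k)) * l ≡ x * x * (y * y) * z * (i * j * k * l)
    regroup = solve-∀
  λ₂≤p : λ₂ ≤ p
  λ₂≤p = ≤-trans (m≤m*n λ₂ ℓ) (m≤n*m (λ₂ * ℓ) t)
  ℓ≤p : ℓ ≤ p
  ℓ≤p = ≤-trans (m≤n*m ℓ λ₂) (m≤n*m (λ₂ * ℓ) t)
  t≤p : t ≤ p
  t≤p = m≤m*n t (λ₂ * ℓ)
  ≤2^ : ∀ m → m ≤ 2 ^ m
  ≤2^ m = <⇒≤ (n<2^n m)
  product≤2^ : ∀ i j {x y} → x ≤ 2 ^ i → y ≤ 2 ^ j → x * y ≤ 2 ^ (i + j)
  product≤2^ i j x≤ y≤ = ≤-trans (*-mono-≤ x≤ y≤) (≤-reflexive (sym (^-distribˡ-+-* 2 i j)))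
  d≤ : d * 4 ≤ 2 ^ s
  d≤ = begin
    d * 4                                                                        ≡⟨ *-assoc (κ * κ * (t * t) * (λ₂ * ℓ)) 134217728 4 ⟩
    κ * κ * (t * t) * (λ₂ * ℓ) * 536870912                                       ≤⟨ product≤2^ (λ₂ + λ₂ + (t + t) + (λ₂ + ℓ)) 29 (product≤2^ (λ₂ + λ₂ + (t + t)) (λ₂ + ℓ)
                                                                                      (product≤2^ (λ₂ + λ₂) (t + t) (product≤2^ λ₂ λ₂ κ≤ κ≤) (product≤2^ t t (≤2^ t) (≤2^ t)))
                                                                                      (product≤2^ λ₂ ℓ (≤2^ λ₂) (≤2^ ℓ))) (≤-refl {2 ^ 29}) ⟩
    2 ^ (λ₂ + λ₂ + (t + t) + (λ₂ + ℓ) + 29)                                      ≤⟨ ^-monoʳ-≤ 2 (+-mono-≤ (+-mono-≤ (+-mono-≤ (+-mono-≤ λ₂≤p λ₂≤p) (+-mono-≤ t≤p t≤p)) (+-mono-≤ λ₂≤p ℓ≤p)) (*-monoˡ-≤ 29 (>-nonZero⁻¹ p))) ⟩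
    2 ^ (p + p + (p + p) + (p + p) + p * 29)                                     ≡⟨ cong (2 ^_) (regroup p 29) ⟩
    2 ^ (p * 35)                                                                 ≤⟨ ^-monoʳ-≤ 2 (*-monoʳ-≤ p (≤ᵇ⇒≤ 35 64 _)) ⟩
    2 ^ s                                                                        ∎
    where
    regroup : ∀ x i → x + x + (x + x) + (x + x) + x * i ≡ x * (6 + i)
    regroup = solve-∀

-- Fractions of natural numbers as rationals

toℚᵘ-/ : ∀ a b .{{_ : NonZero b}} → ℚ.toℚᵘ (ℤ.+ a ℚ./ b) ℚᵘ.≃ (ℤ.+ a ℚᵘ./ b)
toℚᵘ-/ a (suc b) = ℚ.toℚᵘ-fromℚᵘ (ℚᵘ.mkℚᵘ (ℤ.+ a) b)

/-mono-≤ : ∀ a b c d .{{_ : NonZero b}} .{{_ : NonZero d}} → a * d ≤ c * b → ℤ.+ a ℚ./ b ℚ.≤ ℤ.+ c ℚ./ d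
/-mono-≤ a b@(suc _) c d@(suc _) ad≤cb = ℚ.toℚᵘ-cancel-≤ (ℚᵘ.≤-respˡ-≃ (ℚᵘ.≃-sym (toℚᵘ-/ a b))
  (ℚᵘ.≤-respʳ-≃ (ℚᵘ.≃-sym (toℚᵘ-/ c d)) (ℚᵘ.*≤* (subst₂ ℤ._≤_ (ℤ.pos-* a d) (ℤ.pos-* c b) (ℤ.+≤+ ad≤cb)))))

/-mono-< : ∀ a b c d .{{_ : NonZero b}} .{{_ : NonZero d}} → a * d < c * b → ℤ.+ a ℚ./ b ℚ.< ℤ.+ c ℚ./ d
/-mono-< a b@(suc _) c d@(suc _) ad<cb = ℚ.toℚᵘ-cancel-< (ℚᵘ.<-respˡ-≃ (ℚᵘ.≃-sym (toℚᵘ-/ a b))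
  (ℚᵘ.<-respʳ-≃ (ℚᵘ.≃-sym (toℚᵘ-/ c d)) (ℚᵘ.*<* (subst₂ ℤ._<_ (ℤ.pos-* a d) (ℤ.pos-* c b) (ℤ.+<+ ad<cb)))))

ι : ℕ → ℚ
ι n = ℤ.+ n ℚ./ 1

ι-mono-≤ : ∀ {m n} → m ≤ n → ι m ℚ.≤ ι n
ι-mono-≤ {m} {n} m≤n = /-mono-≤ m 1 n 1 (*-monoˡ-≤ 1 m≤n)

ι-mono-< : ∀ {m n} → m < n → ι m ℚ.< ι n
ι-mono-< {m} {n} m<n = /-mono-< m 1 n 1 (*-monoˡ-< 1 m<n)

ι-cancel-< : ∀ {m n} → ι m ℚ.< ι n → m < n
ι-cancel-< {m} {n} ιm<ιn with m <? n
... | yes m<n = m<n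
... | no  m≮n = contradiction (ℚ.<-≤-trans ιm<ιn (ι-mono-≤ (≮⇒≥ m≮n))) (ℚ.<-irrefl refl)

ι-cancel-≤ : ∀ {m n} → ι m ℚ.≤ ι n → m ≤ n
ι-cancel-≤ {m} {n} ιm≤ιn with m ≤? n
... | yes m≤n = m≤n
... | no  m≰n = contradiction (ℚ.≤-<-trans ιm≤ιn (ι-mono-< (≰⇒> m≰n))) (ℚ.<-irrefl refl)

ι-+ : ∀ m n → ι (m + n) ≡ ι m ℚ.+ ι n
ι-+ m n = ℚ.toℚᵘ-injective (begin
  ℚ.toℚᵘ (ι (m + n))                      ≈⟨ toℚᵘ-/ (m + n) 1 ⟩
  ℤ.+ (m + n) ℚᵘ./ 1                      ≈⟨ ℚᵘ.*≡* (cong (ℤ._* ℤ.1ℤ) (sym (cong₂ ℤ._+_ (ℤ.*-identityʳ (ℤ.+ m)) (ℤ.*-identityʳ (ℤ.+ n))))) ⟩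
  (ℤ.+ m ℚᵘ./ 1) ℚᵘ.+ (ℤ.+ n ℚᵘ./ 1)      ≈⟨ ℚᵘ.+-cong (ℚᵘ.≃-sym (toℚᵘ-/ m 1)) (ℚᵘ.≃-sym (toℚᵘ-/ n 1)) ⟩
  ℚ.toℚᵘ (ι m) ℚᵘ.+ ℚ.toℚᵘ (ι n)          ≈⟨ ℚ.toℚᵘ-homo-+ (ι m) (ι n) ⟨
  ℚ.toℚᵘ (ι m ℚ.+ ι n)                    ∎)
  where open ℚᵘ.≃-Reasoning

/-* : ∀ a b c .{{_ : NonZero b}} → (ℤ.+ a ℚ./ b) ℚ.* ι c ≡ ℤ.+ (a * c) ℚ./ b
/-* a b@(suc b-1) c = ℚ.toℚᵘ-injective (begin
  ℚ.toℚᵘ ((ℤ.+ a ℚ./ b) ℚ.* ι c)              ≈⟨ ℚ.toℚᵘ-homo-* (ℤ.+ a ℚ./ b) (ι c) ⟩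
  ℚ.toℚᵘ (ℤ.+ a ℚ./ b) ℚᵘ.* ℚ.toℚᵘ (ι c)      ≈⟨ ℚᵘ.*-cong (toℚᵘ-/ a b) (toℚᵘ-/ c 1) ⟩
  (ℤ.+ a ℚᵘ./ b) ℚᵘ.* (ℤ.+ c ℚᵘ./ 1)          ≈⟨ ℚᵘ.*≡* (cong₂ ℤ._*_ (sym (ℤ.pos-* a c)) (cong ℤ.+_ (sym (*-identityʳ b)))) ⟩
  ℤ.+ (a * c) ℚᵘ./ b                          ≈⟨ toℚᵘ-/ (a * c) b ⟨
  ℚ.toℚᵘ (ℤ.+ (a * c) ℚ./ b)                  ∎)
  where open ℚᵘ.≃-Reasoning

ι-* : ∀ m n → ι (m * n) ≡ ι m ℚ.* ι n
ι-* m n = sym (/-* m 1 n)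

ι-^ : ∀ m k → ι (m ^ k) ≡ ι m ^ℚ k
ι-^ m zero    = refl
ι-^ m (suc k) = trans (ι-* m (m ^ k)) (cong (ι m ℚ.*_) (ι-^ m k))

ι≥0 : ∀ n → 0ℚ ℚ.≤ ι n
ι≥0 n = ι-mono-≤ {0} {n} z≤n

*-mono-≤-≥0 : ∀ {w x y z} → 0ℚ ℚ.≤ w → 0ℚ ℚ.≤ z → w ℚ.≤ x → y ℚ.≤ z → w ℚ.* y ℚ.≤ x ℚ.* z
*-mono-≤-≥0 {w} {x} {y} {z} 0≤w 0≤z w≤x y≤z =
  ℚ.≤-trans (ℚ.*-monoˡ-≤-nonNeg w {{ℚ.nonNegative 0≤w}} y≤z) (ℚ.*-monoʳ-≤-nonNeg z {{ℚ.nonNegative 0≤z}} w≤x)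

^ℚ-≥0 : ∀ {x} k → 0ℚ ℚ.≤ x → 0ℚ ℚ.≤ x ^ℚ k
^ℚ-≥0 zero    _   = ι≥0 1
^ℚ-≥0 {x} (suc k) 0≤x = ℚ.≤-trans (ℚ.≤-reflexive (sym (ℚ.*-zeroʳ x))) (ℚ.*-monoˡ-≤-nonNeg x {{ℚ.nonNegative 0≤x}} (^ℚ-≥0 k 0≤x))

^ℚ-mono-≤ : ∀ {x y} k → 0ℚ ℚ.≤ x → x ℚ.≤ y → x ^ℚ k ℚ.≤ y ^ℚ k
^ℚ-mono-≤ zero    _   _   = ℚ.≤-refl
^ℚ-mono-≤ (suc k) 0≤x x≤y = *-mono-≤-≥0 0≤x (^ℚ-≥0 k (ℚ.≤-trans 0≤x x≤y)) x≤y (^ℚ-mono-≤ k 0≤x x≤y)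

1^ℚ : ∀ k → 1ℚ ^ℚ k ≡ 1ℚ
1^ℚ zero    = refl
1^ℚ (suc k) = trans (ℚ.*-identityˡ _) (1^ℚ k)

2^-cancel-≤ : ∀ {i j} → 2 ^ i ≤ 2 ^ j → i ≤ j
2^-cancel-≤ {i} {j} le with i ≤? j
... | yes i≤j = i≤j
... | no  i≰j = contradiction le (<⇒≱ (^-monoʳ-< 2 (s≤s (s≤s z≤n)) (≰⇒> i≰j)))

2^-cancel-< : ∀ {i j} → 2 ^ i < 2 ^ j → i < j
2^-cancel-< {i} {j} lt with i <? j
... | yes i<j = i<j
... | no  i≮j = contradiction lt (≤⇒≯ (^-monoʳ-≤ 2 (≮⇒≥ i≮j)))

-- Comparing logarithms with fractions

-- The assumption is the inequality x ≤ 2 ^ m, expressed through the lower cut alone. Assumption and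
-- conclusion each use one side of a cut, so the lemma can be applied twice to reach `loglog`.
log-upper : ∀ x m → (∀ {q} → q <ᴸ x → q ℚ.≤ 2ℚ ^ℚ m) → ∀ {r} → r <ᴸ log₂ x → r ℚ.< ι m
log-upper x m q≤ {r@record{}} (q , q<x , 0<q , 2^<) = ℚ.toℚᵘ-cancel-< (ℚᵘ.<-respʳ-≃ (ℚᵘ.≃-sym (toℚᵘ-/ m 1))
  (ℚᵘ.*<* (subst₂ ℤ._<_ (sym (ℤ.*-identityʳ (↥ r))) (ℤ.pos-* m (↧ₙ r)) (numerator (↥ r) bound))))
  where
  bound : 2^ (↥ r) ℚ.< ι (2 ^ (m * ↧ₙ r))
  bound = ℚ.<-≤-trans 2^< (ℚ.≤-trans (^ℚ-mono-≤ (↧ₙ r) (ℚ.<⇒≤ 0<q) (q≤ q<x))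
            (ℚ.≤-reflexive (trans (^ℚ-assocʳ 2ℚ m (↧ₙ r)) (sym (ι-^ 2 (m * ↧ₙ r))))))
  numerator : ∀ z → 2^ z ℚ.< ι (2 ^ (m * ↧ₙ r)) → z ℤ.< ℤ.+ (m * ↧ₙ r)
  numerator (ℤ.+ k)    lt = ℤ.+<+ (2^-cancel-< (ι-cancel-< (ℚ.≤-<-trans (ℚ.≤-reflexive (ι-^ 2 k)) lt)))
  numerator ℤ.-[1+ k ] lt = ℤ.-<+

-- The counterpart for upper cuts, with a fraction a / b so that estimates such as log 3 ≥ 3/2 are
-- covered. Raising to the powers b and `↧ₙ r` clears both denominators. The condition 1 ≤ q
-- excludes negative r, as powers of ½ do not exceed 1.
log-lower : ∀ x a b .{{_ : NonZero b}} → (∀ {q} → x <ᵁ q → 1ℚ ℚ.≤ q × 2ℚ ^ℚ a ℚ.≤ q ^ℚ b) → ∀ {r} → log₂ x <ᵁ r → ℤ.+ a ℚ./ b ℚ.≤ r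
log-lower x a b@(suc _) ≤q {r@record{}} (q , x<q , <2^) = ℚ.toℚᵘ-cancel-≤ (ℚᵘ.≤-respˡ-≃ (ℚᵘ.≃-sym (toℚᵘ-/ a b))
  (ℚᵘ.*≤* (subst (ℤ._≤ ↥ r ℤ.* ℤ.+ b) (ℤ.pos-* a (↧ₙ r)) (numerator (↥ r) <2^))))
  where
  1≤q = proj₁ (≤q x<q)
  0≤q : 0ℚ ℚ.≤ q
  0≤q = ℚ.≤-trans (ι≥0 1) 1≤q
  δ = ↧ₙ r
  numerator : ∀ z → q ^ℚ δ ℚ.< 2^ z → ℤ.+ (a * δ) ℤ.≤ z ℤ.* ℤ.+ b
  numerator (ℤ.+ k) lt = subst (ℤ.+ (a * δ) ℤ.≤_) (ℤ.pos-* k b) (ℤ.+≤+ (2^-cancel-≤ (ι-cancel-≤ (begin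
    ι (2 ^ (a * δ))          ≡⟨ ι-^ 2 (a * δ) ⟩
    2ℚ ^ℚ (a * δ)            ≡⟨ ^ℚ-assocʳ 2ℚ a δ ⟨
    (2ℚ ^ℚ a) ^ℚ δ           ≤⟨ ^ℚ-mono-≤ δ (^ℚ-≥0 a (ι≥0 2)) (proj₂ (≤q x<q)) ⟩
    (q ^ℚ b) ^ℚ δ            ≡⟨ trans (^ℚ-assocʳ q b δ) (trans (cong (q ^ℚ_) (*-comm b δ)) (sym (^ℚ-assocʳ q δ b))) ⟩
    (q ^ℚ δ) ^ℚ b            ≤⟨ ^ℚ-mono-≤ b (^ℚ-≥0 δ 0≤q) (ℚ.<⇒≤ lt) ⟩
    (2ℚ ^ℚ k) ^ℚ b           ≡⟨ ^ℚ-assocʳ 2ℚ k b ⟩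
    2ℚ ^ℚ (k * b)            ≡⟨ ι-^ 2 (k * b) ⟨
    ι (2 ^ (k * b))          ∎))))
    where open ℚ.≤-Reasoning
  numerator ℤ.-[1+ k ] lt = contradiction (begin-strict
    1ℚ                       ≡⟨ 1^ℚ δ ⟨
    1ℚ ^ℚ δ                  ≤⟨ ^ℚ-mono-≤ δ (ι≥0 1) 1≤q ⟩
    q ^ℚ δ                   <⟨ lt ⟩
    ½ ^ℚ suc k               ≤⟨ ^ℚ-mono-≤ (suc k) (/-mono-≤ 0 1 1 2 z≤n) (/-mono-≤ 1 2 1 1 (s≤s z≤n)) ⟩
    1ℚ ^ℚ suc k              ≡⟨ 1^ℚ (suc k) ⟩
    1ℚ                       ∎) (ℚ.<-irrefl refl)
    where open ℚ.≤-Reasoning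

-- Integer scales for log log n and for logarithms

^-distribʳ-* : ∀ k m n → (m * n) ^ k ≡ m ^ k * n ^ k
^-distribʳ-* zero    m n = refl
^-distribʳ-* (suc k) m n = trans (cong (m * n *_) (^-distribʳ-* k m n)) (interchange m n (m ^ k) (n ^ k))
  where
  interchange : ∀ a b c d → a * b * (c * d) ≡ a * c * (b * d)
  interchange = solve-∀

m≤m^n : ∀ n {{_ : NonZero n}} m → m ≤ m ^ n
m≤m^n (suc n) zero      = z≤n
m≤m^n (suc n) m@(suc _) = m≤m*n m (m ^ n) {{m^n≢0 m n}}

maximal : ∀ (f : ℕ → ℕ) X → f 0 ≤ X → (∀ m → m ≤ f m) → ∃ λ m → f m ≤ X × X < f (suc m)
maximal f X f0≤X id≤f = search (suc X) (id≤f (suc X))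
  where
  search : ∀ m → X < f m → ∃ λ m → f m ≤ X × X < f (suc m)
  search zero    X<f0 = contradiction f0≤X (<⇒≱ X<f0)
  search (suc m) X<f  with f m ≤? X
  ... | yes fm≤X = m , fm≤X , X<f
  ... | no  fm≰X = search m (≰⇒> fm≰X)

loglog-scale : ∀ n → 3 ≤ n → ∃ λ j → 2 ^ (2 ^ j) ≤ n × n ≤ 2 ^ (2 ^ suc j)
loglog-scale n 3≤n with maximal (λ j → 2 ^ (2 ^ j)) (n ∸ 1) (∸-monoˡ-≤ 1 3≤n)
                          (λ m → ≤-trans (<⇒≤ (n<2^n m)) (<⇒≤ (n<2^n (2 ^ m))))
... | j , ≤n , n< = j , ≤-trans ≤n (m∸n≤m n 1) , ≤-trans (≤-reflexive (sym (m+[n∸m]≡n (≤-trans (s≤s z≤n) 3≤n)))) n<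

-- `X` can be 0, and then `2 ^ i ≤ X` fails for every i; the alternative `i ≡ 0` covers this.
log-scale : ∀ X → ∃ λ i → (i ≡ 0 ⊎ 2 ^ i ≤ X) × X < 2 ^ suc i
log-scale X with 1 ≤? X
... | no  X<1 = 0 , inj₁ refl , ≤-trans (≰⇒> X<1) (s≤s z≤n)
... | yes 1≤X with maximal (2 ^_) X 1≤X (λ m → <⇒≤ (n<2^n m))
...   | i , ≤X , X< = i , inj₂ ≤X , X<

loglog : ℕ → ℝ
loglog n = log₂ (log₂ (fromℕ n))

loglog-upper : ∀ n ℓ → n ≤ 2 ^ (2 ^ ℓ) → ∀ {s} → s <ᴸ loglog n → s ℚ.< ι ℓ
loglog-upper n ℓ n≤ = log-upper (log₂ (fromℕ n)) ℓ (λ q<log →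
  ℚ.≤-trans (ℚ.<⇒≤ (log-upper (fromℕ n) (2 ^ ℓ) inner q<log)) (ℚ.≤-reflexive (ι-^ 2 ℓ)))
  where
  inner : ∀ {q} → q ℚ.< ι n → q ℚ.≤ 2ℚ ^ℚ (2 ^ ℓ)
  inner q<n = ℚ.≤-trans (ℚ.<⇒≤ q<n) (ℚ.≤-trans (ι-mono-≤ n≤) (ℚ.≤-reflexive (ι-^ 2 (2 ^ ℓ))))

-- Since j ≤ log log n says nothing for j = 0, the additional 1 is absorbed by 2 log log n, using
-- log log 3 ≥ 1/2.
loglog-lower : ∀ n j → 3 ≤ n → 2 ^ (2 ^ j) ≤ n → ∀ {s} → loglog n <ᵁ s → ι (suc j) ℚ.≤ ι 3 ℚ.* s
loglog-lower n j 3≤n ≤n {s} L<s = begin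
  ι (suc j)                ≡⟨ cong ι (+-comm j 1) ⟨
  ι (j + 1)                ≡⟨ ι-+ j 1 ⟩
  ι j ℚ.+ ι 1              ≤⟨ ℚ.+-mono-≤ j≤s (ℚ.*-monoˡ-≤-nonNeg (ι 2) ½≤s) ⟩
  s ℚ.+ ι 2 ℚ.* s          ≡⟨ cong (ℚ._+ ι 2 ℚ.* s) (ℚ.*-identityˡ s) ⟨
  ι 1 ℚ.* s ℚ.+ ι 2 ℚ.* s  ≡⟨ ℚ.*-distribʳ-+ s (ι 1) (ι 2) ⟨
  ι 3 ℚ.* s                ∎
  where
  open ℚ.≤-Reasoning
  n<⇒ : ∀ {q} → ι n ℚ.< q → ∀ a b → 2 ^ a ≤ n ^ b → 1ℚ ℚ.≤ q × 2ℚ ^ℚ a ℚ.≤ q ^ℚ b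
  n<⇒ {q} n<q a b 2^a≤ = ℚ.≤-trans (ι-mono-≤ {1} {n} (≤-trans (s≤s z≤n) 3≤n)) (ℚ.<⇒≤ n<q) , (begin
    2ℚ ^ℚ a        ≡⟨ ι-^ 2 a ⟨
    ι (2 ^ a)      ≤⟨ ι-mono-≤ 2^a≤ ⟩
    ι (n ^ b)      ≡⟨ ι-^ n b ⟩
    ι n ^ℚ b       ≤⟨ ^ℚ-mono-≤ b (ι≥0 n) (ℚ.<⇒≤ n<q) ⟩
    q ^ℚ b         ∎)
  j≤s : ι j ℚ.≤ s
  j≤s = log-lower (log₂ (fromℕ n)) j 1 outer L<s
    where
    outer : ∀ {q} → log₂ (fromℕ n) <ᵁ q → 1ℚ ℚ.≤ q × 2ℚ ^ℚ j ℚ.≤ q ^ℚ 1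
    outer {q} log<q = ℚ.≤-trans (ι-mono-≤ {1} {2 ^ j} (m^n>0 2 j)) 2^j≤q ,
      ℚ.≤-trans (ℚ.≤-reflexive (sym (ι-^ 2 j))) (ℚ.≤-trans 2^j≤q (ℚ.≤-reflexive (sym (ℚ.*-identityʳ q))))
      where
      2^j≤q : ι (2 ^ j) ℚ.≤ q
      2^j≤q = log-lower (fromℕ n) (2 ^ j) 1 (λ n<q → n<⇒ n<q (2 ^ j) 1 (≤-trans ≤n (≤-reflexive (sym (*-identityʳ n))))) log<q
  -- log n ≥ 3/2 since 2³ ≤ 3², and log (3/2) ≥ 1/2 since 2 ≤ (3/2)².
  ½≤s : ½ ℚ.≤ s
  ½≤s = log-lower (log₂ (fromℕ n)) 1 2 outer L<s
    where
    3/2 = ℤ.+ 3 ℚ./ 2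
    outer : ∀ {q} → log₂ (fromℕ n) <ᵁ q → 1ℚ ℚ.≤ q × 2ℚ ^ℚ 1 ℚ.≤ q ^ℚ 2
    outer {q} log<q = ℚ.≤-trans (/-mono-≤ 1 1 3 2 (≤ᵇ⇒≤ 2 3 _)) 3/2≤q ,
      ℚ.≤-trans (/-mono-≤ 2 1 9 4 (≤ᵇ⇒≤ 8 9 _)) (^ℚ-mono-≤ {3/2} 2 (/-mono-≤ 0 1 3 2 z≤n) 3/2≤q)
      where
      3/2≤q : 3/2 ℚ.≤ q
      3/2≤q = log-lower (fromℕ n) 3 2 (λ n<q → n<⇒ n<q 3 2 (≤-trans (≤ᵇ⇒≤ 8 9 _) (^-monoˡ-≤ 2 3≤n))) log<q

loglog-positive : ∀ n → 3 ≤ n → ½ <ᴸ loglog n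
-- Lower cuts are open, so the witness has to be strictly below 3 while its square still exceeds 8:
-- (17/6) ^ 2 = 289/36 does.
loglog-positive n 3≤n = 3/2 , (17/6 , 17/6<n , /-mono-< 0 1 17 6 (<ᵇ⇒< 0 17 _) , /-mono-< 8 1 289 36 (<ᵇ⇒< 288 289 _)) ,
  /-mono-< 0 1 3 2 (<ᵇ⇒< 0 3 _) , /-mono-< 2 1 9 4 (<ᵇ⇒< 8 9 _)
  where
  3/2 = ℤ.+ 3 ℚ./ 2
  17/6 = ℤ.+ 17 ℚ./ 6
  17/6<n : 17/6 ℚ.< ι n
  17/6<n = /-mono-< 17 6 n 1 (≤-trans (<ᵇ⇒< 17 18 _) (*-monoˡ-≤ 6 3≤n))

-- Average degree and the ratio d / log log n

edge-piece : ∀ {n} (G : Graph n) → 0 < edgeCount G → HasPiece 1 G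
edge-piece {n} G 0<e with 0<∑⇒∃ (degree G) (≤-trans 0<e (≤-trans (m≤m+n (edgeCount G) _) (≤-reflexive (sym (handshake G)))))
... | u , 0<deg with 0<#⇒∃ (adjacent G u) (≤-trans 0<deg (≤-reflexive (degree≡# G u)))
...   | v , uv = completeBipartite-piece G 1 (completeBipartite-⊑ G bip (λ _ → u) (λ _ → v) inj inj
                   (λ _ _ → ∧-intro (dec-true (u Fin.≟ u) refl) (dec-true (v Fin.≟ v) refl)))
  where
  inj : ∀ {w} → Injective {A = Fin 1} {B = Fin n} _≡_ _≡_ (λ _ → w)
  inj {_} {zero} {zero} _ = refl
  bip : Bipartite G (λ w → does (u Fin.≟ w)) (λ a b → does (u Fin.≟ a) ∧ does (v Fin.≟ b))
  bip a b eq with ∧-true {does (u Fin.≟ a)} eq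
  ... | ua , vb with does-true (u Fin.≟ a) ua | does-true (v Fin.≟ b) vb
  ...   | refl | refl = ua , dec-false (u Fin.≟ v) (λ { refl → true≢false uv (adjacent-irrefl G u) }) , uv

piece⇒subgraph : ∀ {n κ x} {G : Graph n} → HasPiece κ G → (∀ {q} → q <ᴸ x → q ℚ.< ι κ) → HasAlmostRegularSubgraph 64 G x
piece⇒subgraph {κ = κ} (H , max-H , min-H) x≤κ = H , almost-regular , λ q<x → ℚ.<-≤-trans (x≤κ q<x) κ≤average
  where
  open Subgraph H
  almost-regular : AlmostRegular graph 64
  almost-regular = ≤-trans (maxDegree-≤ graph max-H)
    (≤-trans (≤-reflexive (*-comm κ 64)) (*-monoʳ-≤ 64 (minDegree-≥ graph {{nonEmpty}} min-H)))
  κ≤average : ι κ ℚ.≤ averageDegree graph {{nonEmpty}}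
  κ≤average = /-mono-≤ κ 1 (2 * edgeCount graph) order {{_}} {{nonEmpty}} (begin
    κ * order                    ≡⟨ *-comm κ order ⟩
    order * κ                    ≡⟨ ∑-const order κ ⟨
    ∑ {order} (λ _ → κ)          ≤⟨ ∑-mono min-H ⟩
    ∑ (degree graph)             ≡⟨ handshake graph ⟩
    2 * edgeCount graph          ≡⟨ *-identityʳ (2 * edgeCount graph) ⟨
    2 * edgeCount graph * 1      ∎)
    where open ≤-Reasoning

quotient-scale : ∀ e m .{{_ : NonZero m}} → ∃ λ X → X * m ≤ e × e < suc X * m
quotient-scale e m = e / m , m/n*n≤m e m ,
  ≤-trans (s≤s (≤-reflexive (m≡m%n+[m/n]*n e m))) (+-monoˡ-< (e / m * m) (m%n<n e m))

module _ {n : ℕ} .{{_ : NonZero n}} (G : Graph n) where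

  0<edgeCount : 0ℚ ℚ.< averageDegree G → 0 < edgeCount G
  0<edgeCount 0<d = n≢0⇒n>0 λ e≡0 → contradiction
    (ℚ.<-≤-trans 0<d (/-mono-≤ (2 * edgeCount G) n 0 1 (≤-reflexive (cong (λ m → 2 * m * 1) e≡0))))
    (ℚ.<-irrefl refl)

  averageDegree-≥ : ∀ X ℓ → X * (n * ℓ) ≤ edgeCount G → ι (X * ℓ) ℚ.≤ averageDegree G
  averageDegree-≥ X ℓ ≤e = /-mono-≤ (X * ℓ) 1 (2 * edgeCount G) n (begin
    X * ℓ * n              ≡⟨ regroup X ℓ n ⟩
    X * (n * ℓ)            ≤⟨ ≤e ⟩
    edgeCount G            ≤⟨ m≤m+n (edgeCount G) (edgeCount G + 0) ⟩
    2 * edgeCount G        ≡⟨ *-identityʳ (2 * edgeCount G) ⟨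
    2 * edgeCount G * 1    ∎)
    where
    open ≤-Reasoning
    regroup : ∀ x y z → x * y * z ≡ x * (z * y)
    regroup = solve-∀

  averageDegree-< : ∀ X ℓ → edgeCount G < X * (n * ℓ) → averageDegree G ℚ.< ι (2 * (X * ℓ))
  averageDegree-< X ℓ e< = /-mono-< (2 * edgeCount G) n (2 * (X * ℓ)) 1 (begin-strict
    2 * edgeCount G * 1      ≡⟨ *-identityʳ (2 * edgeCount G) ⟩
    2 * edgeCount G          <⟨ *-monoʳ-< 2 e< ⟩
    2 * (X * (n * ℓ))        ≡⟨ regroup X n ℓ ⟩
    2 * (X * ℓ) * n          ∎)
    where
    open ≤-Reasoning
    regroup : ∀ x y z → 2 * (x * (y * z)) ≡ 2 * (x * z) * y
    regroup = solve-∀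

-- Integer substitutes for the real quantities, correct up to constant factors: `suc j` for log log
-- n, `suc X` for d / log log n and `suc i` for its logarithm.
module Ratio (n : ℕ) (3≤n : 3 ≤ n) (d : ℚ) (d≥2L : 2ℚ · loglog n ≤ᴿ fromℚ d)
             (j : ℕ) (≤n : 2 ^ (2 ^ j) ≤ n) (n≤ : n ≤ 2 ^ (2 ^ suc j))
             (X : ℕ) (d≥ : ι (X * suc j) ℚ.≤ d) (d< : d ℚ.< ι (2 * (suc X * suc j)))
             (i : ℕ) (i-scale : i ≡ 0 ⊎ 2 ^ i ≤ X) where

  ℓ  = suc j
  λ₂ = suc i
  D  = fromℚ d ÷ loglog n

  -- The hypothesis `d≥2L` gives D ≥ 2 and hence log D ≥ 1, which also pays for the 1 in
  -- `λ₂ = suc i`. For the rest, 2 ^ i ≤ X ≤ d / ℓ ≤ D as log log n ≤ ℓ.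
  logD-lower : ∀ {s} → log₂ D <ᵁ s → 1ℚ ℚ.≤ s × ι λ₂ ℚ.≤ ι 2 ℚ.* s
  logD-lower {s} logD<s = 1≤s , (begin
    ι λ₂                       ≡⟨ cong ι (+-comm i 1) ⟨
    ι (i + 1)                  ≡⟨ ι-+ i 1 ⟩
    ι i ℚ.+ ι 1                ≤⟨ ℚ.+-mono-≤ i≤s 1≤s ⟩
    s ℚ.+ s                    ≡⟨ cong₂ ℚ._+_ (ℚ.*-identityˡ s) (ℚ.*-identityˡ s) ⟨
    ι 1 ℚ.* s ℚ.+ ι 1 ℚ.* s    ≡⟨ ℚ.*-distribʳ-+ s (ι 1) (ι 1) ⟨
    ι 2 ℚ.* s                  ∎)
    where
    open ℚ.≤-Reasoning
    2≤v : ∀ {v} → D <ᵁ v → ι 2 ℚ.≤ v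
    2≤v {v} (r , s₁ , d<r , s₁<L , 0<s₁ , r<vs₁) = ℚ.≮⇒≥ λ v<2 →
      ℚ.<-irrefl refl (d≥2L (s₁ , s₁<L , ℚ.<-trans d<r (ℚ.<-trans r<vs₁ (ℚ.*-monoˡ-<-pos s₁ {{ℚ.positive 0<s₁}} v<2))))
    2^i≤v : ∀ {v} → D <ᵁ v → ι (2 ^ i) ℚ.≤ v
    2^i≤v {v} D<v@(r , s₁ , d<r , s₁<L , 0<s₁ , r<vs₁) = by-size i-scale
      where
      by-size : i ≡ 0 ⊎ 2 ^ i ≤ X → ι (2 ^ i) ℚ.≤ v
      by-size (inj₁ i≡0) = ℚ.≤-trans (ι-mono-≤ {2 ^ i} {2} (≤-trans (≤-reflexive (cong (2 ^_) i≡0)) (s≤s z≤n))) (2≤v D<v)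
      by-size (inj₂ 2^i≤X) = ℚ.≮⇒≥ λ v< → ℚ.<-irrefl refl (begin-strict
        ι (2 ^ i) ℚ.* s₁          ≤⟨ *-mono-≤-≥0 (ι≥0 (2 ^ i)) (ι≥0 ℓ) (ι-mono-≤ 2^i≤X) (ℚ.<⇒≤ (loglog-upper n ℓ n≤ s₁<L)) ⟩
        ι X ℚ.* ι ℓ               ≡⟨ ι-* X ℓ ⟨
        ι (X * ℓ)                 ≤⟨ d≥ ⟩
        d                         <⟨ d<r ⟩
        r                         <⟨ r<vs₁ ⟩
        v ℚ.* s₁                  <⟨ ℚ.*-monoˡ-<-pos s₁ {{ℚ.positive 0<s₁}} v< ⟩
        ι (2 ^ i) ℚ.* s₁          ∎)
    1≤v : ∀ {v} → D <ᵁ v → 1ℚ ℚ.≤ v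
    1≤v D<v = ℚ.≤-trans (ι-mono-≤ {1} {2} (s≤s z≤n)) (2≤v D<v)
    1≤s : 1ℚ ℚ.≤ s
    1≤s = log-lower D 1 1 (λ {v} D<v → 1≤v D<v , ℚ.≤-trans (2≤v D<v) (ℚ.≤-reflexive (sym (ℚ.*-identityʳ v)))) logD<s
    i≤s : ι i ℚ.≤ s
    i≤s = log-lower D i 1 (λ {v} D<v → 1≤v D<v ,
      ℚ.≤-trans (ℚ.≤-reflexive (sym (ι-^ 2 i))) (ℚ.≤-trans (2^i≤v D<v) (ℚ.≤-reflexive (sym (ℚ.*-identityʳ v))))) logD<s

  -- D is of the order of X ≤ (2 κ*) ^ p c λ₂, and σ ^ p is at least of the order of λ₂,
  -- so D ^ (1 / p) / σ is at most of the order of κ*.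
  bound : ∀ p c C κ* → c * 12 * 2 ^ p ≤ C ^ p → suc X ≤ (2 * κ*) ^ p * c * λ₂ →
          ∀ ρ σ r → 0ℚ ℚ.< σ → ι λ₂ ℚ.≤ ι 2 ℚ.* (σ ^ℚ p) → ρ ℚ.* σ ℚ.< r → r <ᴸ root p D → ρ ℚ.< ι (κ* * C)
  bound p c C κ* 12c≤C X≤ ρ σ r 0<σ λ≤ ρσ<r r<root = ℚ.≰⇒> refute
    where
    0≤σ = ℚ.<⇒≤ 0<σ
    K = (κ* * C) ^ p
    U = (2 * κ*) ^ p * c * 6 * ℓ
    refute : ¬ (ι (κ* * C) ℚ.≤ ρ)
    refute κC≤ρ = contra r<root
      where
      κCσ<r : ι (κ* * C) ℚ.* σ ℚ.< r
      κCσ<r = ℚ.≤-<-trans (ℚ.*-monoʳ-≤-nonNeg σ {{ℚ.nonNegative 0≤σ}} κC≤ρ) ρσ<r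
      0≤κCσ : 0ℚ ℚ.≤ ι (κ* * C) ℚ.* σ
      0≤κCσ = ℚ.≤-trans (ℚ.≤-reflexive (sym (ℚ.*-zeroˡ σ))) (ℚ.*-monoʳ-≤-nonNeg σ {{ℚ.nonNegative 0≤σ}} (ι≥0 (κ* * C)))
      -- The factor 12 = 3 · 2 · 2 collects ℓ ≤ 3 log log n, d < 2 (X + 1) ℓ and λ₂ ≤ 2 σ ^ p; the
      -- factor `2 ^ p` comes from `2 * κ*` in the bound on X.
      U≤K : U * 2 ≤ K * ℓ
      U≤K = begin
        (2 * κ*) ^ p * c * 6 * ℓ * 2           ≡⟨ cong (λ x → x * c * 6 * ℓ * 2) (^-distribʳ-* p 2 κ*) ⟩
        2 ^ p * κ* ^ p * c * 6 * ℓ * 2         ≡⟨ regroup (2 ^ p) (κ* ^ p) c ℓ 6 2 ⟩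
        κ* ^ p * (c * 12 * 2 ^ p) * ℓ          ≤⟨ *-monoˡ-≤ ℓ (*-monoʳ-≤ (κ* ^ p) 12c≤C) ⟩
        κ* ^ p * C ^ p * ℓ                     ≡⟨ cong (_* ℓ) (^-distribʳ-* p κ* C) ⟨
        K * ℓ                                  ∎
        where
        open ≤-Reasoning
        regroup : ∀ x y z w a b → x * y * z * a * w * b ≡ y * (z * (a * b) * x) * w
        regroup = solve-∀
      contra : ¬ (r ℚ.< 0ℚ ⊎ (r ^ℚ p) <ᴸ D)
      contra (inj₁ r<0) = ℚ.<-irrefl refl (ℚ.≤-<-trans 0≤κCσ (ℚ.<-trans κCσ<r r<0))
      contra (inj₂ (r₀ , s₀ , r₀<d , L<s₀ , rs₀<r₀)) = ℚ.<-irrefl refl (begin-strict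
        ι (K * ℓ) ℚ.* σ ^ℚ p                   ≡⟨ trans (cong (ℚ._* σ ^ℚ p) (ι-* K ℓ)) (shuffle (ι K) (ι ℓ) (σ ^ℚ p)) ⟩
        ι K ℚ.* σ ^ℚ p ℚ.* ι ℓ                 ≡⟨ cong (ℚ._* ι ℓ) (trans (cong (ℚ._* σ ^ℚ p) (ι-^ (κ* * C) p)) (sym (^ℚ-distrib-* (ι (κ* * C)) σ p))) ⟩
        (ι (κ* * C) ℚ.* σ) ^ℚ p ℚ.* ι ℓ        ≤⟨ *-mono-≤-≥0 (^ℚ-≥0 p 0≤κCσ) (ℚ.≤-trans (ι≥0 ℓ) ℓ≤3s) (^ℚ-mono-≤ p 0≤κCσ (ℚ.<⇒≤ κCσ<r)) ℓ≤3s ⟩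
        r ^ℚ p ℚ.* (ι 3 ℚ.* s₀)                ≡⟨ shuffle′ (r ^ℚ p) (ι 3) s₀ ⟩
        ι 3 ℚ.* (r ^ℚ p ℚ.* s₀)                <⟨ ℚ.*-monoʳ-<-pos (ι 3) (ℚ.<-trans rs₀<r₀ (ℚ.<-trans r₀<d d<)) ⟩
        ι 3 ℚ.* ι (2 * (suc X * ℓ))            ≡⟨ ι-* 3 (2 * (suc X * ℓ)) ⟨
        ι (3 * (2 * (suc X * ℓ)))              ≤⟨ ι-mono-≤ (≤-trans (*-monoʳ-≤ 3 (*-monoʳ-≤ 2 (*-monoˡ-≤ ℓ X≤))) (≤-reflexive (regroup ((2 * κ*) ^ p * c) λ₂ ℓ))) ⟩
        ι (U * λ₂)                             ≡⟨ ι-* U λ₂ ⟩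
        ι U ℚ.* ι λ₂                           ≤⟨ ℚ.*-monoˡ-≤-nonNeg (ι U) {{ℚ.nonNegative (ι≥0 U)}} λ≤ ⟩
        ι U ℚ.* (ι 2 ℚ.* σ ^ℚ p)               ≡⟨ trans (cong (ℚ._* σ ^ℚ p) (ι-* U 2)) (ℚ.*-assoc (ι U) (ι 2) (σ ^ℚ p)) ⟨
        ι (U * 2) ℚ.* σ ^ℚ p                   ≤⟨ ℚ.*-monoʳ-≤-nonNeg (σ ^ℚ p) {{ℚ.nonNegative (^ℚ-≥0 p 0≤σ)}} (ι-mono-≤ U≤K) ⟩
        ι (K * ℓ) ℚ.* σ ^ℚ p                   ∎)
        where
        open ℚ.≤-Reasoning
        ℓ≤3s : ι ℓ ℚ.≤ ι 3 ℚ.* s₀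
        ℓ≤3s = loglog-lower n j 3≤n ≤n {s₀} L<s₀
        shuffle : ∀ x y z → x ℚ.* y ℚ.* z ≡ x ℚ.* z ℚ.* y
        shuffle x y z = trans (ℚ.*-assoc x y z) (trans (cong (x ℚ.*_) (ℚ.*-comm y z)) (sym (ℚ.*-assoc x z y)))
        shuffle′ : ∀ x y z → x ℚ.* (y ℚ.* z) ≡ y ℚ.* (x ℚ.* z)
        shuffle′ x y z = trans (sym (ℚ.*-assoc x y z)) (trans (cong (ℚ._* z) (ℚ.*-comm x y)) (ℚ.*-assoc y x z))
        regroup : ∀ x y z → 3 * (2 * (x * y * z)) ≡ x * 6 * z * y
        regroup = solve-∀

-- The two bounds

scaled : ∀ C .{{_ : NonZero C}} {κ* q ρ} → q ℚ.< (ℤ.+ 1 ℚ./ C) ℚ.* ρ → ρ ℚ.< ι (κ* * C) → q ℚ.< ι κ*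
scaled C {κ*} {q} {ρ} q<ερ ρ< = ℚ.<-trans q<ερ (begin-strict
  (ℤ.+ 1 ℚ./ C) ℚ.* ρ              <⟨ ℚ.*-monoʳ-<-pos (ℤ.+ 1 ℚ./ C) {{ℚ.normalize-pos 1 C}} ρ< ⟩
  (ℤ.+ 1 ℚ./ C) ℚ.* ι (κ* * C)     ≡⟨ /-* 1 C (κ* * C) ⟩
  ℤ.+ (1 * (κ* * C)) ℚ./ C         ≤⟨ /-mono-≤ (1 * (κ* * C)) C κ* 1 (≤-reflexive (regroup κ* C)) ⟩
  ι κ*                             ∎)
  where
  open ℚ.≤-Reasoning
  regroup : ∀ x y → 1 * (x * y) * 1 ≡ x * y
  regroup = solve-∀

-- κ* is the larger of 1 and the largest κ that the density allows; t is the identity or constant.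
exists-piece :
  ∀ {n} (G : Graph n) X i ℓ {{_ : NonZero ℓ}} → 0 < n → n ≤ 2 ^ (2 ^ ℓ) → 0 < edgeCount G → X * (n * ℓ) ≤ edgeCount G → X < 2 ^ suc i →
  ∀ p c (t : ℕ → ℕ) {{_ : NonZero p}} {{_ : NonZero c}} →
  (∀ κ ℓ λ₂ → required κ (t κ) λ₂ ℓ ≡ κ ^ p * c * λ₂ * ℓ) →
  (∀ κ → NonZero κ → NonZero (t κ)) →
  (∀ κ → NonZero κ → completeBipartite (t κ) (t κ) ⊑ G → HasPiece κ G) →
  ∃ λ κ* → HasPiece κ* G × suc X ≤ (2 * κ*) ^ p * c * suc i
exists-piece {n} G X i ℓ 0<n n≤ 0<e Xnℓ≤e X<2^ p c t required≡ t≢0 K-piece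
  with maximal (λ κ → κ ^ p * c * suc i) X (≤-trans (≤-reflexive (cong (λ x → x * c * suc i) (0^ p))) z≤n) grows
  where
  0^ : ∀ p {{_ : NonZero p}} → 0 ^ p ≡ 0
  0^ (suc p) = refl
  grows : ∀ κ → κ ≤ κ ^ p * c * suc i
  grows κ = ≤-trans (m≤m^n p κ) (≤-trans (m≤m*n (κ ^ p) c) (m≤m*n (κ ^ p * c) (suc i)))
... | κ , cost≤X , X< = by-size (κ ≟ 0)
  where
  λ₂ = suc i
  by-size : Dec (κ ≡ 0) → ∃ λ κ* → HasPiece κ* G × suc X ≤ (2 * κ*) ^ p * c * λ₂
  by-size (yes κ≡0) = 1 , edge-piece G 0<e ,
    ≤-trans X< (*-monoˡ-≤ λ₂ (*-monoˡ-≤ c (^-monoˡ-≤ p (≤-trans (s≤s (≤-reflexive κ≡0)) (s≤s z≤n)))))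
  by-size (no κ≢0) = κ , [ id , K-piece κ (≢-nonZero κ≢0) ]′ found ,
    ≤-trans X< (*-monoˡ-≤ λ₂ (*-monoˡ-≤ c (^-monoˡ-≤ p (+-mono-≤ (n≢0⇒n>0 κ≢0) (≤-reflexive (sym (+-identityʳ κ)))))))
    where
    -- As κ is at most its own cost, it is at most X, so the logarithm of the density also bounds
    -- that of κ.
    κ≤ : κ ≤ 2 ^ λ₂
    κ≤ = ≤-trans (≤-trans (m≤m^n p κ) (≤-trans (m≤m*n (κ ^ p) c) (m≤m*n (κ ^ p * c) λ₂))) (≤-trans cost≤X (<⇒≤ X<2^))
    found : HasPiece κ G ⊎ (completeBipartite (t κ) (t κ) ⊑ G)
    found = very-dense⇒piece G κ {{≢-nonZero κ≢0}} (t κ) {{t≢0 κ (≢-nonZero κ≢0)}} λ₂ ℓ κ≤ n≤ 0<n (begin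
      n * required κ (t κ) λ₂ ℓ          ≡⟨ cong (n *_) (required≡ κ ℓ λ₂) ⟩
      n * (κ ^ p * c * λ₂ * ℓ)           ≡⟨ regroup n (κ ^ p * c * λ₂) ℓ ⟩
      κ ^ p * c * λ₂ * (n * ℓ)           ≤⟨ *-monoˡ-≤ (n * ℓ) cost≤X ⟩
      X * (n * ℓ)                        ≤⟨ Xnℓ≤e ⟩
      edgeCount G                        ∎)
      where
      open ≤-Reasoning
      regroup : ∀ x y z → x * (y * z) ≡ y * (x * z)
      regroup = solve-∀

-- The common form of both bounds, with p = 4 and t = κ, or p = 2 and constant t. The assumption on
-- x unfolds a rational below (1 / C) · (D ^ (1 / p) / y): ρ lies below the quotient, σ above the
-- denominator y, r below the root and s above log D.
regular-subgraph :
  ∀ p c C (t : ℕ → ℕ) {{_ : NonZero p}} {{_ : NonZero c}} {{_ : NonZero C}} → c * 12 * 2 ^ p ≤ C ^ p →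
  (∀ κ ℓ λ₂ → required κ (t κ) λ₂ ℓ ≡ κ ^ p * c * λ₂ * ℓ) → (∀ κ → NonZero κ → NonZero (t κ)) →
  ∀ n .{{_ : NonZero n}} → 3 ≤ n → (G : Graph n) →
  (∀ κ → NonZero κ → completeBipartite (t κ) (t κ) ⊑ G → HasPiece κ G) →
  let d = fromℚ (averageDegree G)
      D = d ÷ loglog n
  in 2ℚ · loglog n ≤ᴿ d → ∀ x →
     (∀ {q} → q <ᴸ x → ∃₂ λ ρ σ → ∃₂ λ r s → q ℚ.< (ℤ.+ 1 ℚ./ C) ℚ.* ρ ×
        log₂ D <ᵁ s × (1ℚ ℚ.≤ s → 0ℚ ℚ.< σ × s ℚ.≤ σ ^ℚ p) × ρ ℚ.* σ ℚ.< r × r <ᴸ root p D) →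
     HasAlmostRegularSubgraph 64 G x
regular-subgraph p c C t 12c≤C required≡ t≢0 n 3≤n G K-piece d≥2L x below-x =
  at-scale (loglog-scale n 3≤n)
  where
  Result = HasAlmostRegularSubgraph 64 G x
  0<d : 0ℚ ℚ.< averageDegree G
  0<d = d≥2L (½ , loglog-positive n 3≤n , ι-mono-< {0} {1} (s≤s z≤n))
  at-scale : (∃ λ j → 2 ^ (2 ^ j) ≤ n × n ≤ 2 ^ (2 ^ suc j)) → Result
  at-scale (j , ≤n , n≤) = at-quotient (quotient-scale (edgeCount G) (n * suc j) {{m*n≢0 n (suc j)}})
    where
    at-quotient : (∃ λ X → X * (n * suc j) ≤ edgeCount G × edgeCount G < suc X * (n * suc j)) → Result
    at-quotient (X , Xnℓ≤e , e<) = at-log (log-scale X)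
      where
      at-log : (∃ λ i → (i ≡ 0 ⊎ 2 ^ i ≤ X) × X < 2 ^ suc i) → Result
      at-log (i , i-scale , X<2^) =
        found (exists-piece G X i (suc j) (≤-trans (s≤s z≤n) 3≤n) n≤ (0<edgeCount G 0<d) Xnℓ≤e X<2^ p c t required≡ t≢0 K-piece)
        where
        open Ratio n 3≤n (averageDegree G) d≥2L j ≤n n≤ X (averageDegree-≥ G X (suc j) Xnℓ≤e) (averageDegree-< G (suc X) (suc j) e<) i i-scale
        found : (∃ λ κ* → HasPiece κ* G × suc X ≤ (2 * κ*) ^ p * c * suc i) → Result
        found (κ* , piece , X≤) = piece⇒subgraph {κ = κ*} {x} {G} piece (λ {q} q<x → below-κ* q (below-x q<x))
          where
          below-κ* : ∀ q → _ → q ℚ.< ι κ*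
          below-κ* q (ρ , σ , r , s , q<ερ , logD<s , σ-large , ρσ<r , r<root) =
            let 1≤s , λ≤2s = logD-lower logD<s
                0<σ , s≤σ^p = σ-large 1≤s
                λ≤2σ^p = ℚ.≤-trans λ≤2s (ℚ.*-monoˡ-≤-nonNeg (ι 2) s≤σ^p)
            in scaled C {κ*} {ρ = ρ} q<ερ (bound p c C κ* 12c≤C X≤ ρ σ r 0<σ λ≤2σ^p ρσ<r r<root)

≥1⇒≤² : ∀ {x} → 1ℚ ℚ.≤ x → x ℚ.≤ x ℚ.* x
≥1⇒≤² {x} 1≤x = ℚ.≤-trans (ℚ.≤-reflexive (sym (ℚ.*-identityʳ x)))
  (ℚ.*-monoˡ-≤-nonNeg x {{ℚ.nonNegative (ℚ.≤-trans (ι≥0 1) 1≤x)}} 1≤x)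

general-case : ∀ n .{{_ : NonZero n}} → 3 ≤ n → (G : Graph n) →
  let d = fromℚ (averageDegree G) in 2ℚ · loglog n ≤ᴿ d →
  HasAlmostRegularSubgraph 64 G ((ℤ.+ 1 ℚ./ 512) · (root 4 (d ÷ loglog n) ÷ root 2 (log₂ (d ÷ loglog n))))
-- 512 is the least power of two whose fourth power, here 2 ^ 36, reaches 2 ^ 27 · 12 · 2 ^ 4.
general-case n 3≤n G d≥2L = regular-subgraph 4 134217728 512 id (≤ᵇ⇒≤ 25769803776 68719476736 _)
  (λ κ ℓ λ₂ → regroup κ λ₂ ℓ 134217728) (λ _ κ≢0 → κ≢0) n 3≤n G (λ κ κ≢0 → completeBipartite-piece G κ {{κ≢0}}) d≥2L
  ((ℤ.+ 1 ℚ./ 512) · (root 4 D ÷ root 2 (log₂ D)))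
  (λ { (ρ , (r , σ , r<root , (0<σ , logD<σ²) , ρσ<r) , q<ερ) →
       ρ , σ , r , σ ^ℚ 2 , q<ερ , logD<σ² ,
       -- The cost of a piece only calls for the power 1/4 of log D. As log D ≥ 1, the square root
       -- in the denominator dominates it: σ ^ 2 ≤ σ ^ 4.
       (λ 1≤σ² → 0<σ , ℚ.≤-trans (≥1⇒≤² 1≤σ²) (ℚ.≤-reflexive (sym (^ℚ-homo-* σ 2 2)))) , ρσ<r , r<root })
  where
  D = fromℚ (averageDegree G) ÷ loglog n
  regroup : ∀ x y z m → x * x * (x * x) * (y * z) * m ≡ x * (x * (x * (x * 1))) * m * y * z
  regroup = solve-∀

K-free-case : ∀ t {{_ : NonZero t}} n .{{_ : NonZero n}} → 3 ≤ n → (G : Graph n) → ¬ (completeBipartite t t ⊑ G) →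
  let d = fromℚ (averageDegree G) in 2ℚ · loglog n ≤ᴿ d →
  HasAlmostRegularSubgraph 64 G ((ℚ._/_ (ℤ.+ 1) (t * 131072) {{m*n≢0 t 131072}}) · (root 2 (d ÷ loglog n) ÷ log₂ (d ÷ loglog n)))
-- 131072 = 2 ^ 17 is the least power of two whose square reaches 2 ^ 27 · 12 · 2 ^ 2; the factor
-- `t * t` of the cost becomes t under the square root.
K-free-case t {{t≢0}} n 3≤n G K⋢G d≥2L = regular-subgraph 2 (t * t * 134217728) (t * 131072) (λ _ → t)
  {{_}} {{m*n≢0 (t * t) 134217728 {{m*n≢0 t t}}}} {{m*n≢0 t 131072}} 12c≤C
  (λ κ ℓ λ₂ → regroup κ t λ₂ ℓ 134217728) (λ _ _ → t≢0) n 3≤n G (λ _ _ K⊑G → contradiction K⊑G K⋢G) d≥2L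
  ((ℚ._/_ (ℤ.+ 1) (t * 131072) {{m*n≢0 t 131072}}) · (root 2 D ÷ log₂ D))
  (λ { (ρ , (r , s , r<root , logD<s , ρs<r) , q<ερ) →
       ρ , s , r , s , q<ερ , logD<s ,
       (λ 1≤s → ℚ.<-≤-trans (ι-mono-< {0} {1} (s≤s z≤n)) 1≤s , ℚ.≤-trans (≥1⇒≤² 1≤s) (ℚ.≤-reflexive (cong (s ℚ.*_) (sym (ℚ.*-identityʳ s))))) , ρs<r , r<root })
  where
  D = fromℚ (averageDegree G) ÷ loglog n
  12c≤C : t * t * 134217728 * 12 * 4 ≤ (t * 131072) ^ 2
  12c≤C = begin
    t * t * 134217728 * 12 * 4         ≡⟨ regroup₁ (t * t) 134217728 12 4 ⟩
    t * t * 6442450944                 ≤⟨ *-monoʳ-≤ (t * t) (≤ᵇ⇒≤ 6442450944 17179869184 _) ⟩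
    t * t * 17179869184                ≡⟨ regroup₂ t 131072 ⟩
    (t * 131072) ^ 2                   ∎
    where
    open ≤-Reasoning
    regroup₁ : ∀ x i j k → x * i * j * k ≡ x * (i * j * k)
    regroup₁ = solve-∀
    regroup₂ : ∀ x i → x * x * (i * i) ≡ x * i * (x * i * 1)
    regroup₂ = solve-∀
  regroup : ∀ x y z w m → x * x * (y * y) * (z * w) * m ≡ x * (x * 1) * (y * y * m) * z * w
  regroup = solve-∀

theorem6p4 :
  (∃ λ (ε : ℚ) → 0ℚ ℚ.< ε ×
    (∀ (n : ℕ) .{{_ : NonZero n}} → 3 ≤ n → (G : Graph n) →
      let d = fromℚ (averageDegree G)
          loglogn = log₂ (log₂ (fromℕ n))
      in 2ℚ · loglogn ≤ᴿ d →
         HasAlmostRegularSubgraph 64 G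
           (ε · (root 4 (d ÷ loglogn) ÷ root 2 (log₂ (d ÷ loglogn))))))
  ×
  (∀ (t : ℕ) .{{_ : NonZero t}} →
    ∃ λ (ε : ℚ) → 0ℚ ℚ.< ε ×
      (∀ (n : ℕ) .{{_ : NonZero n}} → 3 ≤ n → (G : Graph n) →
        ¬ (completeBipartite t t ⊑ G) →
        let d = fromℚ (averageDegree G)
            loglogn = log₂ (log₂ (fromℕ n))
        in 2ℚ · loglogn ≤ᴿ d →
           HasAlmostRegularSubgraph 64 G
             (ε · (root 2 (d ÷ loglogn) ÷ log₂ (d ÷ loglogn)))))
theorem6p4 = (ℤ.+ 1 ℚ./ 512 , /-mono-< 0 1 1 512 (<ᵇ⇒< 0 1 _) , general-case) ,
  λ t → ℚ._/_ (ℤ.+ 1) (t * 131072) {{m*n≢0 t 131072}} , /-mono-< 0 1 1 (t * 131072) {{_}} {{m*n≢0 t 131072}} (s≤s z≤n) , K-free-case t {{>-nonZero (>-nonZero⁻¹ t)}}
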